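{- Fix an integer $r\ge2$ and a real $K>1$, and let $p=p(n)$ be integer-valued with $p=\Theta(\log n)$. Then the minimum of $W_n(H_A(n))$ and the minimum of $C_n(H_A(n))$, each taken over all multiplicatively independent sets $A\subseteq\{2,\dots,n-1\}$ of $r$ generators with $\gcd(A)=1$, $\max A\le(\min A)^K$ and $|H_A(n)|\le p$, are both $$n\exp\!\left(\Theta\big((\log n)^{1-1/r}\big)\right)\qquad(n\to\infty),$$ where the implied constants depend only on $r$, $K$ and the constants in $p=\Theta(\log n)$. In particular, for $r=2,3,4$ the factor beyond $n$ is respectively $\exp(\Theta(\sqrt{\log n}))$, $\exp(\Theta((\log n)^{2/3}))$, $\exp(\Theta((\log n)^{3/4}))$. Thus, among these classes with a fixed number $r\ge2$ of independent generators, two generators are optimal: for every fixed $r\ge3$ the minimum cost is asymptotically larger than for $r=2$.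
   Context: Shellsort: a gap sequence is a decreasing sequence of positive integers $H=(h_1>h_2>\cdots>h_p=1)$. On an array of $n$ distinct keys (a permutation), pass $j$ runs ordinary insertion sort separately on each $h_j$-chain, i.e. on each set of positions with the same remainder modulo $h_j$: the key is repeatedly compared with the key $h_j$ positions before it, exchanging the two if they are out of order, until no exchange is needed or the start of the chain is reached. Passes are run for $j=1,2,\dots,p$. $W_n(H)$ and $C_n(H)$ are the worst-case (over all inputs of $n$ keys) total numbers of exchanges and of comparisons. Product grids: for a set $A=\{a_1,\dots,a_r\}\subseteq\{2,\dots,n-1\}$ of generators, $H_A(n)=\{\prod_{i=1}^r a_i^{u_i}<n:\ u_i\in\mathbb N_0\}$ (as a set, duplicates removed), used as a gap sequence in decreasing order. The set $A$ is multiplicatively independent if distinct exponent vectors $(u_1,\dots,u_r)\in\mathbb N_0^r$ give distinct products $\prod a_i^{u_i}$. Logarithms are natural. -}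

module Defs where

open import Level using (Level)
open import Data.Nat.Base as ℕ using (ℕ; zero; suc; NonZero; _!; _∸_)
open import Data.Nat.Properties as ℕₚ using (_!≢0)
import Data.Nat.GCD as ℕ using (gcd)
open import Data.Integer.Base as ℤ using (+_)
import Data.Integer.Properties as ℤₚ
open import Data.Rational.Base as ℚ
  using (ℚ; 0ℚ; 1ℚ; ½; _/_; _+_; _*_; _≤_; _<_; _⊔_; NonNegative; nonNegative)
import Data.Rational.Properties as ℚₚ
import Data.Rational.Unnormalised.Base as ℚᵘ
import Data.Rational.Unnormalised.Properties as ℚᵘₚ
open import Data.Fin.Base using (Fin; fromℕ<)
open import Data.Fin.Permutation.Components using (transpose)
open import Data.List.Base as List using (List; []; _∷_; upTo; downFrom)
open import Data.List.Membership.Propositional using (_∈_)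
open import Data.List.Membership.Propositional.Properties
  using (∈-filter⁺; ∈-filter⁻; ∈-map⁺; ∈-map⁻; ∈-downFrom⁺; ∈-downFrom⁻;
         ∈-cartesianProductWith⁺; ∈-upTo⁺)
open import Data.List.Membership.DecPropositional ℕₚ._≟_ using (_∈?_)
open import Data.List.Relation.Unary.Any using (here)
open import Data.Vec.Base as Vec using (Vec; []; _∷_; lookup; zipWith; foldr′)
open import Data.Vec.Relation.Unary.All as All using (All; []; _∷_)
open import Data.Vec.Relation.Unary.Unique.Propositional using (Unique)
open import Data.Vec.Relation.Unary.AllPairs using (allPairs?)
open import Data.Product.Base using (∃; ∃-syntax; _×_; _,_; proj₁; proj₂)
open import Data.Sum.Base using (_⊎_; inj₁; inj₂)
open import Data.Empty using (⊥-elim)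
open import Function.Base using (_∘_; _on_)
open import Function.Bundles using (_⇔_; mk⇔)
open import Relation.Nullary using (¬_; Dec; yes; no; ¬?)
open import Relation.Unary using (Decidable)
open import Relation.Binary.PropositionalEquality
  using (_≡_; refl; sym; trans; cong; cong₂; subst)

open import Algebra.Definitions.RawSemiring ℚₚ.+-*-rawSemiring public
  using () renaming (_^_ to _^ℚ_)

private variable
  ℓ : Level
  n r : ℕ

------------------------------------------------------------------------
-- Rational arithmetic used to bound the cuts below

private
  module ≤R = ℚₚ.≤-Reasoning

  fromNat : ℕ → ℚ
  fromNat m = + m / 1

  0≤* : ∀ {p q} → 0ℚ ≤ p → 0ℚ ≤ q → 0ℚ ≤ p * q
  0≤* {p} {q} hp hq = ℚₚ.nonNegative⁻¹ (p * q)
    {{ℚₚ.nonNeg*nonNeg⇒nonNeg p {{nonNegative hp}} q {{nonNegative hq}}}}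

  *-mono : ∀ {p q u v} → 0ℚ ≤ p → 0ℚ ≤ v → p ≤ q → u ≤ v → p * u ≤ q * v
  *-mono {p} {q} {u} {v} 0≤p 0≤v p≤q u≤v = ℚₚ.≤-trans
    (ℚₚ.*-monoˡ-≤-nonNeg p {{nonNegative 0≤p}} u≤v)
    (ℚₚ.*-monoʳ-≤-nonNeg v {{nonNegative 0≤v}} p≤q)

  0≤1 : 0ℚ ≤ 1ℚ
  0≤1 = ℚₚ.nonNegative⁻¹ 1ℚ

  0≤½ : 0ℚ ≤ ½
  0≤½ = ℚₚ.nonNegative⁻¹ ½

  0≤^ : ∀ {q} k → 0ℚ ≤ q → 0ℚ ≤ q ^ℚ k
  0≤^ zero    _ = 0≤1
  0≤^ (suc k) h = 0≤* h (0≤^ k h)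

  ^-mono : ∀ {p q} k → 0ℚ ≤ p → p ≤ q → p ^ℚ k ≤ q ^ℚ k
  ^-mono zero    _ _ = ℚₚ.≤-refl
  ^-mono (suc k) 0≤p p≤q =
    *-mono 0≤p (0≤^ k (ℚₚ.≤-trans 0≤p p≤q)) p≤q (^-mono k 0≤p p≤q)

  1≤^ : ∀ {q} k → 1ℚ ≤ q → 1ℚ ≤ q ^ℚ k
  1≤^ zero    _ = ℚₚ.≤-refl
  1≤^ (suc k) h =
    *-mono {1ℚ} {_} {1ℚ} 0≤1 (0≤^ k (ℚₚ.≤-trans 0≤1 h)) h (1≤^ k h)

  ^-+ : ∀ q j k → q ^ℚ (j ℕ.+ k) ≡ q ^ℚ j * q ^ℚ k
  ^-+ q zero    k = sym (ℚₚ.*-identityˡ _)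
  ^-+ q (suc j) k = trans (cong (q *_) (^-+ q j k)) (sym (ℚₚ.*-assoc q _ _))

  *-swap : ∀ a b c d → (a * b) * (c * d) ≡ (a * c) * (b * d)
  *-swap a b c d = trans (ℚₚ.*-assoc a b (c * d)) (trans
    (cong (a *_) (trans (sym (ℚₚ.*-assoc b c d)) (trans
      (cong (_* d) (ℚₚ.*-comm b c)) (ℚₚ.*-assoc c b d))))
    (sym (ℚₚ.*-assoc a c (b * d))))

  *-^ : ∀ p q k → (p * q) ^ℚ k ≡ p ^ℚ k * q ^ℚ k
  *-^ p q zero    = refl
  *-^ p q (suc k) =
    trans (cong ((p * q) *_) (*-^ p q k)) (*-swap p q (p ^ℚ k) (q ^ℚ k))

  ^-* : ∀ q j k → q ^ℚ (j ℕ.* k) ≡ (q ^ℚ j) ^ℚ k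
  ^-* q j zero    = cong (q ^ℚ_) (ℕₚ.*-zeroʳ j)
  ^-* q j (suc k) = trans (cong (q ^ℚ_) (ℕₚ.*-suc j k))
    (trans (^-+ q j (j ℕ.* k)) (cong (q ^ℚ j *_) (^-* q j k)))

  ^-monoʳ : ∀ {q j k} → 1ℚ ≤ q → j ℕ.≤ k → q ^ℚ j ≤ q ^ℚ k
  ^-monoʳ {q} {j} {k} 1≤q j≤k = begin
    q ^ℚ j                   ≡⟨ sym (ℚₚ.*-identityʳ _) ⟩
    q ^ℚ j * 1ℚ              ≤⟨ *-mono (0≤^ j 0≤q) (0≤^ (k ∸ j) 0≤q) ℚₚ.≤-refl (1≤^ (k ∸ j) 1≤q) ⟩
    q ^ℚ j * q ^ℚ (k ∸ j)    ≡⟨ sym (^-+ q j (k ∸ j)) ⟩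
    q ^ℚ (j ℕ.+ (k ∸ j))     ≡⟨ cong (q ^ℚ_) (ℕₚ.m+[n∸m]≡n j≤k) ⟩
    q ^ℚ k                   ∎
    where open ≤R
          0≤q = ℚₚ.≤-trans 0≤1 1≤q

  /-≤ : ∀ i j d e .{{_ : NonZero d}} .{{_ : NonZero e}} →
        (i ℕ.* e) ℕ.≤ (j ℕ.* d) → + i / d ≤ + j / e
  /-≤ i j d@(suc _) e@(suc _) h = ℚₚ.toℚᵘ-cancel-≤ (ℚᵘₚ.≤-trans
    (ℚᵘₚ.≤-reflexive (ℚₚ.toℚᵘ-fromℚᵘ (+ i ℚᵘ./ d)))
    (ℚᵘₚ.≤-trans (ℚᵘ.*≤* (subst₂≤ (ℤ.+≤+ h)))
    (ℚᵘₚ.≤-reflexive (ℚᵘₚ.≃-sym (ℚₚ.toℚᵘ-fromℚᵘ (+ j ℚᵘ./ e))))))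
    where
    subst₂≤ : (+ (i ℕ.* e)) ℤ.≤ (+ (j ℕ.* d)) → (+ i ℤ.* + e) ℤ.≤ (+ j ℤ.* + d)
    subst₂≤ x = subst (ℤ._≤ (+ j ℤ.* + d)) (ℤₚ.pos-* i e)
                  (subst ((+ (i ℕ.* e)) ℤ.≤_) (ℤₚ.pos-* j d) x)

  /-≤⁻ : ∀ i j d e .{{_ : NonZero d}} .{{_ : NonZero e}} →
         + i / d ≤ + j / e → (i ℕ.* e) ℕ.≤ (j ℕ.* d)
  /-≤⁻ i j d@(suc _) e@(suc _) h = ℤₚ.drop‿+≤+
    (subst (ℤ._≤ (+ (j ℕ.* d))) (sym (ℤₚ.pos-* i e))
      (subst ((+ i ℤ.* + e) ℤ.≤_) (sym (ℤₚ.pos-* j d)) (ℚᵘₚ.drop-*≤*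
        (ℚᵘₚ.≤-trans (ℚᵘₚ.≤-reflexive (ℚᵘₚ.≃-sym (ℚₚ.toℚᵘ-fromℚᵘ (+ i ℚᵘ./ d))))
        (ℚᵘₚ.≤-trans (ℚₚ.toℚᵘ-mono-≤ h)
        (ℚᵘₚ.≤-reflexive (ℚₚ.toℚᵘ-fromℚᵘ (+ j ℚᵘ./ e))))))))

  /-* : ∀ i j d e .{{_ : NonZero d}} .{{_ : NonZero e}} .{{_ : NonZero (d ℕ.* e)}} →
        (+ (i ℕ.* j)) / (d ℕ.* e) ≡ (+ i / d) * (+ j / e)
  /-* i j d@(suc _) e@(suc _) = ℚₚ.toℚᵘ-injective (ℚᵘₚ.≃-trans
    (ℚₚ.toℚᵘ-fromℚᵘ ((+ (i ℕ.* j)) ℚᵘ./ (d ℕ.* e))) (ℚᵘₚ.≃-trans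
    (ℚᵘₚ.≃-reflexive (cong (ℚᵘ._/ (d ℕ.* e)) (ℤₚ.pos-* i j)))
    (ℚᵘₚ.≃-sym (ℚᵘₚ.≃-trans (ℚₚ.toℚᵘ-homo-* (+ i / d) (+ j / e))
      (ℚᵘₚ.*-cong (ℚₚ.toℚᵘ-fromℚᵘ (+ i ℚᵘ./ d)) (ℚₚ.toℚᵘ-fromℚᵘ (+ j ℚᵘ./ e)))))))

  archimedean : ∀ q → ∃[ m ] q ≤ fromNat m
  archimedean q@(ℚ.mkℚ (+ i) d _) = i ,
    subst (_≤ fromNat i) (ℚₚ.↥p/↧p≡p q)
      (/-≤ i i (suc d) 1 (ℕₚ.*-monoʳ-≤ i (ℕ.s≤s ℕ.z≤n)))
  archimedean (ℚ.mkℚ (ℤ.-[1+ _ ]) _ _) = 0 , ℚₚ.nonPositive⁻¹ _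

------------------------------------------------------------------------
-- Non-negative real numbers as (lower) Dedekind cuts of ℚ.  Classically these
-- are exactly the reals x ≥ 0, with q ∈ lower x iff q < x; no locatedness is
-- demanded.

record ℝ≥0 : Set₁ where
  field
    lower    : ℚ → Set
    negative : ∀ {q} → q < 0ℚ → lower q
    downward : ∀ {p q} → p ≤ q → lower q → lower p
    rounded  : ∀ {q} → lower q → ∃[ s ] q < s × lower s
    bounded  : ∃[ b ] ∀ {q} → lower q → q ≤ b

open ℝ≥0 public

infix 4 _≤ᴿ_ _<ᴿ_

_≤ᴿ_ : ℝ≥0 → ℝ≥0 → Set
x ≤ᴿ y = ∀ {q} → lower x q → lower y q

_<ᴿ_ : ℝ≥0 → ℝ≥0 → Set
x <ᴿ y = ∃[ q ] lower y q × ¬ lower x q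

-- The supremum of S ∪ {0}.
sup : (S : ℚ → Set) → (∃[ b ] ∀ {s} → S s → s ≤ b) → ℝ≥0
sup S (b , S≤b) = record
  { lower    = λ q → q < 0ℚ ⊎ ∃[ s ] S s × q < s
  ; negative = inj₁
  ; downward = λ { p≤q (inj₁ q<0)           → inj₁ (ℚₚ.≤-<-trans p≤q q<0)
                 ; p≤q (inj₂ (s , Ss , q<s)) → inj₂ (s , Ss , ℚₚ.≤-<-trans p≤q q<s) }
  ; rounded  = λ { (inj₁ q<0) → let t , q<t , t<0 = ℚₚ.<-dense q<0 in t , q<t , inj₁ t<0
                 ; (inj₂ (s , Ss , q<s)) →
                     let t , q<t , t<s = ℚₚ.<-dense q<s in t , q<t , inj₂ (s , Ss , t<s) }
  ; bounded  = b ⊔ 0ℚ ,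
      λ { (inj₁ q<0) → ℚₚ.≤-trans (ℚₚ.<⇒≤ q<0) (ℚₚ.p≤q⊔p b 0ℚ)
        ; (inj₂ (s , Ss , q<s)) →
            ℚₚ.≤-trans (ℚₚ.<⇒≤ q<s) (ℚₚ.≤-trans (S≤b Ss) (ℚₚ.p≤p⊔q b 0ℚ)) }
  }

-- Negative rationals are sent to 0.
fromℚ : ℚ → ℝ≥0
fromℚ a = sup (_≡ a) (a , λ { refl → ℚₚ.≤-refl })

fromℕ : ℕ → ℝ≥0
fromℕ m = fromℚ (+ m / 1)

private
  fromℚ-≤⇒≤ : ∀ {a b} → fromℚ a ≤ᴿ fromℚ b → 0ℚ ≤ b → a ≤ b
  fromℚ-≤⇒≤ {a} {b} a≤b 0≤b with a ℚₚ.≤? b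
  ... | yes p = p
  ... | no ¬p with ℚₚ.<-dense (ℚₚ.≰⇒> ¬p)
  ...   | t , b<t , t<a with a≤b (inj₂ (a , refl , t<a))
  ...     | inj₁ t<0             = ⊥-elim (ℚₚ.<-irrefl refl (ℚₚ.<-trans (ℚₚ.≤-<-trans 0≤b b<t) t<0))
  ...     | inj₂ (_ , refl , t<b) = ⊥-elim (ℚₚ.<-irrefl refl (ℚₚ.<-trans b<t t<b))

  bound : ℝ≥0 → ℕ
  bound x = suc (proj₁ (archimedean (proj₁ (bounded x))))

  ≤bound : ∀ x {a} → fromℚ a ≤ᴿ x → a ≤ fromNat (bound x)
  ≤bound x {a} a≤x = ℚₚ.≤-trans (fromℚ-≤⇒≤ step 0≤m)
    (/-≤ m (suc m) 1 1 (ℕₚ.*-monoˡ-≤ 1 (ℕₚ.n≤1+n m)))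
    where
    b = proj₁ (bounded x)
    m = proj₁ (archimedean b)
    0≤m : 0ℚ ≤ fromNat m
    0≤m = /-≤ 0 m 1 1 ℕ.z≤n
    step : fromℚ a ≤ᴿ fromℚ (fromNat m)
    step q∈a with rounded x (a≤x q∈a)
    ... | s , q<s , s∈x = inj₂ (fromNat m , refl ,
      ℚₚ.<-≤-trans q<s (ℚₚ.≤-trans (proj₂ (bounded x) s∈x) (proj₂ (archimedean b))))

infixl 7 _*ᴿ_

_*ᴿ_ : ℝ≥0 → ℝ≥0 → ℝ≥0
x *ᴿ y = sup
  (λ q → ∃[ a ] ∃[ b ] 0ℚ ≤ a × 0ℚ ≤ b × fromℚ a ≤ᴿ x × fromℚ b ≤ᴿ y × q ≡ a * b)
  (fromNat (bound x) * fromNat (bound y) ,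
   λ { (a , b , 0≤a , 0≤b , a≤x , b≤y , refl) →
         *-mono 0≤a (ℚₚ.≤-trans 0≤b (≤bound y b≤y)) (≤bound x a≤x) (≤bound y b≤y) })

------------------------------------------------------------------------
-- Exponential, natural logarithm and powers

-- expSum a k = Σ_{i<k} aⁱ / i!
expSum : ℚ → ℕ → ℚ
expSum a zero    = 0ℚ
expSum a (suc k) = expSum a k + a ^ℚ k * (_/_ (+ 1) (k !) {{k !≢0}})

private
  1/!≤1 : ∀ k → _/_ (+ 1) (k !) {{k !≢0}} ≤ 1ℚ
  1/!≤1 k = /-≤ 1 1 (k !) 1 {{k !≢0}} (subst (1 ℕ.≤_) (sym (ℕₚ.*-identityˡ (k !)))
              (ℕ.>-nonZero⁻¹ (k !) {{k !≢0}}))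

  0≤1/! : ∀ k → 0ℚ ≤ _/_ (+ 1) (k !) {{k !≢0}}
  0≤1/! k = /-≤ 0 1 1 (k !) {{_}} {{k !≢0}} ℕ.z≤n

  ^/!-bound : ∀ m k → let N = fromNat (suc m) in
              N ^ℚ k * (_/_ (+ 1) (k !) {{k !≢0}}) ≤ N ^ℚ suc m
  ^/!-bound m k = go k (k ℕₚ.≤? suc m)
    where
    open ≤R
    N = fromNat (suc m)
    1≤N : 1ℚ ≤ N
    1≤N = /-≤ 1 (suc m) 1 1 (ℕ.s≤s ℕ.z≤n)
    0≤N = ℚₚ.≤-trans 0≤1 1≤N
    go : ∀ k → Dec (k ℕ.≤ suc m) → N ^ℚ k * (_/_ (+ 1) (k !) {{k !≢0}}) ≤ N ^ℚ suc m
    go k (yes k≤) = begin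
      N ^ℚ k * (_/_ (+ 1) (k !) {{k !≢0}})
        ≤⟨ *-mono (0≤^ k 0≤N) 0≤1 ℚₚ.≤-refl (1/!≤1 k) ⟩
      N ^ℚ k * 1ℚ   ≡⟨ ℚₚ.*-identityʳ _ ⟩
      N ^ℚ k        ≤⟨ ^-monoʳ 1≤N k≤ ⟩
      N ^ℚ suc m    ∎
    go zero (no k≰) = ⊥-elim (k≰ ℕ.z≤n)
    go (suc k) (no k≰) = begin
      N ^ℚ suc k * (_/_ (+ 1) (suc k !) {{suc k !≢0}})
        ≡⟨ cong (N ^ℚ suc k *_) (/-* 1 1 (suc k) (k !) {{_}} {{k !≢0}} {{suc k !≢0}}) ⟩
      (N * N ^ℚ k) * ((+ 1 / suc k) * (_/_ (+ 1) (k !) {{k !≢0}}))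
        ≡⟨ *-swap N (N ^ℚ k) _ _ ⟩
      (N * (+ 1 / suc k)) * (N ^ℚ k * (_/_ (+ 1) (k !) {{k !≢0}}))
        ≤⟨ *-mono (0≤* 0≤N (/-≤ 0 1 1 (suc k) ℕ.z≤n)) (0≤^ (suc m) 0≤N) N/k≤1 (go k (k ℕₚ.≤? suc m)) ⟩
      1ℚ * N ^ℚ suc m   ≡⟨ ℚₚ.*-identityˡ _ ⟩
      N ^ℚ suc m        ∎
      where
      N/k≤1 : N * (+ 1 / suc k) ≤ 1ℚ
      N/k≤1 = subst (_≤ 1ℚ) (/-* (suc m) 1 1 (suc k))
        (/-≤ (suc m ℕ.* 1) 1 (1 ℕ.* suc k) 1
          (subst₂ (ℕₚ.<⇒≤ (ℕₚ.≰⇒> k≰))))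
        where
        subst₂ : suc m ℕ.≤ suc k → suc m ℕ.* 1 ℕ.* 1 ℕ.≤ 1 ℕ.* (1 ℕ.* suc k)
        subst₂ h rewrite ℕₚ.*-identityʳ (suc m ℕ.* 1) | ℕₚ.*-identityʳ (suc m)
                       | ℕₚ.*-identityˡ (1 ℕ.* suc k) | ℕₚ.*-identityˡ (suc k) = h

  expSum-bound : ∀ m a k → 0ℚ ≤ a → a ≤ fromNat m →
                 expSum a k ≤ (1ℚ + 1ℚ) * fromNat (suc (m ℕ.+ m)) ^ℚ suc (m ℕ.+ m)
  expSum-bound m a k 0≤a a≤m = ℚₚ.≤-trans
    (subst (_≤ expSum a k + D * ½ ^ℚ k) (ℚₚ.+-identityʳ _)
      (ℚₚ.+-monoʳ-≤ (expSum a k) (0≤* 0≤D (0≤^ k 0≤½))))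
    (go k)
    where
    open ≤R
    N = fromNat (suc (m ℕ.+ m))
    0≤N : 0ℚ ≤ N
    0≤N = /-≤ 0 (suc (m ℕ.+ m)) 1 1 ℕ.z≤n
    E = N ^ℚ suc (m ℕ.+ m)
    D = (1ℚ + 1ℚ) * E
    0≤E : 0ℚ ≤ E
    0≤E = 0≤^ (suc (m ℕ.+ m)) 0≤N
    0≤D : 0ℚ ≤ D
    0≤D = 0≤* (ℚₚ.+-mono-≤ 0≤1 0≤1) 0≤E

    a≤½N : a ≤ ½ * N
    a≤½N = ℚₚ.≤-trans a≤m (subst (fromNat m ≤_) (/-* 1 (suc (m ℕ.+ m)) 2 1)
      (/-≤ m (1 ℕ.* suc (m ℕ.+ m)) 1 2 h))
      where
      h : m ℕ.* 2 ℕ.≤ 1 ℕ.* suc (m ℕ.+ m) ℕ.* 1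
      h rewrite ℕₚ.*-identityʳ (1 ℕ.* suc (m ℕ.+ m)) | ℕₚ.*-identityˡ (suc (m ℕ.+ m))
              | ℕₚ.*-comm m 2 | ℕₚ.+-identityʳ m = ℕₚ.n≤1+n _

    term : ∀ k → a ^ℚ k * (_/_ (+ 1) (k !) {{k !≢0}}) ≤ ½ ^ℚ k * E
    term k = begin
      a ^ℚ k * f               ≤⟨ *-mono (0≤^ k 0≤a) (0≤1/! k) (^-mono k 0≤a a≤½N) ℚₚ.≤-refl ⟩
      (½ * N) ^ℚ k * f         ≡⟨ cong (_* f) (*-^ ½ N k) ⟩
      (½ ^ℚ k * N ^ℚ k) * f    ≡⟨ ℚₚ.*-assoc (½ ^ℚ k) _ f ⟩
      ½ ^ℚ k * (N ^ℚ k * f)    ≤⟨ *-mono (0≤^ k 0≤½) 0≤E ℚₚ.≤-refl (^/!-bound (m ℕ.+ m) k) ⟩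
      ½ ^ℚ k * E               ∎
      where f = _/_ (+ 1) (k !) {{k !≢0}}

    halve : ∀ h → h * E + D * (½ * h) ≡ D * h
    halve h = trans (cong (λ z → h * E + z) eq₁) (sym eq₂)
      where
      eq₁ : D * (½ * h) ≡ h * E
      eq₁ = trans (*-swap (1ℚ + 1ℚ) E ½ h) (trans (ℚₚ.*-identityˡ (E * h)) (ℚₚ.*-comm E h))
      eq₂ : D * h ≡ h * E + h * E
      eq₂ = trans (cong (_* h) (trans (ℚₚ.*-distribʳ-+ E 1ℚ 1ℚ)
              (cong₂ _+_ (ℚₚ.*-identityˡ E) (ℚₚ.*-identityˡ E))))
              (trans (ℚₚ.*-comm (E + E) h) (ℚₚ.*-distribˡ-+ h E E))

    go : ∀ k → expSum a k + D * ½ ^ℚ k ≤ D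
    go zero = ℚₚ.≤-reflexive (trans (ℚₚ.+-identityˡ _) (ℚₚ.*-identityʳ D))
    go (suc k) = begin
      expSum a k + t + D * ½ ^ℚ suc k        ≡⟨ ℚₚ.+-assoc (expSum a k) t _ ⟩
      expSum a k + (t + D * ½ ^ℚ suc k)
        ≤⟨ ℚₚ.+-monoʳ-≤ (expSum a k) (ℚₚ.+-monoˡ-≤ (D * ½ ^ℚ suc k) (term k)) ⟩
      expSum a k + (½ ^ℚ k * E + D * (½ * ½ ^ℚ k))
        ≡⟨ cong (λ z → expSum a k + z) (halve (½ ^ℚ k)) ⟩
      expSum a k + D * ½ ^ℚ k                ≤⟨ go k ⟩
      D                                      ∎
      where t = a ^ℚ k * (_/_ (+ 1) (k !) {{k !≢0}})

exp : ℝ≥0 → ℝ≥0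
exp x = sup
  (λ q → ∃[ a ] ∃[ k ] 0ℚ ≤ a × fromℚ a ≤ᴿ x × q ≡ expSum a k)
  (_ , λ { (a , k , 0≤a , a≤x , refl) → expSum-bound (bound x) a k 0≤a (≤bound x a≤x) })

-- The natural logarithm of x for x ≥ 1, and 0 for x ≤ 1.
log : ℝ≥0 → ℝ≥0
log x = sup (λ q → 0ℚ ≤ q × exp (fromℚ q) ≤ᴿ x) (fromNat (bound x) , λ { {q} → below })
  where
  below : ∀ {q} → 0ℚ ≤ q × exp (fromℚ q) ≤ᴿ x → q ≤ fromNat (bound x)
  below {q} (0≤q , e≤x) = ≤bound x q≤x
    where
    open ≤R
    q<sum : q < expSum q 2
    q<sum = begin-strict
      q                                   ≡⟨ sym (ℚₚ.+-identityˡ q) ⟩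
      0ℚ + q                              <⟨ ℚₚ.+-monoˡ-< q (ℚₚ.positive⁻¹ 1ℚ) ⟩
      1ℚ + q                              ≡⟨ cong (λ z → 1ℚ + z) (sym (trans (ℚₚ.*-identityʳ (q * 1ℚ)) (ℚₚ.*-identityʳ q))) ⟩
      expSum q 2                          ∎
    q≤x : fromℚ q ≤ᴿ x
    q≤x {p} p∈q = e≤x (h p∈q)
      where
      h : lower (fromℚ q) p → lower (exp (fromℚ q)) p
      h (inj₁ p<0) = inj₁ p<0
      h (inj₂ (_ , refl , p<q)) = inj₂ (expSum q 2 ,
        (q , 2 , 0≤q , (λ z → z) , refl) , ℚₚ.<-trans p<q q<sum)

infixr 8 _^ᴿ_

-- For x ≥ 1, the supremum of the rational powers s^(i/d) with 0 ≤ s ≤ x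
-- and 0 ≤ i/d ≤ y, where "q ≤ s^(i/d)" is expressed by q^d ≤ s^i.
_^ᴿ_ : ℝ≥0 → ℝ≥0 → ℝ≥0
x ^ᴿ y = sup
  (λ q → ∃[ s ] ∃[ i ] ∃[ d ]
     0ℚ ≤ q × 0ℚ ≤ s × fromℚ s ≤ᴿ x × fromℚ (+ i / suc d) ≤ᴿ y × q ^ℚ suc d ≤ s ^ℚ i)
  (X ^ℚ Y , λ { {q} → below {q} })
  where
  X = fromNat (bound x)
  Y = bound y
  1≤X : 1ℚ ≤ X
  1≤X = /-≤ 1 (bound x) 1 1 (ℕ.s≤s ℕ.z≤n)
  below : ∀ {q} → (∃[ s ] ∃[ i ] ∃[ d ]
     0ℚ ≤ q × 0ℚ ≤ s × fromℚ s ≤ᴿ x × fromℚ (+ i / suc d) ≤ᴿ y × q ^ℚ suc d ≤ s ^ℚ i) →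
     q ≤ X ^ℚ Y
  below {q} (s , i , d , 0≤q , 0≤s , s≤x , i/d≤y , q^≤s^) with q ℚₚ.≤? X ^ℚ Y
  ... | yes h = h
  ... | no ¬h = ⊥-elim (ℚₚ.<-irrefl refl (ℚₚ.<-≤-trans Z^<q^ (ℚₚ.≤-trans q^≤s^ upper)))
    where
    open ≤R
    Z = X ^ℚ Y
    1≤Z : 1ℚ ≤ Z
    1≤Z = 1≤^ Y 1≤X
    Z<q : Z < q
    Z<q = ℚₚ.≰⇒> ¬h
    0<q : 0ℚ < q
    0<q = ℚₚ.≤-<-trans (ℚₚ.≤-trans 0≤1 1≤Z) Z<q
    Z^<q^ : Z ^ℚ suc d < q ^ℚ suc d
    Z^<q^ = begin-strict
      Z * Z ^ℚ d   ≤⟨ *-mono (ℚₚ.≤-trans 0≤1 1≤Z) (0≤^ d 0≤q) ℚₚ.≤-refl (^-mono d (ℚₚ.≤-trans 0≤1 1≤Z) (ℚₚ.<⇒≤ Z<q)) ⟩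
      Z * q ^ℚ d   <⟨ ℚₚ.*-monoˡ-<-pos (q ^ℚ d) {{ℚ.positive (pos d)}} Z<q ⟩
      q * q ^ℚ d   ∎
      where
      pos : ∀ d → 0ℚ < q ^ℚ d
      pos d = ℚₚ.<-≤-trans (ℚₚ.positive⁻¹ 1ℚ) (1≤^ d (ℚₚ.≤-trans 1≤Z (ℚₚ.<⇒≤ Z<q)))
    i≤ : i ℕ.≤ Y ℕ.* suc d
    i≤ = subst (ℕ._≤ Y ℕ.* suc d) (ℕₚ.*-identityʳ i) (/-≤⁻ i Y (suc d) 1 (≤bound y i/d≤y))
    upper : s ^ℚ i ≤ Z ^ℚ suc d
    upper = begin
      s ^ℚ i               ≤⟨ ^-mono i 0≤s (≤bound x s≤x) ⟩
      X ^ℚ i               ≤⟨ ^-monoʳ 1≤X i≤ ⟩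
      X ^ℚ (Y ℕ.* suc d)   ≡⟨ ^-* X Y (suc d) ⟩
      Z ^ℚ suc d           ∎

------------------------------------------------------------------------
-- Shellsort

record State (n : ℕ) : Set where
  constructor state
  field
    array       : Fin n → ℕ
    exchanges   : ℕ
    comparisons : ℕ

open State public

private
  previous< : ∀ c h k → c ℕ.+ suc k ℕ.* h ℕ.< n → c ℕ.+ k ℕ.* h ℕ.< n
  previous< c h k = ℕₚ.≤-<-trans (ℕₚ.+-monoʳ-≤ c (ℕₚ.m≤n+m (k ℕ.* h) h))

-- The chain of residue c modulo h (c < h) consists of the positions
-- c, c + h, c + 2h, … below n; `insert h c k` inserts the key at its k-th
-- position into the part of the chain to the left.
insert : ∀ (h c k : ℕ) → .(c ℕ.+ k ℕ.* h ℕ.< n) → State n → State n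
insert h c zero    _ s = s
insert {n} h c (suc k) lt (state a e m) with a left ℕₚ.≤? a right
  where
  left right : Fin n
  left  = fromℕ< (previous< c h k lt)
  right = fromℕ< lt
... | yes _ = state a e (suc m)
... | no  _ = insert h c k (previous< c h k lt)
                (state (a ∘ transpose (fromℕ< (previous< c h k lt)) (fromℕ< lt)) (suc e) (suc m))

insertIfPresent : ∀ (h c : ℕ) → State n → ℕ → State n
insertIfPresent {n} h c s k with c ℕ.+ k ℕ.* h ℕₚ.<? n
... | yes lt = insert h c k lt s
... | no  _  = s

sortChain : ∀ (h : ℕ) → State n → ℕ → State n
sortChain {n} h s c = List.foldl (insertIfPresent h c) s (upTo n)

pass : State n → ℕ → State n
pass s h = List.foldl (sortChain h) s (upTo h)

shellsort : List ℕ → (Fin n → ℕ) → State n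
shellsort H a = List.foldl pass (state a 0 0) H

-- All vectors of length k with entries below m.
tuples : ∀ (k m : ℕ) → List (Vec ℕ k)
tuples zero    m = [] ∷ []
tuples (suc k) m = List.cartesianProductWith _∷_ (upTo m) (tuples k m)

unique? : Decidable (Unique {A = ℕ} {n = n})
unique? = allPairs? (λ x y → ¬? (x ℕₚ.≟ y))

permutations : ∀ n → List (Vec ℕ n)
permutations n = List.filter unique? (tuples n n)

worst : (∀ {n} → State n → ℕ) → ℕ → List ℕ → ℕ
worst cost n H =
  List.foldr ℕ._⊔_ 0 (List.map (λ v → cost (shellsort H (lookup v))) (permutations n))

W : ℕ → List ℕ → ℕ
W = worst exchanges

C : ℕ → List ℕ → ℕ
C = worst comparisons

------------------------------------------------------------------------
-- Product grids

monomial : Vec ℕ r → Vec ℕ r → ℕ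
monomial A u = foldr′ ℕ._*_ 1 (zipWith ℕ._^_ A u)

-- For generators ≥ 2, a product below n has all its exponents below n, so
-- only exponent vectors with entries below n are enumerated (cf. ∈-grid).
grid : Vec ℕ r → ℕ → List ℕ
grid {r} A n = List.filter (_∈? List.map (monomial A) (tuples r n)) (downFrom n)

private
  n<2^n : ∀ m → m ℕ.< 2 ℕ.^ m
  n<2^n zero    = ℕ.s≤s ℕ.z≤n
  n<2^n (suc m) = ℕₚ.≤-trans (ℕₚ.+-mono-≤ (ℕₚ.m^n>0 2 m) (n<2^n m))
    (ℕₚ.≤-reflexive (cong (2 ℕ.^ m ℕ.+_) (sym (ℕₚ.+-identityʳ _))))

  exponent< : ∀ a u → 2 ℕ.≤ a → u ℕ.< a ℕ.^ u
  exponent< a u 2≤a = ℕₚ.<-≤-trans (n<2^n u) (ℕₚ.^-monoˡ-≤ u 2≤a)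

  monomial>0 : ∀ {A : Vec ℕ r} → All (2 ℕ.≤_) A → ∀ u → 0 ℕ.< monomial A u
  monomial>0 []            []      = ℕ.s≤s ℕ.z≤n
  monomial>0 (_∷_ {x = a} 2≤a hA) (u ∷ us) =
    ℕₚ.*-mono-≤ (ℕₚ.≤-<-trans ℕ.z≤n (exponent< a u 2≤a)) (monomial>0 hA us)

  ∈-tuples : ∀ {A : Vec ℕ r} → All (2 ℕ.≤_) A → ∀ u → monomial A u ℕ.< n → u ∈ tuples r n
  ∈-tuples []            []       _ = here refl
  ∈-tuples (_∷_ {x = a} {xs = as} 2≤a hA) (u ∷ us) lt = ∈-cartesianProductWith⁺ _∷_
    (∈-upTo⁺ (ℕₚ.<-trans (exponent< a u 2≤a) (ℕₚ.≤-<-trans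
      (ℕₚ.m≤m*n (a ℕ.^ u) (monomial as us) {{ℕ.>-nonZero (monomial>0 hA us)}}) lt)))
    (∈-tuples hA us (ℕₚ.≤-<-trans
      (ℕₚ.m≤n*m (monomial as us) (a ℕ.^ u) {{ℕ.>-nonZero (ℕₚ.≤-<-trans ℕ.z≤n (exponent< a u 2≤a))}}) lt))

∈-grid : ∀ {A : Vec ℕ r} → All (2 ℕ.≤_) A → ∀ {m} →
         m ∈ grid A n ⇔ (m ℕ.< n × ∃[ u ] m ≡ monomial A u)
∈-grid {r} {n} {A} hA {m} = mk⇔ to from
  where
  P? : Decidable (_∈ List.map (monomial A) (tuples r n))
  P? = _∈? List.map (monomial A) (tuples r n)
  to : m ∈ grid A n → m ℕ.< n × ∃[ u ] m ≡ monomial A u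
  to m∈ with ∈-filter⁻ P? {xs = downFrom n} m∈
  ... | m∈down , m∈prods with ∈-map⁻ (monomial A) m∈prods
  ...   | u , _ , eq = ∈-downFrom⁻ m∈down , u , eq
  from : m ℕ.< n × ∃[ u ] m ≡ monomial A u → m ∈ grid A n
  from (m<n , u , refl) = ∈-filter⁺ P? (∈-downFrom⁺ m<n)
    (∈-map⁺ (monomial A) (∈-tuples hA u m<n))

maximum : Vec ℕ r → ℕ
maximum = foldr′ ℕ._⊔_ 0

-- The maximum serves as the neutral element.
minimum : Vec ℕ r → ℕ
minimum A = foldr′ ℕ._⊓_ (maximum A) A

record Admissible (K : ℝ≥0) (n p : ℕ) (A : Vec ℕ r) : Set where
  field
    range       : All (λ a → 2 ℕ.≤ a × a ℕ.< n) A
    distinct    : Unique A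
    independent : ∀ u v → monomial A u ≡ monomial A v → u ≡ v
    coprime     : foldr′ ℕ.gcd 0 A ≡ 1
    comparable  : fromℕ (maximum A) ≤ᴿ fromℕ (minimum A) ^ᴿ K
    small       : List.length (grid A n) ℕ.≤ p

------------------------------------------------------------------------
-- Minima and asymptotics

Eventually : (ℕ → Set ℓ) → Set ℓ
Eventually P = ∃[ N ] ∀ n → N ℕ.≤ n → P n

IsMinimum : {X : Set} → (X → Set) → (X → ℕ) → ℕ → Set
IsMinimum P f m = (∃[ x ] P x × f x ≡ m) × (∀ x → P x → m ℕ.≤ f x)

-- Admissibility involves an arbitrary real K and is not decidable, so the
-- existence of the minimum is asserted classically, i.e. under ¬ ¬.
record MinimumBetween {X : Set} (P : X → Set) (f : X → ℕ) (lo hi : ℝ≥0) : Set where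
  field
    exists : ¬ ¬ (∃[ m ] IsMinimum P f m)
    bounds : ∀ m → IsMinimum P f m → lo ≤ᴿ fromℕ m × fromℕ m ≤ᴿ hi

-- c₁ log n ≤ p(n) ≤ c₂ log n for all large n
LogBounds : ℝ≥0 → ℝ≥0 → (ℕ → ℕ) → Set
LogBounds c₁ c₂ p = Eventually λ n →
  c₁ *ᴿ log (fromℕ n) ≤ᴿ fromℕ (p n) × fromℕ (p n) ≤ᴿ c₂ *ᴿ log (fromℕ n)

-- n exp(c (log n)^e)
growth : ℝ≥0 → ℚ → ℕ → ℝ≥0
growth c e n = fromℕ n *ᴿ exp (c *ᴿ log (fromℕ n) ^ᴿ fromℚ e)

-- Over the admissible r-element sets, the minimum cost is
-- n exp(Θ((log n)^e)), with constants c, c′ chosen before p.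
MinimumCostRate : (r : ℕ) → ℝ≥0 → ℚ → Set₁
MinimumCostRate r K e =
  ∀ (c₁ c₂ : ℝ≥0) → fromℕ 0 <ᴿ c₁ → fromℕ 0 <ᴿ c₂ →
  ∃[ c ] ∃[ c′ ] fromℕ 0 <ᴿ c × fromℕ 0 <ᴿ c′ ×
  (∀ (p : ℕ → ℕ) → LogBounds c₁ c₂ p → Eventually λ n →
     MinimumBetween (Admissible {r} K n (p n)) (λ A → W n (grid A n)) (growth c e n) (growth c′ e n) ×
     MinimumBetween (Admissible {r} K n (p n)) (λ A → C n (grid A n)) (growth c e n) (growth c′ e n))

-- The ratio of the minimum for r generators to that for 2 generators
-- tends to infinity.
TwoGeneratorsBeat : (r : ℕ) → ℝ≥0 → (ℕ → ℕ) → (ℕ → List ℕ → ℕ) → Set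
TwoGeneratorsBeat r K p cost =
  ∀ (M : ℕ) → Eventually λ n → ∀ m₂ mᵣ →
  IsMinimum (Admissible {2} K n (p n)) (λ A → cost n (grid A n)) m₂ →
  IsMinimum (Admissible {r} K n (p n)) (λ A → cost n (grid A n)) mᵣ →
  M ℕ.* m₂ ℕ.≤ mᵣ

{-# OPTIONS --safe #-}

-- Lower bound: as A is independent, the grid contains all products with
-- exponents below log n / (r log max A).  If only O(log n) products lie below
-- n, then log max A, and with it log min A, is at least of order
-- (log n)^(1 − 1/r).  An array whose blocks of length min A are reversed is
-- sorted for every gap of the grid except 1, so the last pass makes at least
-- about n · min A / 8 exchanges on it.
--
-- Upper bound: the generators 1 + iT (1 ≤ i ≤ r) with T = r! 2ᵉ are pairwise
-- coprime, and e of order (log n)^(1 − 1/r) makes the grid small enough.  When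
-- the pass with gap h starts, the array is sorted for the gaps h(1 + T) and
-- h(1 + 2T), hence for ht whenever t ≥ 2(1 + T)², which bounds the number of
-- comparisons of each insertion.
--
-- Logarithms enter only through L = ⌊log₂ n⌋ and rational bounds.
module Submission where

open import Defs
open import Data.Empty using (⊥; ⊥-elim)
open import Data.Product.Base
open import Data.Sum.Base using (_⊎_; inj₁; inj₂)
open import Function.Base using (_∘_)
open import Relation.Nullary using (yes; no; ¬_; Dec)
open import Relation.Binary.PropositionalEquality

-- The cost analysis rests on one fact about insertion sort: if f j ≤ g (j + t) for all j, the
-- inequality survives sorting both sequences. The chains of an array have different lengths, which
-- would spoil such a statement; reading every position beyond the end as an upper bound of the keys
-- makes all chains infinite. The order of e is forced: generators near 2^e have about (L/e)^r
-- products below n, and these number at most p, which is of order L, only if e is at least of order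
-- L^(1 - 1/r). The factor r! of T gives coprimality while all generators stay within a constant
-- factor of each other, so max A ≤ (min A)^K holds for any K > 1 once e is large. As r ≥ 2, the
-- number of gaps is below 2^(r e) and disappears in the exponent of the cost, as T² does. For two
-- generators the exponent of the minimum is at most of order L^(1/2), for r ≥ 3 at least of order
-- L^(2/3); this separates the minima by more than any constant factor.

module Sorting where

  open import Data.Nat.Base
  open import Data.Nat.Properties
  open import Data.Nat.DivMod
    using (_/_; _%_; m≡m%n+[m/n]*n; m%n<n; [m+kn]%n≡m%n; m<n⇒m%n≡m; +-distrib-/-∣ˡ;
           m*n/n≡m; m<n⇒m/n≡0; m/n*n≤m; m≥n⇒m/n>0)
  open import Data.Nat.Divisibility using (n∣m*n)
  open import Data.Nat.Tactic.RingSolver using (solve-∀)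
  open import Data.Fin.Base using (Fin; fromℕ<; toℕ)
  import Data.Fin.Properties as Fin
  open import Data.Fin.Properties using (fromℕ<-injective; toℕ<n; toℕ-fromℕ<; toℕ-injective)
  open import Data.Fin.Permutation.Components using (transpose)
  open import Data.List.Base as List
    using (List; []; _∷_; _++_; upTo; downFrom; foldl; filter; length)
  open import Data.List.Properties using (upTo-∷ʳ; foldl-∷ʳ; foldl-++)
  open import Data.List.Membership.Propositional using (_∈_)
  open import Data.List.Membership.Propositional.Properties
    using (∈-filter⁺; ∈-filter⁻; ∈-cartesianProductWith⁺; ∈-cartesianProductWith⁻; ∈-upTo⁺; ∈-upTo⁻)
  open import Data.List.Relation.Unary.Any using (here; there)
  open import Data.List.Relation.Unary.All using ([]; _∷_) renaming (All to Allᴸ)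
  open import Data.Vec.Base using (Vec; []; _∷_; lookup; tabulate)
  open import Data.Vec.Properties using (lookup∘tabulate)
  open import Data.Vec.Relation.Unary.All using (All; []; _∷_)
  import Data.Vec.Relation.Unary.All.Properties as All
  import Data.Vec.Relation.Unary.Unique.Propositional.Properties as Unique
  open import Relation.Nullary using (recompute)
  open import Relation.Nullary.Decidable using (dec-true; dec-false)
  open import Relation.Unary using (Decidable)
  open import Relation.Binary.Definitions using (tri<; tri≈; tri>)

  -- Insertion sort on infinite sequences.

  private variable
    n : ℕ

  -- The larger of x and the left neighbour f (j - 1), where a missing neighbour counts as -∞.
  -- Inserting x into a sorted f puts min (f j) (max (f (j - 1)) x) at position j. This formula does
  -- not mention where x ends up, so facts about insertion reduce to the monotonicity of min and
  -- max.
  above : (ℕ → ℕ) → ℕ → ℕ → ℕ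
  above f x zero    = x
  above f x (suc j) = f j ⊔ x

  -- The effect of inserting the k-th key into the sorted keys 0, …, k − 1.
  place : ℕ → (ℕ → ℕ) → ℕ → ℕ
  place k f j with <-cmp j k
  ... | tri< _ _ _ = f j ⊓ above f (f k) j
  ... | tri≈ _ _ _ = above f (f k) j
  ... | tri> _ _ _ = f j

  sortPrefix : (ℕ → ℕ) → ℕ → ℕ → ℕ
  sortPrefix f zero    = f
  sortPrefix f (suc k) = place k (sortPrefix f k)

  SortedBelow : ℕ → (ℕ → ℕ) → Set
  SortedBelow k f = ∀ j → suc j < k → f j ≤ f (suc j)

  x≤above : ∀ f x j → x ≤ above f x j
  x≤above f x zero    = ≤-refl
  x≤above f x (suc j) = m≤n⊔m (f j) x

  above-cong : ∀ {f g} x → f ≗ g → ∀ j → above f x j ≡ above g x j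
  above-cong x eq zero    = refl
  above-cong x eq (suc j) = cong (_⊔ x) (eq j)

  place-< : ∀ {k f j} → j < k → place k f j ≡ f j ⊓ above f (f k) j
  place-< {k} {f} {j} j<k with <-cmp j k
  ... | tri< _ _ _   = refl
  ... | tri≈ j≮k _ _ = ⊥-elim (j≮k j<k)
  ... | tri> j≮k _ _ = ⊥-elim (j≮k j<k)

  place-≡ : ∀ k f → place k f k ≡ above f (f k) k
  place-≡ k f with <-cmp k k
  ... | tri< _ k≢k _ = ⊥-elim (k≢k refl)
  ... | tri≈ _ _ _   = refl
  ... | tri> _ k≢k _ = ⊥-elim (k≢k refl)

  place-> : ∀ {k f j} → k < j → place k f j ≡ f j
  place-> {k} {f} {j} k<j with <-cmp j k
  ... | tri< _ _ k≮j = ⊥-elim (k≮j k<j)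
  ... | tri≈ _ _ k≮j = ⊥-elim (k≮j k<j)
  ... | tri> _ _ _   = refl

  place-cong : ∀ k {f g} → f ≗ g → place k f ≗ place k g
  place-cong k {f} {g} eq j with <-cmp j k
  ... | tri< _ _ _ rewrite eq k = cong₂ _⊓_ (eq j) (above-cong (g k) eq j)
  ... | tri≈ _ _ _ rewrite eq k = above-cong (g k) eq j
  ... | tri> _ _ _ = eq j

  place-mono : ∀ k f j → j < k → place k f j ≤ f j
  place-mono k f j j<k rewrite place-< {k} {f} j<k = m⊓n≤m (f j) _

  place-sorted : ∀ k f → SortedBelow k f → SortedBelow (suc k) (place k f)
  place-sorted k f sf j (s≤s 1+j≤k) with <-cmp (suc j) k
  ... | tri< 1+j<k _ _ = ≤-trans (place-mono k f j 1+j≤k)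
          (⊓-glb (sf j 1+j<k) (m≤m⊔n (f j) (f k)))
  ... | tri≈ _ _ _     = ≤-trans (place-mono k f j 1+j≤k) (m≤m⊔n (f j) (f k))
  ... | tri> _ _ k<1+j = ⊥-elim (<-irrefl refl (<-≤-trans k<1+j 1+j≤k))

  place-≤ : ∀ k f y → (∀ j → f j ≤ y) → ∀ j → place k f j ≤ y
  place-≤ k f y f≤y j with <-cmp j k
  ... | tri< _ _ _ = ≤-trans (m⊓n≤m (f j) _) (f≤y j)
  ... | tri≈ _ _ _ = above≤ j
    where
    above≤ : ∀ j → above f (f k) j ≤ y
    above≤ zero    = f≤y k
    above≤ (suc j) = ⊔-lub (f≤y j) (f≤y k)
  ... | tri> _ _ _ = f≤y j

  place-max : ∀ k f → (∀ j → j < k → f j ≤ f k) → place k f ≗ f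
  place-max k f f≤ j with <-cmp j k
  ... | tri< j<k _ _  = m≤n⇒m⊓n≡m (≤-trans (f≤ j j<k) (x≤above f (f k) j))
  ... | tri≈ _ refl _ = top j f≤
    where
    top : ∀ j → (∀ i → i < j → f i ≤ f j) → above f (f j) j ≡ f j
    top zero    _  = refl
    top (suc j) f≤ = m≤n⇒m⊔n≡n (f≤ j ≤-refl)
  ... | tri> _ _ _    = refl

  SortedBelow-≤ : ∀ {k f} → SortedBelow k f → ∀ i {j} → i + j < k → f j ≤ f (i + j)
  SortedBelow-≤ sf zero    _       = ≤-refl
  SortedBelow-≤ sf (suc i) {j} i+j<k = ≤-trans (SortedBelow-≤ sf i (<⇒≤ i+j<k)) (sf (i + j) i+j<k)

  place-sortedBelow : ∀ k f → SortedBelow (suc k) f → place k f ≗ f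
  place-sortedBelow k f sf = place-max k f λ j j<k →
    subst (λ i → f j ≤ f i) (m∸n+n≡m (<⇒≤ j<k))
      (SortedBelow-≤ sf (k ∸ j) (≤-reflexive (cong suc (m∸n+n≡m (<⇒≤ j<k)))))

  sortPrefix-sorted : ∀ f k → SortedBelow k (sortPrefix f k)
  sortPrefix-sorted f zero    j ()
  sortPrefix-sorted f (suc k) = place-sorted k (sortPrefix f k) (sortPrefix-sorted f k)

  sortPrefix-rest : ∀ f k j → k ≤ j → sortPrefix f k j ≡ f j
  sortPrefix-rest f zero    j _   = refl
  sortPrefix-rest f (suc k) j k<j = trans (place-> k<j) (sortPrefix-rest f k j (<⇒≤ k<j))

  sortPrefix-cong : ∀ {f g} → f ≗ g → ∀ k → sortPrefix f k ≗ sortPrefix g k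
  sortPrefix-cong eq zero    = eq
  sortPrefix-cong eq (suc k) = place-cong k (sortPrefix-cong eq k)

  sortPrefix-bounded : ∀ f k y → (∀ j → f j ≤ y) → ∀ j → sortPrefix f k j ≤ y
  sortPrefix-bounded f zero    y f≤y = f≤y
  sortPrefix-bounded f (suc k) y f≤y = place-≤ k _ y (sortPrefix-bounded f k y f≤y)

  -- At least j + 1 of the first k keys are at most y, hence so is the key of rank j, counted from
  -- 0.
  sortPrefix-≤ : ∀ f k j y → j < k → (∀ i → i ≤ j → f i ≤ y) → sortPrefix f k j ≤ y
  sortPrefix-≤ f (suc k) j y j<1+k f≤y with <-cmp j k
  ... | tri< j<k _ _  = ≤-trans (m⊓n≤m _ _) (sortPrefix-≤ f k j y j<k f≤y)
  ... | tri≈ _ refl _ = top j refl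
    where
    x≤y : sortPrefix f k k ≤ y
    x≤y rewrite sortPrefix-rest f k k ≤-refl = f≤y k ≤-refl
    top : ∀ i → i ≡ k → above (sortPrefix f k) (sortPrefix f k k) i ≤ y
    top zero    _    = x≤y
    top (suc i) refl = ⊔-lub
      (sortPrefix-≤ f k i y ≤-refl (λ l l≤i → f≤y l (m≤n⇒m≤1+n l≤i))) x≤y
  ... | tri> _ _ k<j  = ⊥-elim (<-irrefl refl (<-≤-trans k<j (s≤s⁻¹ j<1+k)))

  -- Only the j keys before position j can be smaller than y, so the key of rank j, counted from 0,
  -- is not.
  sortPrefix-≥ : ∀ f k j y → j < k → (∀ i → j ≤ i → i < k → y ≤ f i) → y ≤ sortPrefix f k j
  sortPrefix-≥ f (suc k) j y j<1+k y≤f with <-cmp j k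
  ... | tri< j<k _ _  = ⊓-glb
          (sortPrefix-≥ f k j y j<k (λ i j≤i i<k → y≤f i j≤i (m<n⇒m<1+n i<k)))
          (≤-trans y≤x (x≤above (sortPrefix f k) _ j))
    where
    y≤x : y ≤ sortPrefix f k k
    y≤x rewrite sortPrefix-rest f k k ≤-refl = y≤f k (<⇒≤ j<k) ≤-refl
  ... | tri≈ _ refl _ = ≤-trans y≤x (x≤above (sortPrefix f k) _ j)
    where
    y≤x : y ≤ sortPrefix f k k
    y≤x rewrite sortPrefix-rest f k k ≤-refl = y≤f k ≤-refl ≤-refl
  ... | tri> _ _ k<j  = ⊥-elim (<-irrefl refl (<-≤-trans k<j (s≤s⁻¹ j<1+k)))

  -- The reason why Shellsort works: f and g will be the chains of i and i + k in a k-sorted array.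
  -- The formula of `place` is monotone, so the inequality passes through corresponding insertions.
  -- Where `above` has no left neighbour on the side of f, the inserted key meets, on the side of g,
  -- a maximum that contains the larger inserted key.
  sortPrefix-shift : ∀ f g t → (∀ j → f j ≤ g (j + t)) →
    ∀ k j → sortPrefix f k j ≤ sortPrefix g (k + t) (j + t)
  sortPrefix-shift f g t f≤g k j with j <? k
  ... | no j≮k = subst₂ _≤_ (sym (sortPrefix-rest f k j (≮⇒≥ j≮k)))
          (sym (sortPrefix-rest g (k + t) (j + t) (+-monoˡ-≤ t (≮⇒≥ j≮k)))) (f≤g j)
  ... | yes j<k = go k j j<k
    where
    go : ∀ k j → j < k → sortPrefix f k j ≤ sortPrefix g (k + t) (j + t)
    aboves : ∀ k j → j ≤ k →
      above (sortPrefix f k) (sortPrefix f k k) j ≤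
      above (sortPrefix g (k + t)) (sortPrefix g (k + t) (k + t)) (j + t)
    x≤x : ∀ k → sortPrefix f k k ≤ sortPrefix g (k + t) (k + t)
    x≤x k rewrite sortPrefix-rest f k k ≤-refl | sortPrefix-rest g (k + t) (k + t) ≤-refl = f≤g k
    aboves k zero    j≤k = ≤-trans (x≤x k) (x≤above (sortPrefix g (k + t)) _ t)
    aboves k (suc j) j<k = ⊔-mono-≤ (go k j j<k) (x≤x k)
    go (suc k) j (s≤s j≤k) with <-cmp j k
    ... | tri< j<k _ _
          rewrite place-< {k + t} {sortPrefix g (k + t)} (+-monoˡ-< t j<k)
          = ⊓-mono-≤ (go k j j<k) (aboves k j j≤k)
    ... | tri≈ _ refl _
          rewrite place-≡ (k + t) (sortPrefix g (k + t)) = aboves k j j≤k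
    ... | tri> _ _ k<j  = ⊥-elim (<-irrefl refl (<-≤-trans k<j j≤k))

  -- Serves the padded part of a chain: `sortPrefix-shift` speaks of k + t sorted entries of g while
  -- a pass sorts n of them, and inserting entries that dominate everything changes nothing.
  sortPrefix-stable : ∀ f k l → k ≤ l → (∀ i j → k ≤ i → f j ≤ f i) →
    sortPrefix f l ≗ sortPrefix f k
  sortPrefix-stable f k zero    z≤n _ j = refl
  sortPrefix-stable f k (suc l) k≤1+l top j with m≤n⇒m<n∨m≡n k≤1+l
  ... | inj₂ refl = refl
  ... | inj₁ (s≤s k≤l) = trans (place-max l (sortPrefix f l) (λ i _ → x-max i) j) (sortPrefix-stable f k l k≤l top j)
    where
    x-max : ∀ i → sortPrefix f l i ≤ sortPrefix f l l
    x-max i rewrite sortPrefix-rest f l l ≤-refl =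
      sortPrefix-bounded f l (f l) (λ j → top l j k≤l) i

  -- Chains of an array and single insertions.

  previous : ∀ c h k → c + suc k * h < n → c + k * h < n
  previous c h k = ≤-<-trans (+-monoʳ-≤ c (m≤n+m (k * h) h))

  -- Positions beyond the end of the array read as d, an upper bound of the
  -- keys, so that all chains become infinite sequences.
  at : ℕ → (Fin n → ℕ) → ℕ → ℕ
  at {n} d a i with i <? n
  ... | yes i<n = a (fromℕ< i<n)
  ... | no  _   = d

  at-< : ∀ {d} {a : Fin n → ℕ} {i} .(i<n : i < n) → at d a i ≡ a (fromℕ< i<n)
  at-< {n} {d} {a} {i} i<n with i <? n
  ... | yes _   = refl
  ... | no  i≮n = ⊥-elim (i≮n (recompute (i <? n) i<n))
    where open import Relation.Nullary using (recompute)

  at-≥ : ∀ {d} {a : Fin n → ℕ} {i} → n ≤ i → at d a i ≡ d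
  at-≥ {n} {d} {a} {i} n≤i with i <? n
  ... | yes i<n = ⊥-elim (<-irrefl refl (<-≤-trans i<n n≤i))
  ... | no  _   = refl

  at-bounded : ∀ {d} {a : Fin n → ℕ} → (∀ x → a x ≤ d) → ∀ i → at d a i ≤ d
  at-bounded {n} a≤d i with i <? n
  ... | yes i<n = a≤d (fromℕ< i<n)
  ... | no  _   = ≤-refl

  module _ (a : Fin n → ℕ) {x y : ℕ} (x<n : x < n) (y<n : y < n) where

    swapped : Fin n → ℕ
    swapped = a ∘ transpose (fromℕ< x<n) (fromℕ< y<n)

    at-swapˡ : ∀ {d} → at d swapped x ≡ at d a y
    at-swapˡ {d} rewrite at-< {d = d} {swapped} x<n | at-< {d = d} {a} y<n
      | dec-true (fromℕ< x<n Fin.≟ fromℕ< x<n) refl = refl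

    at-swapʳ : ∀ {d} → at d swapped y ≡ at d a x
    at-swapʳ {d} with x ≟ y
    ... | yes refl = at-swapˡ
    ... | no  x≢y
      rewrite at-< {d = d} {swapped} y<n | at-< {d = d} {a} x<n
      | dec-false (fromℕ< y<n Fin.≟ fromℕ< x<n) (λ eq → x≢y (sym (fromℕ<-injective y x y<n x<n eq)))
      | dec-true (fromℕ< y<n Fin.≟ fromℕ< y<n) refl = refl

    at-swap : ∀ {d} i → i ≢ x → i ≢ y → at d swapped i ≡ at d a i
    at-swap {d} i i≢x i≢y = by (i <? n)
      where
      by : Dec (i < n) → at d swapped i ≡ at d a i
      by (no i≮n) = trans (at-≥ (≮⇒≥ i≮n)) (sym (at-≥ (≮⇒≥ i≮n)))
      by (yes i<n)
        rewrite at-< {d = d} {swapped} i<n | at-< {d = d} {a} i<n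
        | dec-false (fromℕ< i<n Fin.≟ fromℕ< x<n) (λ eq → i≢x (fromℕ<-injective i x i<n x<n eq))
        | dec-false (fromℕ< i<n Fin.≟ fromℕ< y<n) (λ eq → i≢y (fromℕ<-injective i y i<n y<n eq)) = refl

  Bounded : ℕ → State n → Set
  Bounded d s = ∀ x → array s x ≤ d

  module _ (d h c : ℕ) .{{_ : NonZero h}} where

    chain : State n → ℕ → ℕ
    chain s j = at d (array s) (c + j * h)

    position-injective : ∀ {j k} → c + j * h ≡ c + k * h → j ≡ k
    position-injective {j} {k} eq = *-cancelʳ-≡ j k h (+-cancelˡ-≡ c (j * h) (k * h) eq)

    module _ (k : ℕ) (lt : c + suc k * h < n) (a : Fin n → ℕ) (e m : ℕ) where

      swap-state : State n
      swap-state = state (swapped a (previous c h k lt) lt) (suc e) (suc m)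

      chain-swapˡ : chain swap-state k ≡ chain (state a e m) (suc k)
      chain-swapˡ = at-swapˡ a (previous c h k lt) lt

      chain-swapʳ : chain swap-state (suc k) ≡ chain (state a e m) k
      chain-swapʳ = at-swapʳ a (previous c h k lt) lt

      chain-swap : ∀ j → j ≢ k → j ≢ suc k → chain swap-state j ≡ chain (state a e m) j
      chain-swap j j≢k j≢1+k = at-swap a (previous c h k lt) lt (c + j * h)
        (j≢k ∘ position-injective) (j≢1+k ∘ position-injective)

      chain-compare : (chain (state a e m) k ≤ chain (state a e m) (suc k)) ≡
                      (a (fromℕ< (previous c h k lt)) ≤ a (fromℕ< lt))
      chain-compare = cong₂ _≤_ (at-< (previous c h k lt)) (at-< lt)

    -- One exchange puts x = f (k + 1) at k and f k at k + 1; placing x at k in the new sequence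
    -- must agree with placing it at k + 1 in f. At k the minimum with f k has no effect, because x
    -- and f (k - 1) are both at most f k; at k + 1 the maximum is f k, because x < f k.
    insert-chain : ∀ k (lt : c + k * h < n) (s : State n) → SortedBelow k (chain s) →
                   chain (insert h c k lt s) ≗ place k (chain s)
    insert-chain zero lt s sf j with <-cmp j 0
    ... | tri≈ _ refl _ = refl
    ... | tri> _ _ _    = refl
    insert-chain (suc k) lt s@(state a e m) sf j
      with a (fromℕ< (previous c h k lt)) ≤? a (fromℕ< lt)
    ... | yes le = sym (place-sortedBelow (suc k) (chain s) sorted j)
      where
      fk≤x : chain s k ≤ chain s (suc k)
      fk≤x = subst (λ X → X) (sym (chain-compare k lt a e m)) le
      sorted : SortedBelow (suc (suc k)) (chain s)
      sorted j (s≤s j<1+k) with m≤n⇒m<n∨m≡n j<1+k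
      ... | inj₁ 1+j<1+k = sf j 1+j<1+k
      ... | inj₂ refl    = fk≤x
    ... | no nle = trans (insert-chain k (previous c h k lt) s′ sf′ j) (step j)
      where
      f  = chain s
      s′ = swap-state k lt a e m
      f′ = chain s′
      x<fk : f (suc k) < f k
      x<fk = ≰⇒> (λ le → nle (subst (λ X → X) (chain-compare k lt a e m) le))
      f′< : ∀ j → j < k → f′ j ≡ f j
      f′< j j<k = chain-swap k lt a e m j (<⇒≢ j<k) (<⇒≢ (m<n⇒m<1+n j<k))
      sf′ : SortedBelow k f′
      sf′ j 1+j<k rewrite f′< j (<⇒≤ 1+j<k) | f′< (suc j) 1+j<k = sf j (m<n⇒m<1+n 1+j<k)
      above′ : ∀ j → j ≤ k → above f′ (f′ k) j ≡ above f (f (suc k)) j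
      above′ zero    _   = chain-swapˡ k lt a e m
      above′ (suc j) j<k = cong₂ _⊔_ (f′< j j<k) (chain-swapˡ k lt a e m)
      above≤fk : ∀ j → j ≤ k → j ≡ k → above f (f (suc k)) j ≤ f k
      above≤fk zero    _ _    = <⇒≤ x<fk
      above≤fk (suc j) _ refl = ⊔-lub (sf j ≤-refl) (<⇒≤ x<fk)
      step : ∀ j → place k f′ j ≡ place (suc k) f j
      step j with <-cmp j k
      ... | tri< j<k _ _ rewrite place-< {suc k} {f} (m<n⇒m<1+n j<k) =
              cong₂ _⊓_ (f′< j j<k) (above′ j (<⇒≤ j<k))
      ... | tri≈ _ refl _ rewrite place-< {suc k} {f} ≤-refl =
              trans (above′ k ≤-refl) (sym (m≥n⇒m⊓n≡n (above≤fk k ≤-refl refl)))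
      ... | tri> _ _ k<j with m≤n⇒m<n∨m≡n k<j
      ...   | inj₂ refl rewrite place-≡ (suc k) f =
                trans (chain-swapʳ k lt a e m) (sym (m≥n⇒m⊔n≡m (<⇒≤ x<fk)))
      ...   | inj₁ 1+k<j rewrite place-> {suc k} {f} 1+k<j =
                chain-swap k lt a e m j (>⇒≢ k<j) (>⇒≢ 1+k<j)

    insert-other : ∀ k (lt : c + k * h < n) (s : State n) i → (∀ j → i ≢ c + j * h) →
                   at d (array (insert h c k lt s)) i ≡ at d (array s) i
    insert-other zero    lt s i i∉ = refl
    insert-other (suc k) lt s@(state a e m) i i∉
      with a (fromℕ< (previous c h k lt)) ≤? a (fromℕ< lt)
    ... | yes _ = refl
    ... | no  _ = trans (insert-other k (previous c h k lt) (swap-state k lt a e m) i i∉)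
                    (at-swap a (previous c h k lt) lt i (i∉ k) (i∉ (suc k)))

    -- The key meets one that is not larger at the latest g + 1 places to its left. Each exchange
    -- brings it one place closer, which lowers g by one; with g = 0 the first comparison ends the
    -- insertion.
    insert-comparisons : ∀ k g (lt : c + k * h < n) (s : State n) →
      (∀ j → j + g < k → chain s j ≤ chain s k) →
      comparisons (insert h c k lt s) ≤ comparisons s + suc g
    insert-comparisons zero    g lt s _ = m≤m+n (comparisons s) (suc g)
    insert-comparisons (suc k) g lt s@(state a e m) small
      with a (fromℕ< (previous c h k lt)) ≤? a (fromℕ< lt)
    ... | yes _  = subst (_≤ m + suc g) (+-comm m 1) (+-monoʳ-≤ m (s≤s z≤n))
    ... | no nle with g
    ...   | zero = ⊥-elim (nle (subst (λ X → X) (chain-compare k lt a e m)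
                     (small k (s≤s (≤-reflexive (+-identityʳ k))))))
    ...   | suc g = subst (comparisons (insert h c k (previous c h k lt) s′) ≤_) (sym (+-suc m (suc g)))
                      (insert-comparisons k g (previous c h k lt) s′ small′)
      where
      s′ = swap-state k lt a e m
      small′ : ∀ j → j + g < k → chain s′ j ≤ chain s′ k
      small′ j j+g<k = subst₂ _≤_
        (sym (chain-swap k lt a e m j (<⇒≢ j<k) (<⇒≢ (m<n⇒m<1+n j<k))))
        (sym (chain-swapˡ k lt a e m))
        (small j (s≤s (subst (_≤ k) (sym (+-suc j g)) j+g<k)))
        where
        j<k : j < k
        j<k = ≤-<-trans (m≤m+n j g) j+g<k

    -- The o keys directly to the left are larger, and each exchange passes one of them. The case o
    -- = 0 is the monotonicity of the counter.
    insert-exchanges : ∀ k o (lt : c + k * h < n) (s : State n) → o ≤ k →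
      (∀ j → j < k → k ≤ j + o → chain s k < chain s j) →
      exchanges s + o ≤ exchanges (insert h c k lt s)
    insert-exchanges zero    zero lt s _ _ = ≤-reflexive (+-identityʳ (exchanges s))
    insert-exchanges (suc k) zero lt s@(state a e m) _ _
      with a (fromℕ< (previous c h k lt)) ≤? a (fromℕ< lt)
    ... | yes _ = ≤-reflexive (+-identityʳ e)
    ... | no  _ = ≤-trans (≤-reflexive (+-identityʳ e)) (≤-trans (n≤1+n e)
            (subst (_≤ exchanges (insert h c k (previous c h k lt) s′)) (+-identityʳ (suc e))
              (insert-exchanges k 0 (previous c h k lt) s′ z≤n
                (λ j j<k k≤j+0 → ⊥-elim (<-irrefl refl (<-≤-trans j<k
                  (subst (k ≤_) (+-identityʳ j) k≤j+0)))))))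
      where s′ = swap-state k lt a e m
    insert-exchanges (suc k) (suc o) lt s@(state a e m) (s≤s o≤k) large
      with a (fromℕ< (previous c h k lt)) ≤? a (fromℕ< lt)
    ... | yes le = ⊥-elim (<-irrefl refl (<-≤-trans
                     (large k ≤-refl (≤-trans (≤-reflexive (+-comm 1 k)) (+-monoʳ-≤ k (s≤s z≤n))))
                     (subst (λ X → X) (sym (chain-compare k lt a e m)) le)))
    ... | no  _  = subst (_≤ exchanges (insert h c k (previous c h k lt) s′)) (sym (+-suc e o))
                     (insert-exchanges k o (previous c h k lt) s′ o≤k large′)
      where
      s′ = swap-state k lt a e m
      large′ : ∀ j → j < k → k ≤ j + o → chain s′ k < chain s′ j
      large′ j j<k k≤j+o = subst₂ _<_
        (sym (chain-swapˡ k lt a e m))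
        (sym (chain-swap k lt a e m j (<⇒≢ j<k) (<⇒≢ (m<n⇒m<1+n j<k))))
        (large j (m<n⇒m<1+n j<k) (subst (suc k ≤_) (sym (+-suc j o)) (s≤s k≤j+o)))

  insert-bounded : ∀ {d} h c k (lt : c + k * h < n) (s : State n) → Bounded d s →
                   Bounded d (insert h c k lt s)
  insert-bounded h c zero    lt s b = b
  insert-bounded h c (suc k) lt (state a e m) b
    with a (fromℕ< (previous c h k lt)) ≤? a (fromℕ< lt)
  ... | yes _ = b
  ... | no  _ = insert-bounded h c k (previous c h k lt) _ (λ x → b (transpose _ _ x))

  insert-exchanges≤comparisons : ∀ h c k (lt : c + k * h < n) (s : State n) →
    exchanges s ≤ comparisons s → exchanges (insert h c k lt s) ≤ comparisons (insert h c k lt s)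
  insert-exchanges≤comparisons h c zero    lt s le = le
  insert-exchanges≤comparisons h c (suc k) lt (state a e m) le
    with a (fromℕ< (previous c h k lt)) ≤? a (fromℕ< lt)
  ... | yes _ = m≤n⇒m≤1+n le
  ... | no  _ = insert-exchanges≤comparisons h c k (previous c h k lt) _ (s≤s le)

  -- Passes: effect on the chains, preserved order, comparisons.

  foldl-upTo : ∀ {A : Set} (f : A → ℕ → A) x k → foldl f x (upTo (suc k)) ≡ f (foldl f x (upTo k)) k
  foldl-upTo f x k = trans (cong (foldl f x) (sym (upTo-∷ʳ k))) (foldl-∷ʳ f x k (upTo k))

  foldl-invariant : ∀ {A B : Set} (P : A → Set) (f : A → B → A) → (∀ {x} y → P x → P (f x y)) →
                    ∀ {x} ys → P x → P (foldl f x ys)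
  foldl-invariant P f step []       Px = Px
  foldl-invariant P f step (y ∷ ys) Px = foldl-invariant P f step ys (step y Px)

  insertIfPresent-bounded : ∀ {d h c} {s : State n} k → Bounded d s → Bounded d (insertIfPresent h c s k)
  insertIfPresent-bounded {n} {d} {h} {c} {s} k b with c + k * h <? n
  ... | yes lt = insert-bounded h c k lt s b
  ... | no  _  = b

  sortChain-bounded : ∀ {d h} {s : State n} c → Bounded d s → Bounded d (sortChain h s c)
  sortChain-bounded {n} {d} c = foldl-invariant (Bounded d) _ insertIfPresent-bounded (upTo n)

  pass-bounded : ∀ {d} {s : State n} h → Bounded d s → Bounded d (pass s h)
  pass-bounded {n} {d} h = foldl-invariant (Bounded d) _ sortChain-bounded (upTo h)

  shellsort-exchanges≤comparisons : ∀ (H : List ℕ) (a : Fin n → ℕ) →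
    exchanges (shellsort H a) ≤ comparisons (shellsort H a)
  shellsort-exchanges≤comparisons {n} H a =
    foldl-invariant P pass
      (λ h → foldl-invariant P (sortChain h)
        (λ c → foldl-invariant P (insertIfPresent h c) (step h c) (upTo n)) (upTo h)) H z≤n
    where
    P : State n → Set
    P s = exchanges s ≤ comparisons s
    step : ∀ h c {s} k → P s → P (insertIfPresent h c s k)
    step h c {s} k le with c + k * h <? n
    ... | yes lt = insert-exchanges≤comparisons h c k lt s le
    ... | no  _  = le

  module _ (d h c : ℕ) .{{_ : NonZero h}} where

    index≤position : ∀ k → k ≤ c + k * h
    index≤position k = ≤-trans (m≤m*n k h) (m≤n+m (k * h) c)

    processed : State n → ℕ → State n
    processed s k = foldl (insertIfPresent h c) s (upTo k)

    processed-chain : ∀ (s : State n) k → Bounded d s →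
                      chain d h c (processed s k) ≗ sortPrefix (chain d h c s) k
    processed-chain s zero    b j = refl
    processed-chain {n} s (suc k) b j rewrite foldl-upTo (insertIfPresent h c) s k
      with IH ← processed-chain s k b
      with c + k * h <? n
    ... | yes lt = trans
            (insert-chain d h c k lt (processed s k)
              (λ i 1+i<k → subst₂ _≤_ (sym (IH i)) (sym (IH (suc i)))
                (sortPrefix-sorted (chain d h c s) k i 1+i<k)) j)
            (place-cong k IH j)
    -- Past the end of the array the entry is the padding d, the largest possible key, so placing it
    -- changes nothing and the loop still follows `sortPrefix`.
    ... | no k≮n = trans (IH j) (sym (place-max k (sortPrefix f k) (λ i _ → top i) j))
      where
      f = chain d h c s
      top : ∀ i → sortPrefix f k i ≤ sortPrefix f k k
      top i rewrite sortPrefix-rest f k k ≤-refl | at-≥ {d = d} {array s} (≮⇒≥ k≮n) =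
        sortPrefix-bounded f k d (λ j → at-bounded b (c + j * h)) i

    processed-other : ∀ (s : State n) k i → (∀ j → i ≢ c + j * h) →
                      at d (array (processed s k)) i ≡ at d (array s) i
    processed-other s zero    i i∉ = refl
    processed-other {n} s (suc k) i i∉ rewrite foldl-upTo (insertIfPresent h c) s k
      with c + k * h <? n
    ... | yes lt = trans (insert-other d h c k lt (processed s k) i i∉) (processed-other s k i i∉)
    ... | no  _  = processed-other s k i i∉

    -- The last hypothesis speaks of the chain f before the pass: for j + g < k all of f 0, ..., f j
    -- are at most f k, so by `sortPrefix-≤` the key at j of the sorted prefix is too, and
    -- `insert-comparisons` applies. The factor k ⊓ Q counts only insertions inside the array.
    processed-comparisons : ∀ (s : State n) k g Q → Bounded d s →
      (∀ k → c + k * h < n → k < Q) →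
      (∀ i k → i + g ≤ k → chain d h c s i ≤ chain d h c s k) →
      comparisons (processed s k) ≤ comparisons s + (k ⊓ Q) * suc g
    processed-comparisons s zero    g Q b k<Q small = ≤-reflexive (sym (+-identityʳ _))
    processed-comparisons {n} s (suc k) g Q b k<Q small rewrite foldl-upTo (insertIfPresent h c) s k
      with IH ← processed-comparisons s k g Q b k<Q small
      with c + k * h <? n
    ... | no  _  = ≤-trans IH (+-monoʳ-≤ (comparisons s) (*-monoˡ-≤ (suc g) (⊓-monoˡ-≤ Q (n≤1+n k))))
    ... | yes lt = begin
      comparisons (insert h c k lt (processed s k))
        ≤⟨ insert-comparisons d h c k g lt (processed s k) small′ ⟩
      comparisons (processed s k) + suc g            ≤⟨ +-monoˡ-≤ (suc g) IH ⟩
      comparisons s + (k ⊓ Q) * suc g + suc g        ≡⟨ +-assoc (comparisons s) _ _ ⟩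
      comparisons s + ((k ⊓ Q) * suc g + suc g)      ≡⟨ cong (comparisons s +_) (+-comm _ (suc g)) ⟩
      comparisons s + suc (k ⊓ Q) * suc g            ≡⟨ cong (λ z → comparisons s + z * suc g) eq ⟩
      comparisons s + (suc k ⊓ Q) * suc g            ∎
      where
      open ≤-Reasoning
      f = chain d h c s
      eq : suc (k ⊓ Q) ≡ suc k ⊓ Q
      eq rewrite m≤n⇒m⊓n≡m (<⇒≤ (k<Q k lt)) | m≤n⇒m⊓n≡m (k<Q k lt) = refl
      small′ : ∀ j → j + g < k → chain d h c (processed s k) j ≤ chain d h c (processed s k) k
      small′ j j+g<k rewrite processed-chain s k b j | processed-chain s k b k
                           | sortPrefix-rest f k k ≤-refl =
        sortPrefix-≤ f k j (f k) (≤-<-trans (m≤m+n j g) j+g<k)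
          (λ i i≤j → small i k (≤-trans (+-monoˡ-≤ g i≤j) (<⇒≤ j+g<k)))

  -- k-sortedness. When d bounds the keys, the padding makes the condition hold automatically for i
  -- + k ≥ n.
  Ordered : ℕ → ℕ → State n → Set
  Ordered d k s = ∀ i → at d (array s) i ≤ at d (array s) (i + k)

  module _ (d h : ℕ) .{{_ : NonZero h}} where

    chains-disjoint : ∀ {c c′} → c < h → c′ < h → c′ ≢ c → ∀ i j → c′ + i * h ≢ c + j * h
    chains-disjoint {c} {c′} c<h c′<h c′≢c i j eq = c′≢c (begin
      c′                 ≡⟨ m<n⇒m%n≡m c′<h ⟨
      c′ % h             ≡⟨ [m+kn]%n≡m%n c′ i h ⟨
      (c′ + i * h) % h   ≡⟨ cong (_% h) eq ⟩
      (c + j * h) % h    ≡⟨ [m+kn]%n≡m%n c j h ⟩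
      c % h              ≡⟨ m<n⇒m%n≡m c<h ⟩
      c                  ∎)
      where open ≡-Reasoning

    passed : State n → ℕ → State n
    passed s m = foldl (sortChain h) s (upTo m)

    passed-bounded : ∀ (s : State n) m → Bounded d s → Bounded d (passed s m)
    passed-bounded s m = foldl-invariant (Bounded d) _ sortChain-bounded (upTo m)

    passed-pending : ∀ (s : State n) {m c} → m ≤ c → c < h →
                     chain d h c (passed s m) ≗ chain d h c s
    passed-pending s {zero}  m≤c c<h j = refl
    passed-pending {n} s {suc m} {c} m<c c<h j rewrite foldl-upTo (sortChain h) s m =
      trans (processed-other d h m (passed s m) n (c + j * h)
              (λ i → chains-disjoint (<-trans m<c c<h) c<h (>⇒≢ m<c) j i))
            (passed-pending s (<⇒≤ m<c) c<h j)

    passed-done : ∀ (s : State n) {m c} → Bounded d s → c < m → m ≤ h →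
                  chain d h c (passed s m) ≗ sortPrefix (chain d h c s) n
    passed-done {n} s {suc m} {c} b (s≤s c≤m) m<h j rewrite foldl-upTo (sortChain h) s m
      with m≤n⇒m<n∨m≡n c≤m
    ... | inj₂ refl = trans (processed-chain d h c (passed s c) n (passed-bounded s c b) j)
                        (sortPrefix-cong (passed-pending s ≤-refl m<h) n j)
    ... | inj₁ c<m  = trans (processed-other d h m (passed s m) n (c + j * h)
                              (λ i → chains-disjoint m<h (<-trans c<m m<h) (<⇒≢ c<m) j i))
                        (passed-done s b c<m (<⇒≤ m<h) j)

    passed-comparisons : ∀ (s : State n) m g Q → m ≤ h → Bounded d s →
      (∀ c k → c + k * h < n → k < Q) →
      (∀ i t → g ≤ t → at d (array s) i ≤ at d (array s) (i + t * h)) →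
      comparisons (passed s m) ≤ comparisons s + m * (Q * suc g)
    passed-comparisons s zero    g Q _   b k<Q small = ≤-reflexive (sym (+-identityʳ _))
    passed-comparisons {n} s (suc m) g Q m<h b k<Q small rewrite foldl-upTo (sortChain h) s m = begin
      comparisons (processed d h m (passed s m) n)
        ≤⟨ processed-comparisons d h m (passed s m) n g Q (passed-bounded s m b) (k<Q m) small′ ⟩
      comparisons (passed s m) + (n ⊓ Q) * suc g
        ≤⟨ +-mono-≤ (passed-comparisons s m g Q (<⇒≤ m<h) b k<Q small)
             (*-monoˡ-≤ (suc g) (m⊓n≤n n Q)) ⟩
      comparisons s + m * (Q * suc g) + Q * suc g    ≡⟨ +-assoc (comparisons s) _ _ ⟩
      comparisons s + (m * (Q * suc g) + Q * suc g)  ≡⟨ cong (comparisons s +_) (+-comm _ (Q * suc g)) ⟩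
      comparisons s + suc m * (Q * suc g)            ∎
      where
      open ≤-Reasoning
      small′ : ∀ i k → i + g ≤ k → chain d h m (passed s m) i ≤ chain d h m (passed s m) k
      small′ i k i+g≤k rewrite passed-pending s {m} ≤-refl m<h i | passed-pending s {m} ≤-refl m<h k =
        subst (λ p → at d (array s) (m + i * h) ≤ at d (array s) p) eq
          (small (m + i * h) (k ∸ i) (subst (_≤ k ∸ i) (m+n∸m≡n i g) (∸-monoˡ-≤ i i+g≤k)))
        where
        eq : m + i * h + (k ∸ i) * h ≡ m + k * h
        eq = trans (+-assoc m (i * h) _) (cong (m +_)
               (trans (sym (*-distribʳ-+ h i (k ∸ i)))
                 (cong (_* h) (m+[n∸m]≡n (≤-trans (m≤m+n i g) i+g≤k)))))

    pass-chain : ∀ (s : State n) {c} → Bounded d s → c < h →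
                 chain d h c (pass s h) ≗ sortPrefix (chain d h c s) n
    pass-chain s b c<h = passed-done s b c<h ≤-refl

    pass-at : ∀ (s : State n) → Bounded d s → ∀ i →
              at d (array (pass s h)) i ≡ sortPrefix (chain d h (i % h) s) n (i / h)
    pass-at s b i = trans (cong (at d (array (pass s h))) (m≡m%n+[m/n]*n i h))
                      (pass-chain s b (m%n<n i h) (i / h))

    pass-ordered : ∀ (s : State n) → Bounded d s → Ordered d h (pass s h)
    pass-ordered {n} s b i = subst₂ _≤_ (sym (pass-at s b i)) (sym eq) le
      where
      c = i % h
      j = i / h
      f = chain d h c s
      eq : at d (array (pass s h)) (i + h) ≡ sortPrefix f n (suc j)
      eq = trans (cong (at d (array (pass s h))) (trans (cong (_+ h) (m≡m%n+[m/n]*n i h))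
             (trans (+-assoc c (j * h) h) (cong (c +_) (+-comm (j * h) h)))))
           (pass-chain s b (m%n<n i h) (suc j))
      le : sortPrefix f n j ≤ sortPrefix f n (suc j)
      le with suc j <? n
      ... | yes 1+j<n = sortPrefix-sorted f n j 1+j<n
      ... | no  1+j≮n rewrite sortPrefix-rest f n (suc j) (≮⇒≥ 1+j≮n)
            | at-≥ {d = d} {array s} (≤-trans (≮⇒≥ 1+j≮n) (index≤position d h c (suc j))) =
            sortPrefix-bounded f n d (λ l → at-bounded b (c + l * h)) j

    -- The classical theorem that h-sorting keeps a k-sorted array k-sorted. Position i + k lies on
    -- the chain of c′ = (c + k) mod h, shifted by t = (c + k) div h, so k-sortedness reads f l ≤ g
    -- (l + t) and `sortPrefix-shift` applies. From index n on, g is padding, which reduces n + t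
    -- sorted entries to n.
    pass-preserves : ∀ (s : State n) → Bounded d s → ∀ k → Ordered d k s → Ordered d k (pass s h)
    pass-preserves {n} s b k ord i = subst₂ _≤_ (sym (pass-at s b i)) (sym eq) le
      where
      c  = i % h
      j  = i / h
      c′ = (c + k) % h
      t  = (c + k) / h
      f  = chain d h c s
      g  = chain d h c′ s
      shift : ∀ l → c + l * h + k ≡ c′ + (l + t) * h
      shift l = begin
        c + l * h + k            ≡⟨ arith₁ c (l * h) k ⟩
        (c + k) + l * h          ≡⟨ cong (_+ l * h) (m≡m%n+[m/n]*n (c + k) h) ⟩
        (c′ + t * h) + l * h     ≡⟨ arith₂ c′ t l h ⟩
        c′ + (l + t) * h         ∎
        where
        open ≡-Reasoning
        arith₁ : ∀ x y z → x + y + z ≡ (x + z) + y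
        arith₁ = solve-∀
        arith₂ : ∀ x y z w → (x + y * w) + z * w ≡ x + (z + y) * w
        arith₂ = solve-∀
      f≤g : ∀ l → f l ≤ g (l + t)
      f≤g l = subst (λ p → f l ≤ at d (array s) p) (shift l) (ord (c + l * h))
      eq : at d (array (pass s h)) (i + k) ≡ sortPrefix g n (j + t)
      eq = trans (cong (at d (array (pass s h))) (trans (cong (_+ k) (m≡m%n+[m/n]*n i h)) (shift j)))
             (pass-chain s b (m%n<n (c + k) h) (j + t))
      top : ∀ l m → n ≤ l → g m ≤ g l
      top l m n≤l = subst (g m ≤_)
        (sym (at-≥ {d = d} {array s} (≤-trans n≤l (index≤position d h c′ l)))) (at-bounded b (c′ + m * h))
      le : sortPrefix f n j ≤ sortPrefix g n (j + t)
      le = subst (sortPrefix f n j ≤_) (sortPrefix-stable g n (n + t) (m≤m+n n t) top (j + t))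
             (sortPrefix-shift f g t f≤g n j)

    -- There are h chains of at most n / h + 1 positions, and h (n / h + 1) ≤ n + h ≤ 2 n.
    pass-comparisons : ∀ (s : State n) g → h ≤ n → Bounded d s →
      (∀ i t → g ≤ t → at d (array s) i ≤ at d (array s) (i + t * h)) →
      comparisons (pass s h) ≤ comparisons s + 2 * n * suc g
    pass-comparisons {n} s g h≤n b small = begin
      comparisons (pass s h)                             ≤⟨ passed-comparisons s h g (suc (n / h)) ≤-refl b k< small ⟩
      comparisons s + h * (suc (n / h) * suc g)          ≡⟨ cong (comparisons s +_) (*-assoc h (suc (n / h)) (suc g)) ⟨
      comparisons s + h * suc (n / h) * suc g            ≤⟨ +-monoʳ-≤ (comparisons s) (*-monoˡ-≤ (suc g) le) ⟩
      comparisons s + 2 * n * suc g                      ∎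
      where
      open ≤-Reasoning
      le : h * suc (n / h) ≤ 2 * n
      le = begin
        h * suc (n / h)       ≡⟨ *-suc h (n / h) ⟩
        h + h * (n / h)       ≡⟨ cong (h +_) (*-comm h (n / h)) ⟩
        h + (n / h) * h       ≤⟨ +-mono-≤ h≤n (≤-trans (m≤n+m _ (n % h)) (≤-reflexive (sym (m≡m%n+[m/n]*n n h)))) ⟩
        n + n                 ≡⟨ cong (n +_) (+-identityʳ n) ⟨
        2 * n                 ∎
      k< : ∀ c k → c + k * h < n → k < suc (n / h)
      k< c k lt = s≤s (*-cancelʳ-≤ k (n / h) h (≮⇒≥ (λ q<k → <-irrefl refl (begin-strict
        n                        ≡⟨ m≡m%n+[m/n]*n n h ⟩
        n % h + (n / h) * h      <⟨ +-monoˡ-< ((n / h) * h) (m%n<n n h) ⟩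
        suc (n / h) * h          ≤⟨ *-monoˡ-≤ h (*-cancelʳ-< h (n / h) k q<k) ⟩
        k * h                    ≤⟨ m≤n+m (k * h) c ⟩
        c + k * h                <⟨ lt ⟩
        n                        ∎))))

  -- Worst-case comparisons of a decreasing sequence of passes.

  ∈-tuples⁻ : ∀ k m {v : Vec ℕ k} → v ∈ tuples k m → All (_< m) v
  ∈-tuples⁻ zero    m {[]} _ = []
  ∈-tuples⁻ (suc k) m v∈ with ∈-cartesianProductWith⁻ _∷_ (upTo m) (tuples k m) v∈
  ... | _ , _ , x∈ , xs∈ , refl = ∈-upTo⁻ x∈ ∷ ∈-tuples⁻ k m xs∈

  ∈-tuples⁺ : ∀ {k m} {v : Vec ℕ k} → All (_< m) v → v ∈ tuples k m
  ∈-tuples⁺ []           = here refl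
  ∈-tuples⁺ (x<m ∷ xs<m) = ∈-cartesianProductWith⁺ _∷_ (∈-upTo⁺ x<m) (∈-tuples⁺ xs<m)

  max-upper : ∀ {A : Set} (f : A → ℕ) b xs → (∀ {x} → x ∈ xs → f x ≤ b) →
              List.foldr _⊔_ 0 (List.map f xs) ≤ b
  max-upper f b []       _   = z≤n
  max-upper f b (x ∷ xs) f≤b = ⊔-lub (f≤b (here refl)) (max-upper f b xs (f≤b ∘ there))

  max-lower : ∀ {A : Set} (f : A → ℕ) {x xs} → x ∈ xs → f x ≤ List.foldr _⊔_ 0 (List.map f xs)
  max-lower f {xs = x ∷ xs} (here refl) = m≤m⊔n (f x) _
  max-lower f {xs = y ∷ xs} (there x∈)  = ≤-trans (max-lower f x∈) (m≤n⊔m (f y) _)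

  W≤C : ∀ n H → W n H ≤ C n H
  W≤C n H = max-upper _ _ (permutations n) λ {v} v∈ →
    ≤-trans (shellsort-exchanges≤comparisons H (lookup v))
      (max-lower (λ v → comparisons (shellsort H (lookup v))) v∈)

  permutation< : ∀ {v} → v ∈ permutations n → All (_< n) v
  permutation< {n} v∈ = ∈-tuples⁻ n n (proj₁ (∈-filter⁻ unique? {xs = tuples n n} v∈))

  Ordered-* : ∀ {d k} {s : State n} u → Ordered d k s → Ordered d (u * k) s
  Ordered-* {d = d} {k} {s} zero    ord i = ≤-reflexive (cong (at d (array s)) (sym (+-identityʳ i)))
  Ordered-* {d = d} {k} {s} (suc u) ord i = ≤-trans (ord i)
    (subst (λ p → at d (array s) (i + k) ≤ at d (array s) p) (+-assoc i k (u * k)) (Ordered-* {s = s} u ord (i + k)))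

  Ordered-+ : ∀ {d k l} {s : State n} → Ordered d k s → Ordered d l s → Ordered d (k + l) s
  Ordered-+ {d = d} {k} {l} {s} ordₖ ordₗ i = ≤-trans (ordₖ i)
    (subst (λ p → at d (array s) (i + k) ≤ at d (array s) p) (+-assoc i k l) (ordₗ (i + k)))

  Ordered-beyond : ∀ {d k} {s : State n} → Bounded d s → n ≤ k → Ordered d k s
  Ordered-beyond {d = d} {k} {s} b n≤k i = subst (at d (array s) i ≤_)
    (sym (at-≥ {d = d} {array s} (≤-trans n≤k (m≤n+m k i)))) (at-bounded b i)

  module _ {P : ℕ → Set} (P? : Decidable P) (a b g n : ℕ) (P>0 : ∀ {h} → P h → 0 < h)
    (1<a : 1 < a) (1<b : 1 < b)
    (P-*a : ∀ {h} → P h → h * a < n → P (h * a)) (P-*b : ∀ {h} → P h → h * b < n → P (h * b))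
    (generated : ∀ t → g ≤ t → ∃[ u ] ∃[ v ] t ≡ u * a + v * b) where

    -- Gaps come in decreasing order. The hypothesis on s is the invariant: when gap m is reached,
    -- the array is sorted for every larger gap, established by that gap's own pass and kept by
    -- `pass-preserves`.
    passes-comparisons : ∀ m (s : State n) → m ≤ n → Bounded n s →
      (∀ h → m ≤ h → P h → Ordered n h s) →
      comparisons (foldl pass s (filter P? (downFrom m))) ≤
        comparisons s + length (filter P? (downFrom m)) * (2 * n * suc g)
    passes-comparisons zero    s _ _ _ = ≤-reflexive (sym (+-identityʳ _))
    passes-comparisons (suc m) s m<n bd ord with P? m
    ... | no ¬Pm = passes-comparisons m s (<⇒≤ m<n) bd ord′
      where
      ord′ : ∀ h → m ≤ h → P h → Ordered n h s
      ord′ h m≤h Ph with m≤n⇒m<n∨m≡n m≤h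
      ... | inj₁ m<h  = ord h m<h Ph
      ... | inj₂ refl = ⊥-elim (¬Pm Ph)
    ... | yes Pm = begin
      comparisons (foldl pass (pass s m) hs)
        ≤⟨ passes-comparisons m (pass s m) (<⇒≤ m<n) (pass-bounded m bd) ord′ ⟩
      comparisons (pass s m) + length hs * (2 * n * suc g)
        ≤⟨ +-monoˡ-≤ _ (pass-comparisons n m s g (<⇒≤ m<n) bd small) ⟩
      comparisons s + 2 * n * suc g + length hs * (2 * n * suc g)
        ≡⟨ +-assoc (comparisons s) _ _ ⟩
      comparisons s + suc (length hs) * (2 * n * suc g)   ∎
      where
      open ≤-Reasoning
      hs = filter P? (downFrom m)
      instance
        m≢0 : NonZero m
        m≢0 = >-nonZero (P>0 Pm)
      -- m c is either an earlier gap or at least n, where the padding makes the array sorted for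
      -- it.
      multiple : ∀ c → 1 < c → (m * c < n → P (m * c)) → Ordered n (m * c) s
      multiple c 1<c P-*c with m * c <? n
      ... | yes mc<n = ord (m * c) (m<m*n m c 1<c) (P-*c mc<n)
      ... | no  mc≮n = Ordered-beyond {s = s} bd (≮⇒≥ mc≮n)
      -- t m = u (m a) + v (m b), and the distances for which the array is sorted are closed under
      -- addition.
      small : ∀ i t → g ≤ t → at n (array s) i ≤ at n (array s) (i + t * m)
      small i t g≤t with generated t g≤t
      ... | u , v , refl = subst (λ k → at n (array s) i ≤ at n (array s) (i + k)) (arith u v m a b)
        (Ordered-+ {k = u * (m * a)} {s = s} (Ordered-* {s = s} u (multiple a 1<a (P-*a Pm)))
                   (Ordered-* {s = s} v (multiple b 1<b (P-*b Pm))) i)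
        where
        arith : ∀ u v m a b → u * (m * a) + v * (m * b) ≡ (u * a + v * b) * m
        arith = solve-∀
      ord′ : ∀ h → m ≤ h → P h → Ordered n h (pass s m)
      ord′ h m≤h Ph with m≤n⇒m<n∨m≡n m≤h
      ... | inj₁ m<h  = pass-preserves n m s bd h (ord h m<h Ph)
      ... | inj₂ refl = pass-ordered n m s bd

    C-upper : C n (filter P? (downFrom n)) ≤ length (filter P? (downFrom n)) * (2 * n * suc g)
    C-upper = max-upper _ _ (permutations n) λ {v} v∈ →
      let bd : Bounded n (state (lookup v) 0 0)
          bd x = <⇒≤ (All.lookup⁺ (permutation< v∈) x)
      in passes-comparisons n (state (lookup v) 0 0) ≤-refl bd
           (λ h n≤h _ → Ordered-beyond {s = state (lookup v) 0 0} bd n≤h)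

  -- Exchanges forced by reversed blocks.

  insertIfPresent-exchanges : ∀ h c .{{_ : NonZero h}} (s : State n) k →
                              exchanges s ≤ exchanges (insertIfPresent h c s k)
  insertIfPresent-exchanges {n} h c s k with c + k * h <? n
  ... | no  _  = ≤-refl
  ... | yes lt = subst (_≤ exchanges (insert h c k lt s)) (+-identityʳ (exchanges s))
          (insert-exchanges 0 h c k 0 lt s z≤n (λ j j<k k≤j+0 →
            ⊥-elim (<-irrefl refl (<-≤-trans j<k (subst (k ≤_) (+-identityʳ j) k≤j+0)))))

  processed-exchanges : ∀ d h c .{{_ : NonZero h}} (s : State n) {k l} → k ≤′ l →
                        exchanges (processed d h c s k) ≤ exchanges (processed d h c s l)
  processed-exchanges d h c s ≤′-refl = ≤-refl
  processed-exchanges d h c s (≤′-step {l} k≤l) rewrite foldl-upTo (insertIfPresent h c) s l =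
    ≤-trans (processed-exchanges d h c s k≤l) (insertIfPresent-exchanges h c (processed d h c s l) l)

  sortPrefix-monotone : ∀ f k → (∀ j → f j ≤ f (suc j)) → sortPrefix f k ≗ f
  sortPrefix-monotone f zero    mono j = refl
  sortPrefix-monotone f (suc k) mono j = trans (place-cong k (sortPrefix-monotone f k mono) j)
    (place-sortedBelow k f (λ i _ → mono i) j)

  pass-unchanged : ∀ d h .{{_ : NonZero h}} (s : State n) → Bounded d s → Ordered d h s →
                   at d (array (pass s h)) ≗ at d (array s)
  pass-unchanged {n} d h s b ord i = trans (pass-at d h s b i)
    (trans (sortPrefix-monotone _ n mono (i / h)) (cong (at d (array s)) (sym (m≡m%n+[m/n]*n i h))))
    where
    mono : ∀ j → chain d h (i % h) s j ≤ chain d h (i % h) s (suc j)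
    mono j = subst (λ p → chain d h (i % h) s j ≤ at d (array s) p)
      (trans (+-assoc (i % h) (j * h) h) (cong (i % h +_) (+-comm (j * h) h)))
      (ord (i % h + j * h))

  -- o (o - 1) / 2, the number of inversions of a reversed block of length o.
  triangle : ℕ → ℕ
  triangle zero    = 0
  triangle (suc o) = triangle o + o

  triangle-double : ∀ o → 2 * triangle (suc o) ≡ suc o * o
  triangle-double zero    = refl
  triangle-double (suc o) = begin
    2 * (triangle (suc o) + suc o)     ≡⟨ *-distribˡ-+ 2 (triangle (suc o)) (suc o) ⟩
    2 * triangle (suc o) + 2 * suc o   ≡⟨ cong (_+ 2 * suc o) (triangle-double o) ⟩
    suc o * o + 2 * suc o              ≡⟨ arith o ⟩
    suc (suc o) * suc o                ∎
    where
    open ≡-Reasoning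
    arith : ∀ o → suc o * o + 2 * suc o ≡ suc (suc o) * suc o
    arith = solve-∀

  module _ (a : ℕ) .{{_ : NonZero a}} (n : ℕ) where

    -- The identity with every complete block of length a reversed.
    reversal : ℕ → ℕ
    reversal i with suc (i / a) * a ≤? n
    ... | yes _ = i / a * a + (a ∸ suc (i % a))
    ... | no  _ = i

    module _ {i : ℕ} where

      reversal-block : suc (i / a) * a ≤ n → reversal i ≡ i / a * a + (a ∸ suc (i % a))
      reversal-block le with suc (i / a) * a ≤? n
      ... | yes _  = refl
      ... | no nle = ⊥-elim (nle le)

      reversal-rest : ¬ suc (i / a) * a ≤ n → reversal i ≡ i
      reversal-rest nle with suc (i / a) * a ≤? n
      ... | yes le = ⊥-elim (nle le)
      ... | no  _  = refl

    i<block : ∀ i → i < suc (i / a) * a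
    i<block i = begin-strict
      i                        ≡⟨ m≡m%n+[m/n]*n i a ⟩
      i % a + i / a * a        <⟨ +-monoˡ-< (i / a * a) (m%n<n i a) ⟩
      suc (i / a) * a          ∎
      where open ≤-Reasoning

    reversal-upper : ∀ i → reversal i < suc (i / a) * a
    reversal-upper i with suc (i / a) * a ≤? n
    ... | no  _ = i<block i
    ... | yes _ = begin-strict
      i / a * a + (a ∸ suc (i % a))   <⟨ +-monoʳ-< (i / a * a) (∸-monoʳ-< z<s (m%n<n i a)) ⟩
      i / a * a + a                   ≡⟨ +-comm (i / a * a) a ⟩
      suc (i / a) * a                 ∎
      where open ≤-Reasoning

    reversal-lower : ∀ i → i / a * a ≤ reversal i
    reversal-lower i with suc (i / a) * a ≤? n
    ... | yes _ = m≤m+n (i / a * a) _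
    ... | no  _ = m/n*n≤m i a

    reversal< : ∀ {i} → i < n → reversal i < n
    reversal< {i} i<n with suc (i / a) * a ≤? n in eq
    ... | no  _  = i<n
    ... | yes le = <-≤-trans (subst (_< suc (i / a) * a) (reversal-block le) (reversal-upper i)) le

    reversal-quotient : ∀ i → reversal i / a ≡ i / a
    reversal-quotient i = ≤-antisym
      (s≤s⁻¹ (*-cancelʳ-< a (reversal i / a) (suc (i / a))
        (≤-<-trans (m/n*n≤m (reversal i) a) (reversal-upper i))))
      (s≤s⁻¹ (*-cancelʳ-< a (i / a) (suc (reversal i / a))
        (≤-<-trans (reversal-lower i) (i<block (reversal i)))))

    reversal-injective : ∀ {i j} → reversal i ≡ reversal j → i ≡ j
    reversal-injective {i} {j} eq = by (suc (i / a) * a ≤? n)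
      where
      q≡ : i / a ≡ j / a
      q≡ = trans (sym (reversal-quotient i)) (trans (cong (_/ a) eq) (reversal-quotient j))
      by : Dec (suc (i / a) * a ≤ n) → i ≡ j
      by (no nle) = trans (sym (reversal-rest nle)) (trans eq
        (reversal-rest (subst (λ q → ¬ suc q * a ≤ n) q≡ nle)))
      by (yes le) = begin
        i                      ≡⟨ m≡m%n+[m/n]*n i a ⟩
        i % a + i / a * a      ≡⟨ cong₂ (λ o q → o + q * a) o≡ q≡ ⟩
        j % a + j / a * a      ≡⟨ m≡m%n+[m/n]*n j a ⟨
        j                      ∎
        where
        open ≡-Reasoning
        o≡ : i % a ≡ j % a
        o≡ = suc-injective (∸-cancelˡ-≡ (m%n<n i a) (m%n<n j a) (+-cancelˡ-≡ (j / a * a) _ _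
          (trans (cong (λ q → q * a + (a ∸ suc (i % a))) (sym q≡))
          (trans (sym (reversal-block le)) (trans eq
            (reversal-block (subst (λ q → suc q * a ≤ n) q≡ le)))))))

    -- i + h lies in a later block than i, and `reversal` keeps every position in its block.
    reversal-ordered : ∀ h → a ≤ h → ∀ i → reversal i ≤ reversal (i + h)
    reversal-ordered h a≤h i = ≤-trans (<⇒≤ (reversal-upper i))
      (≤-trans (*-monoˡ-≤ a le) (reversal-lower (i + h)))
      where
      le : suc (i / a) ≤ (i + h) / a
      le = s≤s⁻¹ (*-cancelʳ-< a (suc (i / a)) (suc ((i + h) / a)) (begin-strict
        suc (i / a) * a            ≡⟨⟩
        a + i / a * a              ≤⟨ +-mono-≤ a≤h (m/n*n≤m i a) ⟩
        h + i                      ≡⟨ +-comm h i ⟩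
        i + h                      <⟨ i<block (i + h) ⟩
        suc ((i + h) / a) * a      ∎))
        where open ≤-Reasoning

    reversal-position : ∀ q o → o < a → suc q * a ≤ n → reversal (q * a + o) ≡ q * a + (a ∸ suc o)
    reversal-position q o o<a le = trans (reversal-block (subst (λ q → suc q * a ≤ n) (sym q≡) le))
      (cong₂ (λ q o → q * a + (a ∸ suc o)) q≡ o≡)
      where
      q≡ : (q * a + o) / a ≡ q
      q≡ = trans (+-distrib-/-∣ˡ o (n∣m*n q)) (trans (cong₂ _+_ (m*n/n≡m q a) (m<n⇒m/n≡0 o<a)) (+-identityʳ q))
      o≡ : (q * a + o) % a ≡ o
      o≡ = trans (cong (_% a) (+-comm (q * a) o)) (trans ([m+kn]%n≡m%n o q a) (m<n⇒m%n≡m o<a))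

    module _ (s : State n) (bd : Bounded n s) (array≡ : ∀ {i} → i < n → at n (array s) i ≡ reversal i) where

      chain≡ : ∀ {i} → i < n → chain n 1 0 s i ≡ reversal i
      chain≡ {i} i<n = trans (cong (at n (array s)) (*-identityʳ i)) (array≡ i<n)

      -- The o earlier keys of the block are larger than the one at offset o. Earlier insertions
      -- have permuted them, but by `sortPrefix-≥` the positions from q a on still hold larger keys,
      -- so the new key passes o of them.
      last-pass-step : ∀ q o → o < a → suc q * a ≤ n →
        exchanges (processed n 1 0 s (q * a + o)) + o ≤ exchanges (processed n 1 0 s (suc (q * a + o)))
      last-pass-step q o o<a le rewrite foldl-upTo (insertIfPresent 1 0) s (q * a + o)
        with (q * a + o) * 1 <? n
      ... | no  nlt = ⊥-elim (nlt (subst (_< n) (sym (*-identityʳ _)) k<n))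
        where
        k<n : q * a + o < n
        k<n = <-≤-trans (+-monoʳ-< (q * a) o<a) (subst (_≤ n) (+-comm a (q * a)) le)
      ... | yes lt = insert-exchanges n 1 0 k o lt (processed n 1 0 s k) (m≤n+m o (q * a)) large
        where
        k = q * a + o
        k<n : k < n
        k<n = subst (_< n) (*-identityʳ k) lt
        f = chain n 1 0 s
        larger : ∀ i → q * a ≤ i → i < k → f k < f i
        larger i qa≤i i<k = subst₂ _<_
          (sym (trans (chain≡ k<n) (reversal-position q o o<a le)))
          (sym (trans (chain≡ (<-trans i<k k<n)) (trans (cong reversal (sym (m+[n∸m]≡n qa≤i)))
            (reversal-position q (i ∸ q * a) (<-trans o′<o o<a) le))))
          (+-monoʳ-< (q * a) (∸-monoʳ-< (s≤s o′<o) o<a))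
          where
          o′<o : i ∸ q * a < o
          o′<o = +-cancelˡ-< (q * a) _ _ (subst (_< k) (sym (m+[n∸m]≡n qa≤i)) i<k)
        large : ∀ j → j < k → k ≤ j + o → chain n 1 0 (processed n 1 0 s k) k < chain n 1 0 (processed n 1 0 s k) j
        large j j<k k≤j+o = subst₂ _<_
          (sym (trans (processed-chain n 1 0 s k bd k) (sortPrefix-rest f k k ≤-refl)))
          (sym (processed-chain n 1 0 s k bd j))
          (sortPrefix-≥ f k j (suc (f k)) j<k
            (λ i j≤i i<k → larger i (≤-trans (+-cancelʳ-≤ o (q * a) j k≤j+o) j≤i) i<k))

      last-pass-block : ∀ q o → o ≤ a → suc q * a ≤ n →
        exchanges (processed n 1 0 s (q * a)) + triangle o ≤ exchanges (processed n 1 0 s (q * a + o))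
      last-pass-block q zero    _   le = ≤-reflexive (trans (+-identityʳ _)
        (cong (exchanges ∘ processed n 1 0 s) (sym (+-identityʳ (q * a)))))
      last-pass-block q (suc o) o<a le = begin
        E (q * a) + (triangle o + o)   ≡⟨ +-assoc (E (q * a)) (triangle o) o ⟨
        E (q * a) + triangle o + o     ≤⟨ +-monoˡ-≤ o (last-pass-block q o (<⇒≤ o<a) le) ⟩
        E (q * a + o) + o              ≤⟨ last-pass-step q o o<a le ⟩
        E (suc (q * a + o))            ≡⟨ cong E (+-suc (q * a) o) ⟨
        E (q * a + suc o)              ∎
        where
        open ≤-Reasoning
        E = λ k → exchanges (processed n 1 0 s k)

      last-pass-blocks : ∀ q → q * a ≤ n → q * triangle a ≤ exchanges (processed n 1 0 s (q * a))
      last-pass-blocks zero    _  = z≤n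
      last-pass-blocks (suc q) le = begin
        triangle a + q * triangle a        ≡⟨ +-comm (triangle a) _ ⟩
        q * triangle a + triangle a        ≤⟨ +-monoˡ-≤ (triangle a) (last-pass-blocks q (≤-trans (m≤n+m (q * a) a) le)) ⟩
        E (q * a) + triangle a             ≤⟨ last-pass-block q a ≤-refl le ⟩
        E (q * a + a)                      ≡⟨ cong E (+-comm (q * a) a) ⟩
        E (suc q * a)                      ∎
        where
        open ≤-Reasoning
        E = λ k → exchanges (processed n 1 0 s k)

    -- By `reversal-ordered` each of these passes finds its chains sorted already. The agreement
    -- with `reversal` is kept below n only, since beyond the end the array reads as n.
    unchanged-prefix : ∀ hs → Allᴸ (a ≤_) hs → (s : State n) → Bounded n s →
      (∀ {i} → i < n → at n (array s) i ≡ reversal i) →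
      Bounded n (foldl pass s hs) × (∀ {i} → i < n → at n (array (foldl pass s hs)) i ≡ reversal i)
    unchanged-prefix []       []         s bd array≡ = bd , array≡
    unchanged-prefix (h ∷ hs) (a≤h ∷ a≤) s bd array≡ =
      unchanged-prefix hs a≤ (pass s h) (pass-bounded h bd)
        (λ {i} i<n → trans (pass-unchanged n h {{h≢0}} s bd ordered i) (array≡ i<n))
      where
      h≢0 : NonZero h
      h≢0 = >-nonZero (<-≤-trans (>-nonZero⁻¹ a) a≤h)
      ordered : Ordered n h s
      ordered i = by (i + h <? n)
        where
        by : Dec (i + h < n) → at n (array s) i ≤ at n (array s) (i + h)
        by (yes i+h<n) = subst₂ _≤_ (sym (array≡ (≤-<-trans (m≤m+n i h) i+h<n))) (sym (array≡ i+h<n))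
          (reversal-ordered h a≤h i)
        by (no  i+h≮n) = subst (at n (array s) i ≤_)
          (sym (at-≥ {d = n} {array s} (≮⇒≥ i+h≮n))) (at-bounded bd i)

    -- Each of the q = n / a complete blocks costs a (a - 1) / 2 exchanges in the last pass. Of the
    -- factor 8, a factor 2 comes from n < (q + 1) a ≤ 2 q a and a factor 4 from a² ≤ 2 a (a - 1).
    W-lower : ∀ hs → Allᴸ (a ≤_) hs → 1 < a → a ≤ n → n * a ≤ 8 * W n (hs ++ 1 ∷ [])
    W-lower hs a≤ 1<a a≤n = begin
      n * a                                    ≤⟨ *-monoˡ-≤ a (<⇒≤ (i<block n)) ⟩
      suc q * a * a                            ≤⟨ *-monoˡ-≤ a (*-monoˡ-≤ a (+-monoˡ-≤ q q>0)) ⟩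
      (q + q) * a * a                          ≡⟨ arith q a ⟩
      2 * q * (a * a)                          ≤⟨ *-monoʳ-≤ (2 * q) (square a 1<a) ⟩
      2 * q * (4 * triangle a)                 ≡⟨ arith′ q (triangle a) ⟩
      8 * (q * triangle a)                     ≤⟨ *-monoʳ-≤ 8 exchanges≥ ⟩
      8 * W n (hs ++ 1 ∷ [])                   ∎
      where
      open ≤-Reasoning
      q = n / a
      q>0 : 0 < q
      q>0 = m≥n⇒m/n>0 a≤n
      arith : ∀ q a → (q + q) * a * a ≡ 2 * q * (a * a)
      arith = solve-∀
      arith′ : ∀ q t → 2 * q * (4 * t) ≡ 8 * (q * t)
      arith′ = solve-∀
      square : ∀ a → 1 < a → a * a ≤ 4 * triangle a
      square (suc zero)    (s≤s ())
      square (suc (suc o)) _ = begin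
        suc (suc o) * suc (suc o)             ≤⟨ *-monoʳ-≤ (suc (suc o)) (s≤s (s≤s (m≤n*m o 2))) ⟩
        suc (suc o) * suc (suc (2 * o))       ≡⟨ arith″ o ⟩
        2 * (suc (suc o) * suc o)             ≡⟨ cong (2 *_) (triangle-double (suc o)) ⟨
        2 * (2 * triangle (suc (suc o)))      ≡⟨ *-assoc 2 2 (triangle (suc (suc o))) ⟨
        4 * triangle (suc (suc o))            ∎
        where
        arith″ : ∀ o → suc (suc o) * suc (suc (2 * o)) ≡ 2 * (suc (suc o) * suc o)
        arith″ = solve-∀
      v : Vec ℕ n
      v = tabulate (reversal ∘ toℕ)
      v∈ : v ∈ permutations n
      v∈ = ∈-filter⁺ unique? (∈-tuples⁺ (All.tabulate⁺ (λ x → reversal< (toℕ<n x))))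
             (Unique.tabulate⁺ (toℕ-injective ∘ reversal-injective))
      s : State n
      s = state (lookup v) 0 0
      bd : Bounded n s
      bd x = subst (_≤ n) (sym (lookup∘tabulate _ x)) (<⇒≤ (reversal< (toℕ<n x)))
      array≡ : ∀ {i} → i < n → at n (lookup v) i ≡ reversal i
      array≡ i<n = trans (at-< i<n) (trans (lookup∘tabulate _ (fromℕ< i<n)) (cong reversal (toℕ-fromℕ< i<n)))
      exchanges≥ : q * triangle a ≤ W n (hs ++ 1 ∷ [])
      exchanges≥ with unchanged-prefix hs a≤ s bd array≡
      ... | bd′ , array≡′ = begin
        q * triangle a                                  ≤⟨ last-pass-blocks (foldl pass s hs) bd′ array≡′ q (m/n*n≤m n a) ⟩
        exchanges (processed n 1 0 (foldl pass s hs) (q * a))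
          ≤⟨ processed-exchanges n 1 0 (foldl pass s hs) (≤⇒≤′ (m/n*n≤m n a)) ⟩
        exchanges (pass (foldl pass s hs) 1)            ≡⟨ cong exchanges (foldl-++ pass s hs (1 ∷ [])) ⟨
        exchanges (shellsort (hs ++ 1 ∷ []) (lookup v)) ≤⟨ max-lower (λ v → exchanges (shellsort (hs ++ 1 ∷ []) (lookup v))) v∈ ⟩
        W n (hs ++ 1 ∷ [])                              ∎

open Sorting

module Generators where

  open import Data.Nat.Base
  open import Data.Nat.Properties
  open import Data.Nat.DivMod using (_/_; _%_; m≡m%n+[m/n]*n; m%n<n; m/n*n≤m)
  open import Data.Nat.Divisibility
  open import Data.Nat.GCD using (gcd; gcd[m,n]∣m; gcd[m,n]∣n)
  open import Data.Nat.Coprimality using (Coprime; coprime-divisor)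
  open import Data.Nat.Tactic.RingSolver using (solve-∀)
  open import Data.List.Base as List using (List; []; _∷_; _++_; upTo; downFrom; filter; length)
  open import Data.List.Properties using (length-++; length-map; length-upTo)
  open import Data.List.Membership.Propositional using (_∈_)
  open import Data.List.Membership.Propositional.Properties
    using (∈-filter⁻; ∈-map⁺; ∈-map⁻; ∈-∃++; ∈-++⁺ˡ; ∈-++⁺ʳ; ∈-++⁻)
  open import Data.List.Membership.DecPropositional _≟_ using (_∈?_)
  open import Data.List.Relation.Unary.Any using (here; there)
  open import Data.List.Relation.Unary.All as Allᴸ using ([]; _∷_) renaming (All to Allᴸ)
  open import Data.List.Relation.Unary.AllPairs using ([]; _∷_)
  open import Data.List.Relation.Unary.Unique.Propositional using () renaming (Unique to Uniqueᴸ)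
  import Data.List.Relation.Unary.Unique.Propositional.Properties as Uniqueᴸ
  open import Data.Vec.Base as Vec using (Vec; []; _∷_; foldr′)
  open import Data.Vec.Properties using (∷-injective)
  open import Data.Vec.Relation.Unary.All as All using (All; []; _∷_)
  open import Data.Vec.Relation.Unary.AllPairs as AllPairs using (AllPairs; []; _∷_)
  open import Data.Vec.Relation.Unary.Unique.Propositional using (Unique)
  open import Function.Bundles using (Equivalence)
  open import Relation.Unary using (Decidable)

  private variable
    n r : ℕ

  -- Number of gaps in a grid, and the cost bounds for grids.

  Unique-⊆-length : ∀ {A : Set} {xs ys : List A} → Uniqueᴸ xs → (∀ {x} → x ∈ xs → x ∈ ys) →
                    length xs ≤ length ys
  Unique-⊆-length {xs = []}     _            _  = z≤n
  Unique-⊆-length {xs = x ∷ xs} (x∉xs ∷ uxs) xs⊆ys with ∈-∃++ (xs⊆ys (here refl))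
  ... | as , bs , refl = begin
    suc (length xs)                ≤⟨ s≤s (Unique-⊆-length uxs xs⊆) ⟩
    suc (length (as ++ bs))        ≡⟨ cong suc (length-++ as) ⟩
    suc (length as + length bs)    ≡⟨ +-suc (length as) (length bs) ⟨
    length as + suc (length bs)    ≡⟨ length-++ as ⟨
    length (as ++ x ∷ bs)          ∎
    where
    open ≤-Reasoning
    xs⊆ : ∀ {y} → y ∈ xs → y ∈ as ++ bs
    xs⊆ y∈xs with ∈-++⁻ as (xs⊆ys (there y∈xs))
    ... | inj₁ y∈as         = ∈-++⁺ˡ y∈as
    ... | inj₂ (here refl)  = ⊥-elim (Allᴸ.lookup x∉xs y∈xs refl)
    ... | inj₂ (there y∈bs) = ∈-++⁺ʳ as y∈bs

  length-cartesianProductWith : ∀ {A B C : Set} (f : A → B → C) xs ys →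
    length (List.cartesianProductWith f xs ys) ≡ length xs * length ys
  length-cartesianProductWith f []       ys = refl
  length-cartesianProductWith f (x ∷ xs) ys = trans (length-++ (List.map (f x) ys))
    (cong₂ _+_ (length-map (f x) ys) (length-cartesianProductWith f xs ys))

  length-tuples : ∀ k m → length (tuples k m) ≡ m ^ k
  length-tuples zero    m = refl
  length-tuples (suc k) m = trans (length-cartesianProductWith _∷_ (upTo m) (tuples k m))
    (cong₂ _*_ (length-upTo m) (length-tuples k m))

  tuples-unique : ∀ k m → Uniqueᴸ (tuples k m)
  tuples-unique zero    m = [] ∷ []
  tuples-unique (suc k) m =
    Uniqueᴸ.cartesianProductWith⁺ _∷_ ∷-injective (Uniqueᴸ.upTo⁺ m) (tuples-unique k m)

  module _ {A : Vec ℕ r} (A≥2 : All (2 ≤_) A) where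

    monomial>0 : ∀ u → 0 < monomial A u
    monomial>0 = go A≥2
      where
      go : ∀ {r} {A : Vec ℕ r} → All (2 ≤_) A → ∀ u → 0 < monomial A u
      go []                 []       = z<s
      go {A = a ∷ as} (2≤a ∷ as≥2) (u ∷ us) =
        *-mono-≤ (m^n>0 a {{>-nonZero (<-trans z<s 2≤a)}} u) (go as≥2 us)

    grid⁺ : ∀ u → monomial A u < n → monomial A u ∈ grid A n
    grid⁺ u lt = Equivalence.from (∈-grid A≥2) (lt , u , refl)

    grid⁻ : ∀ {h} → h ∈ grid A n → h < n × ∃[ u ] h ≡ monomial A u
    grid⁻ = Equivalence.to (∈-grid A≥2)

    grid-unique : ∀ n → Uniqueᴸ (grid A n)
    grid-unique n = Uniqueᴸ.filter⁺ _ (Uniqueᴸ.downFrom⁺ n)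

    length-grid-≤ : ∀ m → (∀ u → monomial A u < n → All (_< m) u) → length (grid A n) ≤ m ^ r
    length-grid-≤ {n} m u<m = begin
      length (grid A n)                               ≤⟨ Unique-⊆-length (grid-unique n) sub ⟩
      length (List.map (monomial A) (tuples r m))     ≡⟨ length-map (monomial A) (tuples r m) ⟩
      length (tuples r m)                             ≡⟨ length-tuples r m ⟩
      m ^ r                                           ∎
      where
      open ≤-Reasoning
      sub : ∀ {h} → h ∈ grid A n → h ∈ List.map (monomial A) (tuples r m)
      sub h∈ with grid⁻ h∈
      ... | lt , u , refl = ∈-map⁺ (monomial A) (∈-tuples⁺ (u<m u lt))

    length-grid-≥ : (∀ u v → monomial A u ≡ monomial A v → u ≡ v) →
      ∀ m → (∀ u → All (_< m) u → monomial A u < n) → m ^ r ≤ length (grid A n)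
    length-grid-≥ {n} independent m small = begin
      m ^ r                                           ≡⟨ length-tuples r m ⟨
      length (tuples r m)                             ≡⟨ length-map (monomial A) (tuples r m) ⟨
      length (List.map (monomial A) (tuples r m))
        ≤⟨ Unique-⊆-length (Uniqueᴸ.map⁺ (independent _ _) (tuples-unique r m)) sub ⟩
      length (grid A n)                               ∎
      where
      open ≤-Reasoning
      sub : ∀ {h} → h ∈ List.map (monomial A) (tuples r m) → h ∈ grid A n
      sub h∈ with ∈-map⁻ (monomial A) h∈
      ... | u , u∈ , refl = grid⁺ u (small u (∈-tuples⁻ r m u∈))

  monomial≡1⊎≥ : ∀ {a} {A : Vec ℕ r} → 0 < a → All (a ≤_) A → ∀ u → monomial A u ≡ 1 ⊎ a ≤ monomial A u
  monomial≡1⊎≥ 0<a []                        []          = inj₁ refl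
  monomial≡1⊎≥ 0<a (_∷_ {x = b} a≤b a≤) (zero ∷ us) with monomial≡1⊎≥ 0<a a≤ us
  ... | inj₁ eq = inj₁ (trans (*-identityˡ _) eq)
  ... | inj₂ le = inj₂ (≤-trans le (≤-reflexive (sym (*-identityˡ _))))
  monomial≡1⊎≥ {a = a} {b ∷ bs} 0<a (a≤b ∷ a≤) (suc u ∷ us) = inj₂ (begin
    a                               ≤⟨ a≤b ⟩
    b                               ≡⟨ *-identityʳ b ⟨
    b * 1                           ≤⟨ *-monoʳ-≤ b (*-mono-≤ (m^n>0 b {{>-nonZero (<-≤-trans 0<a a≤b)}} u) positive) ⟩
    b * (b ^ u * monomial bs us)    ≡⟨ *-assoc b (b ^ u) _ ⟨
    b * b ^ u * monomial bs us      ∎)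
    where
    open ≤-Reasoning
    positive : 1 ≤ monomial bs us
    positive with monomial≡1⊎≥ 0<a a≤ us
    ... | inj₁ eq = ≤-reflexive (sym eq)
    ... | inj₂ le = ≤-trans 0<a le

  -- Brings a grid into the form that `W-lower` expects, with the gap 1 split off at the end.
  filter-downFrom-last : ∀ {P : ℕ → Set} (P? : Decidable P) a → P 1 → ¬ P 0 →
    (∀ {h} → P h → h ≢ 1 → a ≤ h) → ∀ m → 2 ≤ m →
    ∃[ hs ] filter P? (downFrom m) ≡ hs ++ 1 ∷ [] × Allᴸ (a ≤_) hs
  filter-downFrom-last P? a P1 ¬P0 P≥a (suc zero) (s≤s ())
  filter-downFrom-last P? a P1 ¬P0 P≥a (suc (suc zero)) _ with P? 1
  ... | no ¬P1 = ⊥-elim (¬P1 P1)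
  ... | yes _  with P? 0
  ...   | yes P0 = ⊥-elim (¬P0 P0)
  ...   | no  _  = [] , refl , []
  filter-downFrom-last P? a P1 ¬P0 P≥a (suc m@(suc (suc _))) _
    with filter-downFrom-last P? a P1 ¬P0 P≥a m (s≤s (s≤s z≤n)) | P? m
  ... | hs , eq , a≤ | no  _  = hs , eq , a≤
  ... | hs , eq , a≤ | yes Pm = m ∷ hs , cong (m ∷_) eq , P≥a Pm (λ ()) ∷ a≤

  monomial-zeros : ∀ (A : Vec ℕ r) → monomial A (Vec.replicate r 0) ≡ 1
  monomial-zeros []       = refl
  monomial-zeros (a ∷ as) = trans (*-identityˡ _) (monomial-zeros as)

  W-grid-lower : ∀ {a} {A : Vec ℕ r} → 1 < a → All (a ≤_) A → a ≤ n → n * a ≤ 8 * W n (grid A n)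
  W-grid-lower {r} {n} {a} {A} 1<a a≤ a≤n =
    subst (λ H → n * a ≤ 8 * W n H) (sym (proj₁ (proj₂ split)))
      (W-lower a {{>-nonZero (<⇒≤ 1<a)}} n (proj₁ split) (proj₂ (proj₂ split)) 1<a a≤n)
    where
    2≤n = ≤-trans 1<a a≤n
    A≥2 = All.map (≤-trans 1<a) a≤
    P : ℕ → Set
    P h = h ∈ List.map (monomial A) (tuples r n)
    P⁻ : ∀ {h} → P h → ∃[ u ] h ≡ monomial A u
    P⁻ Ph with ∈-map⁻ (monomial A) Ph
    ... | u , _ , eq = u , eq
    P1 : P 1
    P1 = proj₂ (∈-filter⁻ (_∈? List.map (monomial A) (tuples r n)) {xs = downFrom n}
           (subst (_∈ grid A n) (monomial-zeros A)
             (grid⁺ A≥2 (Vec.replicate r 0) (subst (_< n) (sym (monomial-zeros A)) 2≤n))))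
    ¬P0 : ¬ P 0
    ¬P0 P0 with P⁻ P0
    ... | u , eq = <⇒≢ (monomial>0 A≥2 u) eq
    P≥a : ∀ {h} → P h → h ≢ 1 → a ≤ h
    P≥a Ph h≢1 with P⁻ Ph
    ... | u , refl with monomial≡1⊎≥ (<⇒≤ 1<a) a≤ u
    ...   | inj₁ eq = ⊥-elim (h≢1 eq)
    ...   | inj₂ le = le
    split = filter-downFrom-last (_∈? List.map (monomial A) (tuples r n)) a P1 ¬P0 P≥a n 2≤n

  -- Raising one exponent multiplies a gap by a or b, so below n the grid is closed under both
  -- multiplications, as `C-upper` requires.
  C-grid-upper : ∀ {a b g} {as : Vec ℕ r} → let A = a ∷ b ∷ as in All (2 ≤_) A →
    (∀ t → g ≤ t → ∃[ u ] ∃[ v ] t ≡ u * a + v * b) →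
    C n (grid A n) ≤ length (grid A n) * (2 * n * suc g)
  C-grid-upper {r} {n} {a} {b} {g} {as} A≥2@(1<a ∷ 1<b ∷ _) =
    C-upper P? a b g n P>0 1<a 1<b P-*a P-*b
    where
    A = a ∷ b ∷ as
    P : ℕ → Set
    P h = h ∈ List.map (monomial A) (tuples (suc (suc r)) n)
    P? : Decidable P
    P? = _∈? List.map (monomial A) (tuples (suc (suc r)) n)
    P⁻ : ∀ {h} → P h → ∃[ u ] h ≡ monomial A u
    P⁻ Ph with ∈-map⁻ (monomial A) Ph
    ... | u , _ , eq = u , eq
    P⁺ : ∀ u → monomial A u < n → P (monomial A u)
    P⁺ u lt = proj₂ (∈-filter⁻ P? {xs = downFrom n} (grid⁺ A≥2 u lt))
    P>0 : ∀ {h} → P h → 0 < h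
    P>0 Ph with P⁻ Ph
    ... | u , refl = monomial>0 A≥2 u
    P-*a : ∀ {h} → P h → h * a < n → P (h * a)
    P-*a Ph lt with P⁻ Ph
    ... | u ∷ us , refl = subst P eq (P⁺ (suc u ∷ us) (subst (_< n) (sym eq) lt))
      where
      arith : ∀ a x y → a * x * y ≡ x * y * a
      arith = solve-∀
      eq : monomial A (suc u ∷ us) ≡ monomial A (u ∷ us) * a
      eq = arith a (a ^ u) (monomial (b ∷ as) us)
    P-*b : ∀ {h} → P h → h * b < n → P (h * b)
    P-*b Ph lt with P⁻ Ph
    ... | u ∷ v ∷ vs , refl = subst P eq (P⁺ (u ∷ suc v ∷ vs) (subst (_< n) (sym eq) lt))
      where
      arith : ∀ a b x y → a * (b * x * y) ≡ a * (x * y) * b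
      arith = solve-∀
      eq : monomial A (u ∷ suc v ∷ vs) ≡ monomial A (u ∷ v ∷ vs) * b
      eq = arith (a ^ u) b (b ^ v) (monomial as vs)

  -- Pairwise coprime generators.

  coprime-* : ∀ {a b c} → Coprime a b → Coprime a c → Coprime a (b * c)
  coprime-* {a} {b} {c} ab ac {d} (d∣a , d∣bc) = ac (d∣a , coprime-divisor
    (λ (e∣d , e∣b) → ab (∣-trans e∣d d∣a , e∣b)) d∣bc)

  coprime-^ : ∀ {a b} k → Coprime a b → Coprime a (b ^ k)
  coprime-^ zero    _  (_ , d∣1) = ∣1⇒≡1 d∣1
  coprime-^ (suc k) ab = coprime-* ab (coprime-^ k ab)

  coprime-monomial : ∀ {a} {A : Vec ℕ r} → All (Coprime a) A → ∀ u → Coprime a (monomial A u)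
  coprime-monomial []        []       (_ , d∣1) = ∣1⇒≡1 d∣1
  coprime-monomial (ab ∷ aA) (u ∷ us) = coprime-* (coprime-^ u ab) (coprime-monomial aA us)

  -- Uniqueness of the valuation at a, with coprimality in the role of primality: if the exponents
  -- differ, cancelling the common powers of a leaves a dividing M or N, which forces a = 1.
  valuation-unique : ∀ {a M N} → 2 ≤ a → Coprime a M → Coprime a N → ∀ u v →
                     a ^ u * M ≡ a ^ v * N → u ≡ v × M ≡ N
  valuation-unique {M = M} {N} 2≤a aM aN zero zero eq =
    refl , trans (sym (*-identityˡ M)) (trans eq (*-identityˡ N))
  valuation-unique {a} {M} {N} 2≤a aM aN zero (suc v) eq =
    ⊥-elim (<-irrefl (sym (aM (∣-refl , subst (a ∣_) (trans (sym eq) (*-identityˡ M))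
      (∣m⇒∣m*n N (m∣m*n (a ^ v)))))) 2≤a)
  valuation-unique {a} {M} {N} 2≤a aM aN (suc u) zero eq =
    ⊥-elim (<-irrefl (sym (aN (∣-refl , subst (a ∣_) (trans eq (*-identityˡ N))
      (∣m⇒∣m*n M (m∣m*n (a ^ u)))))) 2≤a)
  valuation-unique {a} {M} {N} 2≤a aM aN (suc u) (suc v) eq
    with valuation-unique 2≤a aM aN u v
           (*-cancelˡ-≡ _ _ a {{>-nonZero (<⇒≤ 2≤a)}}
             (trans (sym (*-assoc a (a ^ u) M)) (trans eq (*-assoc a (a ^ v) N))))
  ... | refl , M≡N = refl , M≡N

  coprime⇒independent : ∀ {A : Vec ℕ r} → All (2 ≤_) A → AllPairs Coprime A →
                        ∀ u v → monomial A u ≡ monomial A v → u ≡ v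
  coprime⇒independent []           []        []       []       _  = refl
  coprime⇒independent (2≤a ∷ A≥2) (aA ∷ cA) (u ∷ us) (v ∷ vs) eq
    with valuation-unique 2≤a (coprime-monomial aA us) (coprime-monomial aA vs) u v eq
  ... | refl , eq′ = cong (u ∷_) (coprime⇒independent A≥2 cA us vs eq′)

  -- As in Gödel's β function.
  gödel : ℕ → ℕ → (r : ℕ) → Vec ℕ r
  gödel T i zero    = []
  gödel T i (suc r) = suc (i * T) ∷ gödel T (suc i) r

  gödel-All : ∀ {P : ℕ → Set} T i r → (∀ j → i ≤ j → j < i + r → P (suc (j * T))) → All P (gödel T i r)
  gödel-All T i zero    _ = []
  gödel-All T i (suc r) p = p i ≤-refl (m<m+n i z<s) ∷
    gödel-All T (suc i) r (λ j i<j j< → p j (<⇒≤ i<j) (subst (j <_) (sym (+-suc i r)) j<))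

  -- A common divisor divides j (1 + i T) - i (1 + j T) = j - i, hence T, hence 1 = (1 + i T) - i T.
  gödel-coprime : ∀ {T i j} → i < j → j ∸ i ∣ T → Coprime (suc (i * T)) (suc (j * T))
  gödel-coprime {T} {i} {j} i<j k∣T {d} (d∣a , d∣b) = ∣1⇒≡1 (∣m+n∣m⇒∣n (subst (d ∣_) (+-comm 1 (i * T)) d∣a)
    (∣n⇒∣m*n i d∣T))
    where
    k = j ∸ i
    arith : ∀ i k T → i * suc ((k + i) * T) + k ≡ (k + i) * suc (i * T)
    arith = solve-∀
    d∣k : d ∣ k
    d∣k = ∣m+n∣m⇒∣n {d} {i * suc (j * T)}
      (subst (λ j′ → d ∣ i * suc (j′ * T) + k) (m∸n+n≡m (<⇒≤ i<j))
        (subst (d ∣_) (sym (arith i k T)) (∣n⇒∣m*n (k + i) d∣a)))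
      (∣n⇒∣m*n i d∣b)
    d∣T : d ∣ T
    d∣T = ∣-trans d∣k k∣T

  gödel-pairwise : ∀ T i r → (∀ k → 1 ≤ k → k < r → k ∣ T) → AllPairs Coprime (gödel T i r)
  gödel-pairwise T i zero    _   = []
  gödel-pairwise T i (suc r) k∣T =
    gödel-All T (suc i) r (λ j i<j j< → gödel-coprime {T} i<j
      (k∣T (j ∸ i) (m<n⇒0<n∸m i<j) (s≤s (subst (j ∸ i ≤_) (m+n∸m≡n i r) (∸-monoˡ-≤ i (s≤s⁻¹ j<))))))
    ∷ gödel-pairwise T (suc i) r (λ k 1≤k k<r → k∣T k 1≤k (m<n⇒m<1+n k<r))

  gödel-distinct : ∀ T i r → 0 < T → Unique (gödel T i r)
  gödel-distinct T i zero    _   = []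
  gödel-distinct T i (suc r) T>0 =
    gödel-All T (suc i) r (λ j i<j _ eq → <-irrefl eq (s≤s (*-monoˡ-< T {{>-nonZero T>0}} i<j)))
    ∷ gödel-distinct T (suc i) r T>0

  coprime-gcd : ∀ {a b} {as : Vec ℕ r} → Coprime a b → foldr′ gcd 0 (a ∷ b ∷ as) ≡ 1
  coprime-gcd {a = a} {b} {as} ab = ab
    ( gcd[m,n]∣m a (gcd b (foldr′ gcd 0 as))
    , ∣-trans (gcd[m,n]∣n a (gcd b (foldr′ gcd 0 as))) (gcd[m,n]∣m b (foldr′ gcd 0 as)) )

  -- Modulo 1 + T the second generator is −1.
  gödel-generated : ∀ T t → 2 * suc T * suc T ≤ t → ∃[ u ] ∃[ v ] t ≡ u * suc (1 * T) + v * suc (2 * T)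
  gödel-generated T t large = u , v , +-cancelʳ-≡ v t _ (begin
    t + v                                      ≡⟨ cong (_+ v) (m≡m%n+[m/n]*n t a) ⟩
    t % a + q * a + v                          ≡⟨ arith₁ (t % a) (q * a) v ⟩
    (t % a + v) + q * a                        ≡⟨ cong (_+ q * a) (m+[n∸m]≡n (<⇒≤ (m%n<n t a))) ⟩
    suc q * a                                  ≡⟨ cong (_* a) (m∸n+n≡m 2v≤) ⟨
    (u + 2 * v) * a                            ≡⟨ arith₂ u v T ⟩
    u * suc (1 * T) + v * suc (2 * T) + v      ∎)
    where
    open ≡-Reasoning
    a = suc T
    q = t / a
    -- Here a = 1 + T and 1 + 2 T = 2 a - 1. As t + v = (q + 1) a, this gives t = (q + 1 - 2 v) a +
    -- v (2 a - 1). The coefficient u is not truncated, because v ≤ a and t ≥ 2 a².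
    v = a ∸ t % a
    u = suc q ∸ 2 * v
    q≥ : 2 * a ≤ suc q
    q≥ = <⇒≤ (*-cancelʳ-< a (2 * a) (suc q) (≤-<-trans large
      (subst (_< suc q * a) (sym (m≡m%n+[m/n]*n t a)) (+-monoˡ-< (q * a) (m%n<n t a)))))
    2v≤ : 2 * v ≤ suc q
    2v≤ = ≤-trans (*-monoʳ-≤ 2 (m∸n≤m a (t % a))) q≥
    arith₁ : ∀ x y z → x + y + z ≡ (x + z) + y
    arith₁ = solve-∀
    arith₂ : ∀ u v T → (u + 2 * v) * suc T ≡ u * suc (1 * T) + v * suc (2 * T) + v
    arith₂ = solve-∀

  -- Integer logarithms and the exponents of products below n.

  open ≤-Reasoning

  -- A discrete intermediate value theorem; it supplies the binary logarithm and an integer root.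
  crossing : ∀ (f : ℕ → ℕ) {x} k → f 0 ≤ x → x < f k → ∃[ m ] f m ≤ x × x < f (suc m)
  crossing f     zero    f0≤x x<f0 = ⊥-elim (<-irrefl refl (<-≤-trans x<f0 f0≤x))
  crossing f {x} (suc k) f0≤x x<f with f k ≤? x
  ... | yes fk≤x = k , fk≤x , x<f
  ... | no  fk≰x = crossing f k f0≤x (≰⇒> fk≰x)

  n<2^n : ∀ n → n < 2 ^ n
  n<2^n zero    = z<s
  n<2^n (suc n) = +-mono-≤ (m^n>0 2 n) (≤-trans (n<2^n n) (≤-reflexive (sym (+-identityʳ _))))

  binary-log : ∀ n → 0 < n → ∃[ L ] 2 ^ L ≤ n × n < 2 ^ suc L
  binary-log n 0<n = crossing (2 ^_) n 0<n (n<2^n n)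

  ^-cancelʳ-< : ∀ a {m n} → 1 < a → a ^ m < a ^ n → m < n
  ^-cancelʳ-< a {m} {n} 1<a lt = ≰⇒> λ n≤m → <-irrefl refl (<-≤-trans lt
    (^-monoʳ-≤ a {{>-nonZero (<⇒≤ 1<a)}} n≤m))

  ^-distribʳ-* : ∀ n a b → (a * b) ^ n ≡ a ^ n * b ^ n
  ^-distribʳ-* zero    a b = refl
  ^-distribʳ-* (suc n) a b = trans (cong (a * b *_) (^-distribʳ-* n a b)) (arith a b (a ^ n) (b ^ n))
    where
    arith : ∀ a b c d → a * b * (c * d) ≡ a * c * (b * d)
    arith = solve-∀

  m≤m^n : ∀ m n .{{_ : NonZero m}} .{{_ : NonZero n}} → m ≤ m ^ n
  m≤m^n m n = ≤-trans (≤-reflexive (sym (*-identityʳ m))) (^-monoʳ-≤ m (>-nonZero⁻¹ n))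

  maximum-≤ : ∀ {y} {A : Vec ℕ r} → All (_≤ y) A → maximum A ≤ y
  maximum-≤ []         = z≤n
  maximum-≤ (a≤y ∷ A≤) = ⊔-lub a≤y (maximum-≤ A≤)

  ≤-maximum : ∀ (A : Vec ℕ r) → All (_≤ maximum A) A
  ≤-maximum []      = []
  ≤-maximum (a ∷ A) = m≤m⊔n a _ ∷ All.map (λ le → ≤-trans le (m≤n⊔m a _)) (≤-maximum A)

  module _ (y : ℕ) where

    ≤-meet : ∀ {x} {A : Vec ℕ r} → x ≤ y → All (x ≤_) A → x ≤ foldr′ _⊓_ y A
    ≤-meet x≤y []         = x≤y
    ≤-meet x≤y (x≤a ∷ x≤) = ⊓-glb x≤a (≤-meet x≤y x≤)

    meet-≤ : ∀ (A : Vec ℕ r) → All (foldr′ _⊓_ y A ≤_) A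
    meet-≤ []      = []
    meet-≤ (a ∷ A) = m⊓n≤m a _ ∷ All.map (≤-trans (m⊓n≤n a _)) (meet-≤ A)

  ≤-minimum : ∀ {x} {A : Vec ℕ (suc r)} → All (x ≤_) A → x ≤ minimum A
  ≤-minimum {A = a ∷ as} x≤@(x≤a ∷ _) = ≤-meet _ (≤-trans x≤a (m≤m⊔n a _)) x≤

  -- Each single factor obeys 2^(e u) ≤ a^u < 2^(L + 1), so e u ≤ L < e m. This bounds the grid of
  -- generators above 2^e by m^r.
  exponents< : ∀ {A : Vec ℕ r} {e L m} → All (2 ^ e ≤_) A → L < e * m →
               ∀ u → monomial A u < 2 ^ suc L → All (_< m) u
  exponents< []                          L<em []       _  = []
  exponents< {A = a ∷ as} {e} {L} {m} (2^e≤a ∷ 2^e≤) L<em (u ∷ us) lt =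
    *-cancelˡ-< e u m (≤-<-trans (s≤s⁻¹ (^-cancelʳ-< 2 ≤-refl (begin-strict
      2 ^ (e * u)               ≡⟨ ^-*-assoc 2 e u ⟨
      (2 ^ e) ^ u               ≤⟨ ^-monoˡ-≤ u 2^e≤a ⟩
      a ^ u                     ≤⟨ m≤m*n (a ^ u) (monomial as us) {{>-nonZero rest>0}} ⟩
      a ^ u * monomial as us    <⟨ lt ⟩
      2 ^ suc L                 ∎))) L<em)
    ∷ exponents< {e = e} {L} 2^e≤ L<em us (≤-<-trans (m≤n*m (monomial as us) (a ^ u) {{>-nonZero a^u>0}}) lt)
    where
    a^u>0 : 0 < a ^ u
    a^u>0 = m^n>0 a {{>-nonZero (≤-trans (m^n>0 2 e) 2^e≤a)}} u
    positive : ∀ {r} {A : Vec ℕ r} → All (2 ^ e ≤_) A → ∀ u → 0 < monomial A u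
    positive []                   []       = z<s
    positive {A = b ∷ bs} (b≥ ∷ bs≥) (v ∷ vs) =
      *-mono-≤ (m^n>0 b {{>-nonZero (≤-trans (m^n>0 2 e) b≥)}} v) (positive bs≥ vs)
    rest>0 : 0 < monomial as us
    rest>0 = positive 2^e≤ us

  -- Every factor satisfies a^u 2^G ≤ 2^(G (u + 1)) ≤ 2^(G m). The extra 2^(r G) replaces a
  -- subtraction m - 1 on the right and later provides a strict inequality.
  monomial-box : ∀ {A : Vec ℕ r} {G m} → All (_≤ 2 ^ G) A → ∀ u → All (_< m) u →
                 monomial A u * 2 ^ (r * G) ≤ 2 ^ (r * G * m)
  monomial-box []                    []       []         = ≤-refl
  monomial-box {suc r} {a ∷ as} {G} {m} (a≤ ∷ A≤) (u ∷ us) (u<m ∷ us<m) = begin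
    a ^ u * monomial as us * 2 ^ (G + r * G)         ≡⟨ cong (a ^ u * monomial as us *_) (^-distribˡ-+-* 2 G (r * G)) ⟩
    a ^ u * monomial as us * (2 ^ G * 2 ^ (r * G))   ≡⟨ arith (a ^ u) (monomial as us) (2 ^ G) (2 ^ (r * G)) ⟩
    2 ^ G * a ^ u * (monomial as us * 2 ^ (r * G))
      ≤⟨ *-mono-≤ (*-monoʳ-≤ (2 ^ G) (^-monoˡ-≤ u a≤)) (monomial-box A≤ us us<m) ⟩
    (2 ^ G) ^ suc u * 2 ^ (r * G * m)                ≡⟨ cong (_* 2 ^ (r * G * m)) (^-*-assoc 2 G (suc u)) ⟩
    2 ^ (G * suc u) * 2 ^ (r * G * m)
      ≤⟨ *-monoˡ-≤ (2 ^ (r * G * m)) (^-monoʳ-≤ 2 (*-monoʳ-≤ G u<m)) ⟩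
    2 ^ (G * m) * 2 ^ (r * G * m)                    ≡⟨ ^-distribˡ-+-* 2 (G * m) (r * G * m) ⟨
    2 ^ (G * m + r * G * m)                          ≡⟨ cong (2 ^_) (*-distribʳ-+ m G (r * G)) ⟨
    2 ^ ((G + r * G) * m)                            ∎
    where
    arith : ∀ w x y z → w * x * (y * z) ≡ y * w * (x * z)
    arith = solve-∀

  -- Cheap generators of size about 2^e.

  record Balanced (r d κ μ n p L : ℕ) : Set where
    field
      A           : Vec ℕ r
      range       : All (λ a → 2 ≤ a × a < n) A
      distinct    : Unique A
      independent : ∀ u v → monomial A u ≡ monomial A v → u ≡ v
      coprime     : foldr′ gcd 0 A ≡ 1
      -- The condition max A ≤ (min A)^((d + 1)/d) in natural numbers; any K > 1 is at least such a
      -- fraction.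
      comparable  : maximum A ^ d ≤ minimum A ^ suc d
      small       : length (grid A n) ≤ p
      -- The binary order of magnitude of the generators; `e-bound` says e = O(L^(1 - 1/r)).
      e           : ℕ
      e>0         : 0 < e
      e-bound     : e ^ r ≤ μ * L ^ pred r
      cost        : C n (grid A n) ≤ n * 2 ^ (κ * e)

  module _ (r′ D d : ℕ) where

    private
      rank = suc (suc r′)
      R = suc (rank * rank !)

    -- R is chosen so that 1 + rank · T ≤ R 2^e ≤ 2^(R + e). The summands of the threshold ensure m
    -- ≥ 2, R + e < L and R d ≤ e in `balanced`. The cost exponent collects rank for the number of
    -- gaps, 2 for T² and 2 R + 3 for constant factors.
    balancedCost balancedBound balancedThreshold : ℕ
    balancedCost      = rank + 2 * R + 5
    balancedBound     = 4 ^ rank * D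
    balancedThreshold = D * 2 ^ rank + (2 * R + 3) + R * d * (R * d)

    -- m is the integer part of (L / D)^(1 / rank), so m^rank ≤ p; e is the least integer with L < e
    -- m, so generators above 2^e have exponents below m and their grid has at most m^rank elements.
    balanced : ∀ {n p L} → 2 ^ L ≤ n → n < 2 ^ suc L → balancedThreshold ≤ L → L ≤ D * p →
               Balanced rank d balancedCost balancedBound n p L
    balanced {n} {p} {L} 2^L≤n n<2^1+L L-large L≤Dp = record
      { A           = A
      ; range       = gödel-All T 1 rank λ j 1≤j j<1+rank → gen≥2 j 1≤j , gen<n j (s≤s⁻¹ j<1+rank)
      ; distinct    = gödel-distinct T 1 rank T>0
      ; independent = coprime⇒independent A≥2 pairwise
      ; coprime     = coprime-gcd {as = gödel T 3 r′} (All.head (AllPairs.head pairwise))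
      ; comparable  = comparable
      ; small       = ≤-trans length≤ m^r≤p
      ; e           = e
      ; e>0         = z<s
      ; e-bound     = e-bound
      ; cost        = cost
      }
      where
      L₁ : D * 2 ^ rank ≤ L
      L₁ = ≤-trans (≤-trans (m≤m+n _ (2 * R + 3)) (m≤m+n _ _)) L-large
      L₂ : 2 * R + 3 ≤ L
      L₂ = ≤-trans (≤-trans (m≤n+m (2 * R + 3) (D * 2 ^ rank)) (m≤m+n _ _)) L-large
      L₃ : R * d * (R * d) ≤ L
      L₃ = ≤-trans (m≤n+m _ (D * 2 ^ rank + (2 * R + 3))) L-large
      L>0 : 0 < L
      L>0 = ≤-trans (≤-trans (s≤s z≤n) (m≤n+m 3 (2 * R))) L₂
      instance
        L≢0 : NonZero L
        L≢0 = >-nonZero L>0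
        D≢0 : NonZero D
        D≢0 = ≢-nonZero λ { refl → <-irrefl refl (<-≤-trans L>0 L≤Dp) }
      m-spec : ∃[ m ] m ^ rank * D ≤ L × L < suc m ^ rank * D
      m-spec = crossing (λ m → m ^ rank * D) (suc L) z≤n
        (≤-trans (m≤m^n (suc L) rank) (m≤m*n (suc L ^ rank) D))
      m = proj₁ m-spec
      m^rD≤L = proj₁ (proj₂ m-spec)
      L<[1+m]^rD = proj₂ (proj₂ m-spec)
      m≥2 : 2 ≤ m
      m≥2 = ≮⇒≥ λ m<2 → <-irrefl refl (<-≤-trans L<[1+m]^rD (begin
        suc m ^ rank * D    ≤⟨ *-monoˡ-≤ D (^-monoˡ-≤ rank m<2) ⟩
        2 ^ rank * D        ≡⟨ *-comm (2 ^ rank) D ⟩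
        D * 2 ^ rank        ≤⟨ L₁ ⟩
        L                ∎))
      instance
        m≢0 : NonZero m
        m≢0 = >-nonZero (<⇒≤ m≥2)
      m^r≤L : m ^ rank ≤ L
      m^r≤L = ≤-trans (m≤m*n (m ^ rank) D) m^rD≤L
      e = suc (L / m)
      L<em : L < e * m
      L<em = subst (_< e * m) (sym (m≡m%n+[m/n]*n L m)) (+-monoˡ-< (L / m * m) (m%n<n L m))
      em≤2L : e * m ≤ 2 * L
      em≤2L = begin
        m + L / m * m    ≤⟨ +-mono-≤ (≤-trans (m≤m^n m rank) m^r≤L) (m/n*n≤m L m) ⟩
        L + L            ≡⟨ cong (L +_) (+-identityʳ L) ⟨
        2 * L            ∎
      -- This step uses rank ≥ 2. It bounds the number of gaps, at most m^rank, by 2^(e rank).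
      m<e : m < e
      m<e = *-cancelʳ-< m m e (begin-strict
        m * m                    ≤⟨ *-monoʳ-≤ m (m≤m^n m (suc r′)) ⟩
        m ^ rank                    ≤⟨ m^r≤L ⟩
        L                        <⟨ L<em ⟩
        e * m                    ∎)
      Rd≤e : R * d ≤ e
      Rd≤e = ≮⇒≥ λ e<Rd → <-irrefl refl (begin-strict
        R * d * (R * d)    ≤⟨ L₃ ⟩
        L                  <⟨ L<em ⟩
        e * m              ≤⟨ *-mono-≤ (<⇒≤ e<Rd) (<⇒≤ (<-trans m<e e<Rd)) ⟩
        R * d * (R * d)    ∎)
      -- m ≥ 2 gives e ≤ 1 + L / 2, so for large L all generators stay below 2^L ≤ n.
      R+e<L : R + e < L
      R+e<L = *-cancelˡ-< 2 _ _ (begin-strict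
        2 * (R + suc (L / m))        ≡⟨ arith R (L / m) ⟩
        (2 * R + 2) + L / m * 2      <⟨ +-monoˡ-< _ (+-monoʳ-< (2 * R) (s≤s (s≤s (s≤s z≤n)))) ⟩
        (2 * R + 3) + L / m * 2      ≤⟨ +-mono-≤ L₂ (≤-trans (*-monoʳ-≤ (L / m) m≥2) (m/n*n≤m L m)) ⟩
        L + L                        ≡⟨ cong (L +_) (+-identityʳ L) ⟨
        2 * L                        ∎)
        where
        arith : ∀ R q → 2 * (R + suc q) ≡ (2 * R + 2) + q * 2
        arith = solve-∀
      -- Multiply by L < (m + 1)^rank D and use e (m + 1) ≤ 4 L; cancelling one L leaves L^(rank -
      -- 1).
      e-bound : e ^ rank ≤ 4 ^ rank * D * L ^ suc r′
      e-bound = *-cancelʳ-≤ _ _ L (begin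
        e ^ rank * L                          ≤⟨ *-monoʳ-≤ (e ^ rank) (<⇒≤ L<[1+m]^rD) ⟩
        e ^ rank * (suc m ^ rank * D)            ≤⟨ *-monoʳ-≤ (e ^ rank) (*-monoˡ-≤ D (^-monoˡ-≤ rank 1+m≤2m)) ⟩
        e ^ rank * ((2 * m) ^ rank * D)          ≡⟨ *-assoc (e ^ rank) _ D ⟨
        e ^ rank * (2 * m) ^ rank * D            ≡⟨ cong (_* D) (^-distribʳ-* rank e (2 * m)) ⟨
        (e * (2 * m)) ^ rank * D              ≤⟨ *-monoˡ-≤ D (^-monoˡ-≤ rank e2m≤4L) ⟩
        (4 * L) ^ rank * D                    ≡⟨ cong (_* D) (^-distribʳ-* rank 4 L) ⟩
        4 ^ rank * (L * L ^ suc r′) * D       ≡⟨ arith (4 ^ rank) L (L ^ suc r′) D ⟩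
        4 ^ rank * D * L ^ suc r′ * L         ∎)
        where
        arith : ∀ x y z w → x * (y * z) * w ≡ x * w * z * y
        arith = solve-∀
        1+m≤2m : suc m ≤ 2 * m
        1+m≤2m = +-mono-≤ (<⇒≤ m≥2) (≤-reflexive (sym (+-identityʳ m)))
        e2m≤4L : e * (2 * m) ≤ 4 * L
        e2m≤4L = begin
          e * (2 * m)      ≡⟨ *-comm e (2 * m) ⟩
          2 * m * e        ≡⟨ *-assoc 2 m e ⟩
          2 * (m * e)      ≡⟨ cong (2 *_) (*-comm m e) ⟩
          2 * (e * m)      ≤⟨ *-monoʳ-≤ 2 em≤2L ⟩
          2 * (2 * L)      ≡⟨ *-assoc 2 2 L ⟨
          4 * L            ∎
      instance
        r!≢0 : NonZero (rank !)
        r!≢0 = rank !≢0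
        2^e≢0 : NonZero (2 ^ e)
        2^e≢0 = m^n≢0 2 e
      T = rank ! * 2 ^ e
      T>0 : 0 < T
      T>0 = *-mono-≤ (>-nonZero⁻¹ (rank !)) (m^n>0 2 e)
      A = gödel T 1 rank
      2^e≤gen : ∀ j → 1 ≤ j → 2 ^ e ≤ suc (j * T)
      2^e≤gen j 1≤j = begin
        2 ^ e          ≤⟨ m≤n*m (2 ^ e) (rank !) ⟩
        T              ≤⟨ m≤n*m T j {{>-nonZero 1≤j}} ⟩
        j * T          ≤⟨ n≤1+n _ ⟩
        suc (j * T)    ∎
      gen≥2 : ∀ j → 1 ≤ j → 2 ≤ suc (j * T)
      gen≥2 j 1≤j = s≤s (*-mono-≤ 1≤j T>0)
      gen≤ : ∀ j → j ≤ rank → suc (j * T) ≤ 2 ^ (R + e)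
      gen≤ j j≤rank = begin
        suc (j * T)                    ≤⟨ +-mono-≤ (m^n>0 2 e) (*-monoˡ-≤ T j≤rank) ⟩
        2 ^ e + rank * (rank ! * 2 ^ e)      ≡⟨ cong (2 ^ e +_) (*-assoc rank (rank !) (2 ^ e)) ⟨
        R * 2 ^ e                      ≤⟨ *-monoˡ-≤ (2 ^ e) (<⇒≤ (n<2^n R)) ⟩
        2 ^ R * 2 ^ e                  ≡⟨ ^-distribˡ-+-* 2 R e ⟨
        2 ^ (R + e)                    ∎
      gen<n : ∀ j → j ≤ rank → suc (j * T) < n
      gen<n j j≤rank = ≤-<-trans (gen≤ j j≤rank) (<-≤-trans (^-monoʳ-< 2 ≤-refl R+e<L) 2^L≤n)
      2^e≤A : All (2 ^ e ≤_) A
      2^e≤A = gödel-All T 1 rank λ j 1≤j _ → 2^e≤gen j 1≤j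
      A≥2 : All (2 ≤_) A
      A≥2 = gödel-All T 1 rank λ j 1≤j _ → gen≥2 j 1≤j
      -- Differences of indices are smaller than rank, hence divide rank ! and so T.
      pairwise = gödel-pairwise T 1 rank λ { k@(suc k′) 1≤k k<rank →
        ∣m⇒∣m*n (2 ^ e) (∣-trans (m∣m*n (k′ !)) (m≤n⇒m!∣n! (<⇒≤ k<rank))) }
      -- max A and min A differ at most by the factor 2^R in the bounds 2^(R + e) and 2^e, and R d ≤
      -- e makes room for it.
      comparable : maximum A ^ d ≤ minimum A ^ suc d
      comparable = begin
        maximum A ^ d            ≤⟨ ^-monoˡ-≤ d (maximum-≤ (gödel-All T 1 rank λ j _ j<1+rank → gen≤ j (s≤s⁻¹ j<1+rank))) ⟩
        (2 ^ (R + e)) ^ d        ≡⟨ ^-*-assoc 2 (R + e) d ⟩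
        2 ^ ((R + e) * d)        ≤⟨ ^-monoʳ-≤ 2 (begin
          (R + e) * d    ≡⟨ *-distribʳ-+ d R e ⟩
          R * d + e * d  ≤⟨ +-monoˡ-≤ (e * d) Rd≤e ⟩
          e + e * d      ≡⟨ *-suc e d ⟨
          e * suc d      ∎) ⟩
        2 ^ (e * suc d)          ≡⟨ ^-*-assoc 2 e (suc d) ⟨
        (2 ^ e) ^ suc d          ≤⟨ ^-monoˡ-≤ (suc d) (≤-minimum 2^e≤A) ⟩
        minimum A ^ suc d        ∎
      length≤ : length (grid A n) ≤ m ^ rank
      length≤ = length-grid-≤ A≥2 m λ u lt → exponents< {e = e} {L} 2^e≤A L<em u (<-trans lt n<2^1+L)
      m^r≤p : m ^ rank ≤ p
      m^r≤p = *-cancelʳ-≤ (m ^ rank) p D (≤-trans m^rD≤L (≤-trans L≤Dp (≤-reflexive (*-comm D p))))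
      g = 2 * suc T * suc T
      1+T≤ : suc T ≤ 2 ^ (R + e)
      1+T≤ = subst (λ t → suc t ≤ 2 ^ (R + e)) (*-identityˡ T) (gen≤ 1 (s≤s z≤n))
      cost : C n (grid A n) ≤ n * 2 ^ (balancedCost * e)
      cost = begin
        C n (grid A n)                                 ≤⟨ C-grid-upper {n = n} A≥2 (gödel-generated T) ⟩
        length (grid A n) * (2 * n * suc g)            ≤⟨ *-mono-≤ length≤2^ (*-monoʳ-≤ (2 * n) 1+g≤) ⟩
        2 ^ (e * rank) * (2 * n * 2 ^ (2 + 2 * (R + e)))  ≡⟨ arith (2 ^ (e * rank)) n (2 ^ (2 + 2 * (R + e))) ⟩
        n * (2 ^ (e * rank) * 2 ^ (3 + 2 * (R + e)))      ≡⟨ cong (n *_) (^-distribˡ-+-* 2 (e * rank) (3 + 2 * (R + e))) ⟨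
        n * 2 ^ (e * rank + (3 + 2 * (R + e)))            ≤⟨ *-monoʳ-≤ n (^-monoʳ-≤ 2 exponent≤) ⟩
        n * 2 ^ (balancedCost * e)                     ∎
        where
        arith : ∀ x n y → x * (2 * n * y) ≡ n * (x * (2 * y))
        arith = solve-∀
        length≤2^ : length (grid A n) ≤ 2 ^ (e * rank)
        length≤2^ = begin
          length (grid A n)    ≤⟨ length≤ ⟩
          m ^ rank                ≤⟨ ^-monoˡ-≤ rank (<⇒≤ (<-trans m<e (n<2^n e))) ⟩
          (2 ^ e) ^ rank          ≡⟨ ^-*-assoc 2 e rank ⟩
          2 ^ (e * rank)          ∎
        arith₃ : ∀ x → 2 * (x * x) + 2 * x * x ≡ 4 * (x * x)
        arith₃ = solve-∀
        1+g≤ : suc g ≤ 2 ^ (2 + 2 * (R + e))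
        1+g≤ = begin
          1 + 2 * suc T * suc T                      ≤⟨ +-monoˡ-≤ (2 * suc T * suc T) {1} {2 * (suc T * suc T)} (s≤s z≤n) ⟩
          2 * (suc T * suc T) + 2 * suc T * suc T    ≡⟨ arith₃ (suc T) ⟩
          4 * (suc T * suc T)                  ≤⟨ *-monoʳ-≤ 4 (*-mono-≤ 1+T≤ 1+T≤) ⟩
          4 * (2 ^ (R + e) * 2 ^ (R + e))      ≡⟨ cong (4 *_) (^-distribˡ-+-* 2 (R + e) (R + e)) ⟨
          4 * 2 ^ (R + e + (R + e))            ≡⟨ cong (λ x → 4 * 2 ^ (R + e + x)) (+-identityʳ (R + e)) ⟨
          4 * 2 ^ (2 * (R + e))                ≡⟨ ^-distribˡ-+-* 2 2 (2 * (R + e)) ⟨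
          2 ^ (2 + 2 * (R + e))                ∎
        exponent≤ : e * rank + (3 + 2 * (R + e)) ≤ balancedCost * e
        exponent≤ = begin
          e * rank + (3 + 2 * (R + e))          ≡⟨ arith₁ e rank R ⟩
          (2 * R + 3) * 1 + (rank + 2) * e      ≤⟨ +-monoˡ-≤ ((rank + 2) * e) (*-monoʳ-≤ (2 * R + 3) (s≤s (z≤n {L / m}))) ⟩
          (2 * R + 3) * e + (rank + 2) * e      ≡⟨ arith₂ e rank R ⟩
          balancedCost * e                   ∎
          where
          arith₁ : ∀ e k R → e * k + (3 + 2 * (R + e)) ≡ (2 * R + 3) * 1 + (k + 2) * e
          arith₁ = solve-∀
          arith₂ : ∀ e k R → (2 * R + 3) * e + (k + 2) * e ≡ (k + 2 * R + 5) * e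
          arith₂ = solve-∀

  -- Generators of a small grid are large.

  module _ (r′ D k : ℕ) where

    private
      rank = suc r′

    -- The factors 2^rank D, rank^rank and k^rank stem from the number of products, from the box of
    -- exponents and from the comparison of max A with min A.
    spreadBound : ℕ
    spreadBound = (2 * (rank * k)) ^ rank * D

    -- All products of exponents below L / (rank · log₂ max A) lie in the grid;
    -- as these are at most D L, the generators cannot be small.
    spread : ∀ {n p L} {A : Vec ℕ rank} → 0 < D → 0 < L → 2 ^ L ≤ n →
      All (λ a → 2 ≤ a × a < n) A → (∀ u v → monomial A u ≡ monomial A v → u ≡ v) →
      maximum A ≤ minimum A ^ k → length (grid A n) ≤ p → p ≤ D * L →
      ∃[ f ] L ^ r′ ≤ spreadBound * suc f ^ rank × n * 2 ^ f ≤ 8 * W n (grid A n)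
    spread {n} {p} {L} {A@(_ ∷ _)} 0<D 0<L 2^L≤n range independent max≤min^k length≤p p≤DL =
      f , bound , (begin
        n * 2 ^ f           ≤⟨ *-monoʳ-≤ n 2^f≤min ⟩
        n * minimum A       ≤⟨ W-grid-lower min≥2 min≤A min≤n ⟩
        8 * W n (grid A n)  ∎)
      where
      A≥2 : All (2 ≤_) A
      A≥2 = All.map proj₁ range
      min≥2 : 2 ≤ minimum A
      min≥2 = ≤-minimum A≥2
      min≤A : All (minimum A ≤_) A
      min≤A = meet-≤ (maximum A) A
      min≤n : minimum A ≤ n
      min≤n = ≤-trans (All.head min≤A) (<⇒≤ (proj₂ (All.head range)))
      max≥1 : 1 ≤ maximum A
      max≥1 = ≤-trans (<⇒≤ (All.head A≥2)) (All.head (≤-maximum A))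
      g-spec = binary-log (maximum A) max≥1
      g = proj₁ g-spec
      f-spec = binary-log (minimum A) (<⇒≤ min≥2)
      f = proj₁ f-spec
      2^f≤min = proj₁ (proj₂ f-spec)
      -- In binary logarithms max A ≤ (min A)^k becomes g < k (f + 1), which carries a lower bound
      -- from the largest generator to the smallest; k = 0 would force max A ≤ 1.
      g<k[1+f] : suc g ≤ k * suc f
      g<k[1+f] = subst (suc g ≤_) (*-comm (suc f) k) (case-k k max≤min^k)
        where
        case-k : ∀ k → maximum A ≤ minimum A ^ k → suc g ≤ suc f * k
        case-k zero    max≤1 = ⊥-elim (<-irrefl refl
          (<-≤-trans (≤-trans (All.head A≥2) (All.head (≤-maximum A))) max≤1))
        case-k (suc k) max≤ = ^-cancelʳ-< 2 ≤-refl (begin-strict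
          2 ^ g                        ≤⟨ proj₁ (proj₂ g-spec) ⟩
          maximum A                    ≤⟨ max≤ ⟩
          minimum A ^ suc k            <⟨ ^-monoˡ-< (suc k) (proj₂ (proj₂ f-spec)) ⟩
          (2 ^ suc f) ^ suc k          ≡⟨ ^-*-assoc 2 (suc f) (suc k) ⟩
          2 ^ (suc f * suc k)          ∎)
      G = suc g
      m = L / (rank * G)
      A≤2^G : All (_≤ 2 ^ G) A
      A≤2^G = All.map (λ a≤ → ≤-trans a≤ (<⇒≤ (proj₂ (proj₂ g-spec)))) (≤-maximum A)
      box : ∀ u → All (_< m) u → monomial A u < n
      box u u<m = begin-strict
        monomial A u                       <⟨ m<m*n (monomial A u) (2 ^ (rank * G)) {{>-nonZero (monomial>0 A≥2 u)}} (^-monoʳ-< 2 ≤-refl {0} {rank * G} z<s) ⟩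
        monomial A u * 2 ^ (rank * G)      ≤⟨ monomial-box {G = G} A≤2^G u u<m ⟩
        2 ^ (rank * G * m)                 ≤⟨ ^-monoʳ-≤ 2 (≤-trans (≤-reflexive (*-comm (rank * G) m)) (m/n*n≤m L (rank * G))) ⟩
        2 ^ L                              ≤⟨ 2^L≤n ⟩
        n                                  ∎
      m^r≤DL : m ^ rank ≤ D * L
      m^r≤DL = ≤-trans (length-grid-≥ A≥2 independent m box) (≤-trans length≤p p≤DL)
      [1+m]^r≤ : suc m ^ rank ≤ 2 ^ rank * (D * L)
      [1+m]^r≤ = by-m m m^r≤DL
        where
        by-m : ∀ m → m ^ rank ≤ D * L → suc m ^ rank ≤ 2 ^ rank * (D * L)
        -- If m = 0 the count of products gives no information, and 1 ≤ 2^rank D L is used instead.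
        by-m zero    _  = ≤-trans (≤-reflexive (^-zeroˡ rank)) (*-mono-≤ (m^n>0 2 rank) (*-mono-≤ 0<D 0<L))
        by-m (suc m) le = begin
          suc (suc m) ^ rank           ≤⟨ ^-monoˡ-≤ rank (+-mono-≤ (s≤s (z≤n {m})) (≤-reflexive (sym (+-identityʳ (suc m))))) ⟩
          (2 * suc m) ^ rank           ≡⟨ ^-distribʳ-* rank 2 (suc m) ⟩
          2 ^ rank * suc m ^ rank      ≤⟨ *-monoʳ-≤ (2 ^ rank) le ⟩
          2 ^ rank * (D * L)           ∎
      -- Raise L < (m + 1) · rank · G to the power rank and insert the bounds for (m + 1)^rank and
      -- G. One factor L cancels, which leaves L^(rank - 1) on the left.
      bound : L ^ r′ ≤ spreadBound * suc f ^ rank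
      bound = *-cancelˡ-≤ L {{>-nonZero 0<L}} (begin
        L ^ rank                                     ≤⟨ ^-monoˡ-≤ rank L≤ ⟩
        (suc m * (rank * G)) ^ rank                  ≡⟨ ^-distribʳ-* rank (suc m) (rank * G) ⟩
        suc m ^ rank * (rank * G) ^ rank             ≤⟨ *-mono-≤ [1+m]^r≤ (^-monoˡ-≤ rank (*-monoʳ-≤ rank g<k[1+f])) ⟩
        2 ^ rank * (D * L) * (rank * (k * suc f)) ^ rank
          ≡⟨ cong (λ x → 2 ^ rank * (D * L) * x ^ rank) (*-assoc rank k (suc f)) ⟨
        2 ^ rank * (D * L) * (rank * k * suc f) ^ rank
          ≡⟨ cong (2 ^ rank * (D * L) *_) (^-distribʳ-* rank (rank * k) (suc f)) ⟩
        2 ^ rank * (D * L) * ((rank * k) ^ rank * suc f ^ rank)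
          ≡⟨ arith (2 ^ rank) D L ((rank * k) ^ rank) (suc f ^ rank) ⟩
        L * (2 ^ rank * (rank * k) ^ rank * D * suc f ^ rank)
          ≡⟨ cong (λ x → L * (x * D * suc f ^ rank)) (^-distribʳ-* rank 2 (rank * k)) ⟨
        L * (spreadBound * suc f ^ rank)             ∎)
        where
        arith : ∀ x D L y z → x * (D * L) * (y * z) ≡ L * (x * y * D * z)
        arith = solve-∀
        L≤ : L ≤ suc m * (rank * G)
        L≤ = <⇒≤ (subst (_< suc m * (rank * G)) (sym (m≡m%n+[m/n]*n L (rank * G)))
          (+-monoˡ-< (m * (rank * G)) (m%n<n L (rank * G))))

open Generators

module Cuts where

  open import Data.Nat.Base as ℕ using (ℕ; zero; suc; NonZero; _!)
  import Data.Nat.Properties as ℕₚ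
  open import Data.Nat.Properties using (_!≢0; m^n≢0; m*n≢0)
  open import Data.Nat.Tactic.RingSolver using (solve-∀)
  open import Data.Integer.Base as ℤ using (+_; -[1+_])
  import Data.Integer.Properties as ℤₚ
  open import Data.Integer.Tactic.RingSolver using () renaming (solve-∀ to ℤsolve-∀)
  open import Data.Rational.Base as ℚ
    using (ℚ; mkℚ; 0ℚ; 1ℚ; _/_; _+_; _*_; _-_; _≤_; _<_; nonNegative; positive; toℚᵘ)
  import Data.Rational.Properties as ℚₚ
  import Data.Rational.Unnormalised.Base as ℚᵘ
  import Data.Rational.Unnormalised.Properties as ℚᵘₚ

  -- Arithmetic of fractions and rational powers.

  module _ (i j d e : ℕ) .{{_ : NonZero d}} .{{_ : NonZero e}} where

    private
      toℚᵘ-/ : ∀ i d .{{_ : NonZero d}} → toℚᵘ (+ i / d) ℚᵘ.≃ (+ i ℚᵘ./ d)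
      toℚᵘ-/ i d@(suc _) = ℚₚ.toℚᵘ-fromℚᵘ (+ i ℚᵘ./ d)

      /-≤ᵘ : (+ i ℚᵘ./ d) ℚᵘ.≤ (+ j ℚᵘ./ e) → + i / d ≤ + j / e
      /-≤ᵘ le = ℚₚ.toℚᵘ-cancel-≤ (ℚᵘₚ.≤-respˡ-≃ (ℚᵘₚ.≃-sym (toℚᵘ-/ i d))
                  (ℚᵘₚ.≤-respʳ-≃ (ℚᵘₚ.≃-sym (toℚᵘ-/ j e)) le))

      /-≤ᵘ⁻ : + i / d ≤ + j / e → (+ i ℚᵘ./ d) ℚᵘ.≤ (+ j ℚᵘ./ e)
      /-≤ᵘ⁻ le = ℚᵘₚ.≤-respˡ-≃ (toℚᵘ-/ i d) (ℚᵘₚ.≤-respʳ-≃ (toℚᵘ-/ j e) (ℚₚ.toℚᵘ-mono-≤ le))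

    /-≤ : i ℕ.* e ℕ.≤ j ℕ.* d → + i / d ≤ + j / e
    /-≤ le = /-≤ᵘ (core d e le)
      where
      core : ∀ d e .{{_ : NonZero d}} .{{_ : NonZero e}} → i ℕ.* e ℕ.≤ j ℕ.* d → (+ i ℚᵘ./ d) ℚᵘ.≤ (+ j ℚᵘ./ e)
      core d@(suc _) e@(suc _) le = ℚᵘ.*≤* (subst₂ ℤ._≤_ (ℤₚ.pos-* i e) (ℤₚ.pos-* j d) (ℤ.+≤+ le))

    /-≤⁻ : + i / d ≤ + j / e → i ℕ.* e ℕ.≤ j ℕ.* d
    /-≤⁻ le = core d e (/-≤ᵘ⁻ le)
      where
      core : ∀ d e .{{_ : NonZero d}} .{{_ : NonZero e}} → (+ i ℚᵘ./ d) ℚᵘ.≤ (+ j ℚᵘ./ e) → i ℕ.* e ℕ.≤ j ℕ.* d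
      core d@(suc _) e@(suc _) le = ℤₚ.drop‿+≤+
        (subst₂ ℤ._≤_ (sym (ℤₚ.pos-* i e)) (sym (ℤₚ.pos-* j d)) (ℚᵘₚ.drop-*≤* le))

    /-* : .{{_ : NonZero (d ℕ.* e)}} → (+ i / d) * (+ j / e) ≡ + (i ℕ.* j) / (d ℕ.* e)
    /-* = ℚₚ.toℚᵘ-injective (ℚᵘₚ.≃-trans (ℚₚ.toℚᵘ-homo-* (+ i / d) (+ j / e))
      (ℚᵘₚ.≃-trans (ℚᵘₚ.*-cong (toℚᵘ-/ i d) (toℚᵘ-/ j e))
        (ℚᵘₚ.≃-trans (core d e) (ℚᵘₚ.≃-sym (toℚᵘ-/ (i ℕ.* j) (d ℕ.* e))))))
      where
      core : ∀ d e .{{_ : NonZero d}} .{{_ : NonZero e}} .{{_ : NonZero (d ℕ.* e)}} →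
             (+ i ℚᵘ./ d) ℚᵘ.* (+ j ℚᵘ./ e) ℚᵘ.≃ (+ (i ℕ.* j) ℚᵘ./ (d ℕ.* e))
      core d@(suc _) e@(suc _) = ℚᵘₚ.≃-reflexive (cong (ℚᵘ._/ (d ℕ.* e)) (sym (ℤₚ.pos-* i j)))

  /-≡ : ∀ i j d e .{{_ : NonZero d}} .{{_ : NonZero e}} → i ℕ.* e ≡ j ℕ.* d → + i / d ≡ + j / e
  /-≡ i j d e eq = ℚₚ.≤-antisym (/-≤ i j d e (ℕₚ.≤-reflexive eq)) (/-≤ j i e d (ℕₚ.≤-reflexive (sym eq)))

  0≤/ : ∀ i d .{{_ : NonZero d}} → 0ℚ ≤ + i / d
  0≤/ i d = /-≤ 0 i 1 d ℕ.z≤n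

  /-^ : ∀ i d k .{{_ : NonZero d}} → (+ i / d) ^ℚ k ≡ _/_ (+ (i ℕ.^ k)) (d ℕ.^ k) {{m^n≢0 d k}}
  /-^ i d zero    = refl
  /-^ i d (suc k) = trans (cong ((+ i / d) *_) (/-^ i d k)) (/-* i (i ℕ.^ k) d (d ℕ.^ k))
    where
    instance
      d^k≢0 : NonZero (d ℕ.^ k)
      d^k≢0 = m^n≢0 d k
      d^1+k≢0 : NonZero (d ℕ.* d ℕ.^ k)
      d^1+k≢0 = m^n≢0 d (suc k)

  ι : ℕ → ℚ
  ι m = + m / 1

  ι-mono : ∀ {m n} → m ℕ.≤ n → ι m ≤ ι n
  ι-mono {m} {n} le = /-≤ m n 1 1 (ℕₚ.*-monoˡ-≤ 1 le)

  ι-cancel : ∀ {m n} → ι m ≤ ι n → m ℕ.≤ n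
  ι-cancel {m} {n} le = ℕₚ.*-cancelʳ-≤ m n 1 (/-≤⁻ m n 1 1 le)

  ι-^ : ∀ m k → ι m ^ℚ k ≡ ι (m ℕ.^ k)
  ι-^ m k = trans (/-^ m 1 k) (/-≡ (m ℕ.^ k) (m ℕ.^ k) (1 ℕ.^ k) 1 {{m^n≢0 1 k}}
    (cong (m ℕ.^ k ℕ.*_) (sym (ℕₚ.^-zeroˡ k))))

  0≤* : ∀ {p q} → 0ℚ ≤ p → 0ℚ ≤ q → 0ℚ ≤ p * q
  0≤* {p} {q} 0≤p 0≤q = ℚₚ.nonNegative⁻¹ (p * q)
    {{ℚₚ.nonNeg*nonNeg⇒nonNeg p {{nonNegative 0≤p}} q {{nonNegative 0≤q}}}}

  *-mono : ∀ {p q u v} → 0ℚ ≤ p → 0ℚ ≤ v → p ≤ q → u ≤ v → p * u ≤ q * v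
  *-mono {p} {v = v} 0≤p 0≤v p≤q u≤v = ℚₚ.≤-trans
    (ℚₚ.*-monoˡ-≤-nonNeg p {{nonNegative 0≤p}} u≤v)
    (ℚₚ.*-monoʳ-≤-nonNeg v {{nonNegative 0≤v}} p≤q)

  0≤1 : 0ℚ ≤ 1ℚ
  0≤1 = ℚₚ.nonNegative⁻¹ 1ℚ

  0≤^ : ∀ {q} k → 0ℚ ≤ q → 0ℚ ≤ q ^ℚ k
  0≤^ zero    _   = 0≤1
  0≤^ (suc k) 0≤q = 0≤* 0≤q (0≤^ k 0≤q)

  ^-mono : ∀ {p q} k → 0ℚ ≤ p → p ≤ q → p ^ℚ k ≤ q ^ℚ k
  ^-mono zero    _   _   = ℚₚ.≤-refl
  ^-mono (suc k) 0≤p p≤q = *-mono 0≤p (0≤^ k (ℚₚ.≤-trans 0≤p p≤q)) p≤q (^-mono k 0≤p p≤q)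

  ^-strictMono : ∀ {p q} k → 0ℚ ≤ p → p < q → p ^ℚ suc k < q ^ℚ suc k
  ^-strictMono {p} {q} k 0≤p p<q = ℚₚ.≤-<-trans
    (*-mono 0≤p (0≤^ k (ℚₚ.≤-trans 0≤p (ℚₚ.<⇒≤ p<q))) ℚₚ.≤-refl (^-mono k 0≤p (ℚₚ.<⇒≤ p<q)))
    (ℚₚ.*-monoˡ-<-pos (q ^ℚ k) {{positive (0<^ k)}} p<q)
    where
    0<^ : ∀ k → 0ℚ < q ^ℚ k
    0<^ zero    = ℚₚ.positive⁻¹ 1ℚ
    0<^ (suc k) = ℚₚ.positive⁻¹ (q * q ^ℚ k)
      {{ℚₚ.pos*pos⇒pos q {{positive (ℚₚ.≤-<-trans 0≤p p<q)}} (q ^ℚ k) {{positive (0<^ k)}}}}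

  ^-cancel : ∀ {p q} k → 0ℚ ≤ q → p ^ℚ suc k ≤ q ^ℚ suc k → p ≤ q
  ^-cancel {p} {q} k 0≤q le with p ℚₚ.≤? q
  ... | yes p≤q = p≤q
  ... | no  p≰q = ⊥-elim (ℚₚ.<-irrefl refl (ℚₚ.<-≤-trans (^-strictMono k 0≤q (ℚₚ.≰⇒> p≰q)) le))

  1≤^ : ∀ {q} k → 1ℚ ≤ q → 1ℚ ≤ q ^ℚ k
  1≤^ zero    _   = ℚₚ.≤-refl
  1≤^ (suc k) 1≤q = *-mono {1ℚ} {_} {1ℚ} 0≤1 (0≤^ k (ℚₚ.≤-trans 0≤1 1≤q)) 1≤q (1≤^ k 1≤q)

  ^-+ : ∀ q j k → q ^ℚ (j ℕ.+ k) ≡ q ^ℚ j * q ^ℚ k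
  ^-+ q zero    k = sym (ℚₚ.*-identityˡ _)
  ^-+ q (suc j) k = trans (cong (q *_) (^-+ q j k)) (sym (ℚₚ.*-assoc q _ _))

  ^-* : ∀ q j k → (q ^ℚ j) ^ℚ k ≡ q ^ℚ (j ℕ.* k)
  ^-* q j zero    = cong (q ^ℚ_) (sym (ℕₚ.*-zeroʳ j))
  ^-* q j (suc k) = trans (cong (q ^ℚ j *_) (^-* q j k))
    (trans (sym (^-+ q j (j ℕ.* k))) (cong (q ^ℚ_) (sym (ℕₚ.*-suc j k))))

  ^-monoʳ : ∀ {q j k} → 1ℚ ≤ q → j ℕ.≤ k → q ^ℚ j ≤ q ^ℚ k
  ^-monoʳ {q} {j} {k} 1≤q j≤k = subst₂ _≤_ (ℚₚ.*-identityʳ _)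
    (trans (sym (^-+ q j (k ℕ.∸ j))) (cong (q ^ℚ_) (ℕₚ.m+[n∸m]≡n j≤k)))
    (*-mono (0≤^ j 0≤q) (0≤^ (k ℕ.∸ j) 0≤q) ℚₚ.≤-refl (1≤^ (k ℕ.∸ j) 1≤q))
    where
    0≤q = ℚₚ.≤-trans 0≤1 1≤q

  -- Bounds for the exponential series by powers of two.

  expSum-mono : ∀ {a b} k → 0ℚ ≤ a → a ≤ b → expSum a k ≤ expSum b k
  expSum-mono zero    _   _   = ℚₚ.≤-refl
  expSum-mono (suc k) 0≤a a≤b = ℚₚ.+-mono-≤ (expSum-mono k 0≤a a≤b)
    (*-mono (0≤^ k 0≤a) (0≤/ 1 (k !) {{k !≢0}}) (^-mono k 0≤a a≤b) ℚₚ.≤-refl)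

  0≤expSum : ∀ {a} k → 0ℚ ≤ a → 0ℚ ≤ expSum a k
  0≤expSum     zero    _   = ℚₚ.≤-refl
  0≤expSum {a} (suc k) 0≤a = ℚₚ.+-mono-≤ (0≤expSum k 0≤a) (0≤* (0≤^ k 0≤a) (0≤/ 1 (k !) {{k !≢0}}))

  -- The rising factorial j (j + 1) ... (j + k - 1). It dominates j^k and is k! times a binomial
  -- coefficient, which gives j^k / k! ≤ 2^(j + k).
  rising : ℕ → ℕ → ℕ
  rising j zero    = 1
  rising j (suc k) = j ℕ.* rising (suc j) k

  rising-last : ∀ j k → rising j (suc k) ≡ rising j k ℕ.* (j ℕ.+ k)
  rising-last j zero    = trans (ℕₚ.*-identityʳ j) (sym (trans (ℕₚ.+-identityʳ (j ℕ.+ 0)) (ℕₚ.+-identityʳ j)))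
  rising-last j (suc k) = trans (cong (j ℕ.*_) (rising-last (suc j) k))
    (trans (sym (ℕₚ.*-assoc j (rising (suc j) k) _))
      (cong (j ℕ.* rising (suc j) k ℕ.*_) (sym (ℕₚ.+-suc j k))))

  ^≤rising : ∀ j k → j ℕ.^ k ℕ.≤ rising j k
  ^≤rising j zero    = ℕₚ.≤-refl
  ^≤rising j (suc k) = ℕₚ.*-monoʳ-≤ j (ℕₚ.≤-trans (ℕₚ.^-monoˡ-≤ k (ℕₚ.n≤1+n j)) (^≤rising (suc j) k))

  -- rising j k / k! is a binomial coefficient; the recursion is Pascal's.
  rising-bound : ∀ j k → rising j k ℕ.≤ k ! ℕ.* 2 ℕ.^ (j ℕ.+ k)
  rising-bound j       zero    = ℕₚ.*-mono-≤ {1} {1} {1} ℕₚ.≤-refl (ℕₚ.m^n>0 2 (j ℕ.+ 0))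
  rising-bound zero    (suc k) = ℕ.z≤n
  rising-bound (suc j) (suc k) = begin
    rising (suc j) (suc k)                                     ≡⟨ rising-last (suc j) k ⟩
    rising (suc j) k ℕ.* (suc j ℕ.+ k)                         ≡⟨ arith₁ (rising (suc j) k) j k ⟩
    rising j (suc k) ℕ.+ suc k ℕ.* rising (suc j) k
      ≤⟨ ℕₚ.+-mono-≤ (rising-bound j (suc k)) (ℕₚ.*-monoʳ-≤ (suc k) (rising-bound (suc j) k)) ⟩
    suc k ! ℕ.* 2 ℕ.^ (j ℕ.+ suc k) ℕ.+ suc k ℕ.* (k ! ℕ.* 2 ℕ.^ (suc j ℕ.+ k))
      ≡⟨ cong (λ i → suc k ! ℕ.* 2 ℕ.^ (j ℕ.+ suc k) ℕ.+ suc k ℕ.* (k ! ℕ.* 2 ℕ.^ i)) (ℕₚ.+-suc j k) ⟨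
    suc k ! ℕ.* 2 ℕ.^ (j ℕ.+ suc k) ℕ.+ suc k ℕ.* (k ! ℕ.* 2 ℕ.^ (j ℕ.+ suc k))
      ≡⟨ arith₂ (suc k) (k !) (2 ℕ.^ (j ℕ.+ suc k)) ⟩
    suc k ! ℕ.* 2 ℕ.^ (suc j ℕ.+ suc k)                        ∎
    where
    open ℕₚ.≤-Reasoning
    arith₁ : ∀ x j k → x ℕ.* (suc j ℕ.+ k) ≡ j ℕ.* x ℕ.+ suc k ℕ.* x
    arith₁ = solve-∀
    arith₂ : ∀ x y z → x ℕ.* y ℕ.* z ℕ.+ x ℕ.* (y ℕ.* z) ≡ x ℕ.* y ℕ.* (2 ℕ.* z)
    arith₂ = solve-∀

  -- At a = j/4 the k-th term is at most 2^(j + k) / 4^k = 2^(j - k), and the geometric series sums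
  -- to 2^(j + 1). `rest k` is the tail of that series from k on; adding it makes the induction
  -- work.
  expSum-upper : ∀ {a} j k → 0ℚ ≤ a → a ≤ + j / 4 → expSum a k ≤ ι (2 ℕ.^ suc j)
  expSum-upper {a} j k 0≤a a≤j/4 = ℚₚ.≤-trans
    (subst (_≤ expSum a k + rest k) (ℚₚ.+-identityʳ _) (ℚₚ.+-monoʳ-≤ (expSum a k) (0≤rest k)))
    (ℚₚ.≤-trans (go k) (ℚₚ.≤-reflexive (/-≡ (2 ℕ.^ suc j) (2 ℕ.^ suc j) 1 1 refl)))
    where
    open ℚₚ.≤-Reasoning
    half rest : ℕ → ℚ
    half k = _/_ (+ (2 ℕ.^ j)) (2 ℕ.^ k) {{m^n≢0 2 k}}
    rest k = _/_ (+ (2 ℕ.^ suc j)) (2 ℕ.^ k) {{m^n≢0 2 k}}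
    0≤rest : ∀ k → 0ℚ ≤ rest k
    0≤rest k = 0≤/ (2 ℕ.^ suc j) (2 ℕ.^ k) {{m^n≢0 2 k}}
    term : ∀ k → a ^ℚ k * (_/_ (+ 1) (k !) {{k !≢0}}) ≤ half k
    term k = begin
      a ^ℚ k * f                                  ≤⟨ *-mono (0≤^ k 0≤a) (0≤/ 1 (k !)) (^-mono k 0≤a a≤j/4) ℚₚ.≤-refl ⟩
      (+ j / 4) ^ℚ k * f                          ≡⟨ cong (_* f) (/-^ j 4 k) ⟩
      (+ (j ℕ.^ k) / (4 ℕ.^ k)) * f               ≡⟨ /-* (j ℕ.^ k) 1 (4 ℕ.^ k) (k !) ⟩
      + (j ℕ.^ k ℕ.* 1) / (4 ℕ.^ k ℕ.* k !)       ≤⟨ /-≤ (j ℕ.^ k ℕ.* 1) (2 ℕ.^ j) (4 ℕ.^ k ℕ.* k !) (2 ℕ.^ k) nat ⟩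
      half k                                      ∎
      where
      instance
        k!≢0 : NonZero (k !)
        k!≢0 = k !≢0
        2^k≢0 : NonZero (2 ℕ.^ k)
        2^k≢0 = m^n≢0 2 k
        4^k≢0 : NonZero (4 ℕ.^ k)
        4^k≢0 = m^n≢0 4 k
        4^*k!≢0 : NonZero (4 ℕ.^ k ℕ.* k !)
        4^*k!≢0 = m*n≢0 (4 ℕ.^ k) (k !)
      f = + 1 / (k !)
      nat : j ℕ.^ k ℕ.* 1 ℕ.* 2 ℕ.^ k ℕ.≤ 2 ℕ.^ j ℕ.* (4 ℕ.^ k ℕ.* k !)
      nat = N.begin
        j ℕ.^ k ℕ.* 1 ℕ.* 2 ℕ.^ k                  N.≡⟨ cong (ℕ._* 2 ℕ.^ k) (ℕₚ.*-identityʳ (j ℕ.^ k)) ⟩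
        j ℕ.^ k ℕ.* 2 ℕ.^ k                        N.≤⟨ ℕₚ.*-monoˡ-≤ (2 ℕ.^ k) (ℕₚ.≤-trans (^≤rising j k) (rising-bound j k)) ⟩
        k ! ℕ.* 2 ℕ.^ (j ℕ.+ k) ℕ.* 2 ℕ.^ k        N.≡⟨ cong (λ x → k ! ℕ.* x ℕ.* 2 ℕ.^ k) (ℕₚ.^-distribˡ-+-* 2 j k) ⟩
        k ! ℕ.* (2 ℕ.^ j ℕ.* 2 ℕ.^ k) ℕ.* 2 ℕ.^ k  N.≡⟨ arith (k !) (2 ℕ.^ j) (2 ℕ.^ k) ⟩
        2 ℕ.^ j ℕ.* (2 ℕ.^ k ℕ.* 2 ℕ.^ k ℕ.* k !)
          N.≡⟨ cong (λ x → 2 ℕ.^ j ℕ.* (x ℕ.* k !)) (trans (sym (ℕₚ.^-distribˡ-+-* 2 k k))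
               (trans (cong (λ x → 2 ℕ.^ (k ℕ.+ x)) (sym (ℕₚ.+-identityʳ k))) (sym (ℕₚ.^-*-assoc 2 2 k)))) ⟩
        2 ℕ.^ j ℕ.* (4 ℕ.^ k ℕ.* k !)              N.∎
        where
        module N = ℕₚ.≤-Reasoning
        arith : ∀ x y z → x ℕ.* (y ℕ.* z) ℕ.* z ≡ y ℕ.* (z ℕ.* z ℕ.* x)
        arith = solve-∀
    halve : ∀ k → half k + rest (suc k) ≡ rest k
    halve k = begin-equality
      half k + rest (suc k)        ≡⟨ cong (λ x → half k + x) (/-≡ (2 ℕ.^ suc j) (2 ℕ.^ j) (2 ℕ.^ suc k) (2 ℕ.^ k) (arith (2 ℕ.^ j) (2 ℕ.^ k))) ⟩
      half k + half k              ≡⟨ cong₂ _+_ (sym (ℚₚ.*-identityˡ (half k))) (sym (ℚₚ.*-identityˡ (half k))) ⟩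
      1ℚ * half k + 1ℚ * half k    ≡⟨ ℚₚ.*-distribʳ-+ (half k) 1ℚ 1ℚ ⟨
      ι 2 * half k                 ≡⟨ /-* 2 (2 ℕ.^ j) 1 (2 ℕ.^ k) ⟩
      + (2 ℕ.^ suc j) / (1 ℕ.* 2 ℕ.^ k)
        ≡⟨ /-≡ (2 ℕ.^ suc j) (2 ℕ.^ suc j) (1 ℕ.* 2 ℕ.^ k) (2 ℕ.^ k)
             (cong (2 ℕ.^ suc j ℕ.*_) (sym (ℕₚ.*-identityˡ (2 ℕ.^ k)))) ⟩
      rest k                       ∎
      where
      instance
        2^k≢0 : NonZero (2 ℕ.^ k)
        2^k≢0 = m^n≢0 2 k
        2^1+k≢0 : NonZero (2 ℕ.^ suc k)
        2^1+k≢0 = m^n≢0 2 (suc k)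
        1*2^k≢0 : NonZero (1 ℕ.* 2 ℕ.^ k)
        1*2^k≢0 = m*n≢0 1 (2 ℕ.^ k)
      arith : ∀ x y → 2 ℕ.* x ℕ.* y ≡ x ℕ.* (2 ℕ.* y)
      arith = solve-∀
    go : ∀ k → expSum a k + rest k ≤ rest 0
    go zero    = ℚₚ.≤-reflexive (ℚₚ.+-identityˡ (rest 0))
    go (suc k) = begin
      expSum a k + t + rest (suc k)        ≡⟨ ℚₚ.+-assoc (expSum a k) t (rest (suc k)) ⟩
      expSum a k + (t + rest (suc k))      ≤⟨ ℚₚ.+-monoʳ-≤ (expSum a k) (ℚₚ.+-monoˡ-≤ (rest (suc k)) (term k)) ⟩
      expSum a k + (half k + rest (suc k)) ≡⟨ cong (λ x → expSum a k + x) (halve k) ⟩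
      expSum a k + rest k                  ≤⟨ go k ⟩
      rest 0                               ∎
      where t = a ^ℚ k * (_/_ (+ 1) (k !) {{k !≢0}})

  -- The single term of index M suffices: (2 M)^M / M! ≥ 2^M because M! ≤ M^M.
  expSum-lower : ∀ M → ι (2 ℕ.^ M) ≤ expSum (ι (2 ℕ.* M)) (suc M)
  expSum-lower M = begin
    ι (2 ℕ.^ M)                                     ≤⟨ /-≤ (2 ℕ.^ M) ((2 ℕ.* M) ℕ.^ M ℕ.* 1) 1 (1 ℕ.* M !) nat ⟩
    + ((2 ℕ.* M) ℕ.^ M ℕ.* 1) / (1 ℕ.* M !)         ≡⟨ /-* ((2 ℕ.* M) ℕ.^ M) 1 1 (M !) ⟨
    ι ((2 ℕ.* M) ℕ.^ M) * f                         ≡⟨ cong (_* f) (ι-^ (2 ℕ.* M) M) ⟨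
    ι (2 ℕ.* M) ^ℚ M * f                            ≡⟨ ℚₚ.+-identityˡ _ ⟨
    0ℚ + ι (2 ℕ.* M) ^ℚ M * f                       ≤⟨ ℚₚ.+-monoˡ-≤ _ (0≤expSum M (0≤/ (2 ℕ.* M) 1)) ⟩
    expSum (ι (2 ℕ.* M)) (suc M)                    ∎
    where
    open ℚₚ.≤-Reasoning
    instance
      M!≢0 : NonZero (M !)
      M!≢0 = M !≢0
      1*M!≢0 : NonZero (1 ℕ.* M !)
      1*M!≢0 = m*n≢0 1 (M !)
    f = + 1 / (M !)
    factorial≤ : ∀ k → k ℕ.≤ M → k ! ℕ.≤ M ℕ.^ k
    factorial≤ zero    _   = ℕₚ.≤-refl
    factorial≤ (suc k) k<M = ℕₚ.*-mono-≤ k<M (factorial≤ k (ℕₚ.<⇒≤ k<M))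
    nat : 2 ℕ.^ M ℕ.* (1 ℕ.* M !) ℕ.≤ (2 ℕ.* M) ℕ.^ M ℕ.* 1 ℕ.* 1
    nat rewrite ℕₚ.*-identityˡ (M !) | ℕₚ.*-identityʳ ((2 ℕ.* M) ℕ.^ M ℕ.* 1)
      | ℕₚ.*-identityʳ ((2 ℕ.* M) ℕ.^ M) =
      ℕₚ.≤-trans (ℕₚ.*-monoʳ-≤ (2 ℕ.^ M) (factorial≤ M ℕₚ.≤-refl)) (ℕₚ.≤-reflexive (sym (^-distribʳ-* M 2 M)))

  -- Estimates for exp, log and powers of cuts.

  Below : (ℚ → Set) → ℚ → Set
  Below S q = q < 0ℚ ⊎ ∃[ s ] S s × q < s

  -- `Below S` unfolds to the lower set of `sup S` with any proof of boundedness, so this lemma and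
  -- the next serve products, `exp`, `log` and powers alike.
  sup-≥ : ∀ {S : ℚ → Set} {s} → S s → ∀ {q} → lower (fromℚ s) q → Below S q
  sup-≥ Ss (inj₁ q<0)              = inj₁ q<0
  sup-≥ Ss (inj₂ (_ , refl , q<s)) = inj₂ (_ , Ss , q<s)

  sup-≤ : ∀ {S : ℚ → Set} {b} → (∀ {s} → S s → s ≤ b) → ∀ {q} → Below S q → lower (fromℚ b) q
  sup-≤ S≤b (inj₁ q<0)            = inj₁ q<0
  sup-≤ S≤b (inj₂ (s , Ss , q<s)) = inj₂ (_ , refl , ℚₚ.<-≤-trans q<s (S≤b Ss))

  fromℚ-mono : ∀ {a b} → a ≤ b → fromℚ a ≤ᴿ fromℚ b
  fromℚ-mono a≤b = sup-≤ λ { refl → a≤b }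

  fromℚ-cancel : ∀ {a b} → 0ℚ ≤ b → fromℚ a ≤ᴿ fromℚ b → a ≤ b
  fromℚ-cancel {a} {b} 0≤b le with a ℚₚ.≤? b
  ... | yes a≤b = a≤b
  ... | no  a≰b with ℚₚ.<-dense (ℚₚ.≰⇒> a≰b)
  ...   | t , b<t , t<a with le (inj₂ (a , refl , t<a))
  ...     | inj₁ t<0              = ⊥-elim (ℚₚ.<-irrefl refl (ℚₚ.<-trans (ℚₚ.≤-<-trans 0≤b b<t) t<0))
  ...     | inj₂ (_ , refl , t<b) = ⊥-elim (ℚₚ.<-irrefl refl (ℚₚ.<-trans b<t t<b))

  fromℕ-mono : ∀ {m n} → m ℕ.≤ n → fromℕ m ≤ᴿ fromℕ n
  fromℕ-mono = fromℚ-mono ∘ ι-mono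

  fromℕ-cancel : ∀ {m n} → fromℕ m ≤ᴿ fromℕ n → m ℕ.≤ n
  fromℕ-cancel {m} {n} = ι-cancel ∘ fromℚ-cancel (0≤/ n 1)

  *ᴿ-≥ : ∀ {x y a b} → 0ℚ ≤ a → 0ℚ ≤ b → fromℚ a ≤ᴿ x → fromℚ b ≤ᴿ y → fromℚ (a * b) ≤ᴿ x *ᴿ y
  *ᴿ-≥ {x} {y} {a} {b} 0≤a 0≤b a≤x b≤y = sup-≥ (a , b , 0≤a , 0≤b , (λ {q} → a≤x {q}) , (λ {q} → b≤y {q}) , refl)

  *ᴿ-≤ : ∀ {x y a b} → 0ℚ ≤ a → 0ℚ ≤ b → x ≤ᴿ fromℚ a → y ≤ᴿ fromℚ b → x *ᴿ y ≤ᴿ fromℚ (a * b)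
  *ᴿ-≤ {x} {y} {a} {b} 0≤a 0≤b x≤a y≤b = sup-≤ λ { (u , v , 0≤u , 0≤v , u≤x , v≤y , refl) →
    *-mono 0≤u 0≤b (fromℚ-cancel 0≤a λ {q} → x≤a ∘ u≤x {q}) (fromℚ-cancel 0≤b λ {q} → y≤b ∘ v≤y {q}) }

  exp-≥ : ∀ {x} M → fromℚ (ι (2 ℕ.* M)) ≤ᴿ x → fromℕ (2 ℕ.^ M) ≤ᴿ exp x
  exp-≥ M le {q} q∈ = sup-≥
    (ι (2 ℕ.* M) , suc M , 0≤/ (2 ℕ.* M) 1 , (λ {q} → le {q}) , refl)
    (fromℚ-mono (expSum-lower M) {q} q∈)

  exp-≤ : ∀ {x} j → x ≤ᴿ fromℚ (+ j / 4) → exp x ≤ᴿ fromℕ (2 ℕ.^ suc j)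
  exp-≤ j le = sup-≤ λ { (a , k , 0≤a , a≤x , refl) →
    expSum-upper j k 0≤a (fromℚ-cancel (0≤/ j 4) λ {q} → le ∘ a≤x {q}) }

  -- `exp-≤` with j = L - 1 gives exp (j/4) ≤ 2^L ≤ n, and L/8 ≤ (L - 1)/4 for L ≥ 2.
  log-≥ : ∀ {L n} → 2 ℕ.≤ L → 2 ℕ.^ L ℕ.≤ n → fromℚ (+ L / 8) ≤ᴿ log (fromℕ n)
  log-≥ {suc j} {n} (ℕ.s≤s 1≤j) 2^L≤n = sup-≥ (0≤/ (suc j) 8 , λ {q} q∈ →
    fromℕ-mono 2^L≤n {q} (exp-≤ {fromℚ (+ suc j / 8)} j (λ {q} → fromℚ-mono (/-≤ (suc j) j 8 4 le) {q}) q∈))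
    where
    open ℕₚ.≤-Reasoning
    le : suc j ℕ.* 4 ℕ.≤ j ℕ.* 8
    le = begin
      suc j ℕ.* 4              ≡⟨ cong (ℕ._+ j ℕ.* 4) (ℕₚ.*-identityˡ 4) ⟨
      1 ℕ.* 4 ℕ.+ j ℕ.* 4      ≤⟨ ℕₚ.+-monoˡ-≤ (j ℕ.* 4) (ℕₚ.*-monoˡ-≤ 4 1≤j) ⟩
      j ℕ.* 4 ℕ.+ j ℕ.* 4      ≡⟨ ℕₚ.*-distribˡ-+ j 4 4 ⟨
      j ℕ.* 8                  ∎

  -- A rational s above 2 M has exp s ≥ 2^M > n by `exp-≥`.
  log-≤ : ∀ {M n} → n ℕ.< 2 ℕ.^ M → log (fromℕ n) ≤ᴿ fromℚ (ι (2 ℕ.* M))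
  log-≤ {M} {n} n<2^M = sup-≤ bound
    where
    bound : ∀ {s} → 0ℚ ≤ s × exp (fromℚ s) ≤ᴿ fromℕ n → s ≤ ι (2 ℕ.* M)
    bound {s} (0≤s , e≤n) with s ℚₚ.≤? ι (2 ℕ.* M)
    ... | yes le = le
    ... | no nle = ⊥-elim (ℕₚ.<-irrefl refl (ℕₚ.<-≤-trans n<2^M
            (fromℕ-cancel {2 ℕ.^ M} {n} λ {q} q∈ → e≤n {q}
              (exp-≥ {fromℚ s} M (λ {q} → fromℚ-mono (ℚₚ.<⇒≤ (ℚₚ.≰⇒> nle)) {q}) {q} q∈))))

  ^ᴿ-≥ : ∀ {x y q s} i d → 0ℚ ≤ q → 0ℚ ≤ s → fromℚ s ≤ᴿ x → fromℚ (+ i / suc d) ≤ᴿ y →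
         q ^ℚ suc d ≤ s ^ℚ i → fromℚ q ≤ᴿ x ^ᴿ y
  ^ᴿ-≥ {s = s} i d 0≤q 0≤s s≤x i/d≤y le =
    sup-≥ (s , i , d , 0≤q , 0≤s , (λ {q} → s≤x {q}) , (λ {q} → i/d≤y {q}) , le)

  ^ᴿ-≤ : ∀ {x y S b} i d → 1ℚ ≤ S → 0ℚ ≤ b → x ≤ᴿ fromℚ S → y ≤ᴿ fromℚ (+ i / suc d) →
         S ^ℚ i ≤ b ^ℚ suc d → x ^ᴿ y ≤ᴿ fromℚ b
  ^ᴿ-≤ {x} {y} {S} {b} i d 1≤S 0≤b x≤S y≤i/d S^i≤b^d = sup-≤ bound
    where
    open ℚₚ.≤-Reasoning
    0≤S = ℚₚ.≤-trans 0≤1 1≤S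
    bound : ∀ {q} → (∃[ s ] ∃[ i ] ∃[ d ] 0ℚ ≤ q × 0ℚ ≤ s × fromℚ s ≤ᴿ x ×
              fromℚ (+ i / suc d) ≤ᴿ y × q ^ℚ suc d ≤ s ^ℚ i) → q ≤ b
    bound {q} (s , i′ , d′ , 0≤q , 0≤s , s≤x , i′/d′≤y , q^d′≤s^i′) =
      -- Both fractions are brought to the common denominator (1 + d′)(1 + d), of which the first
      -- argument is the predecessor. S ≥ 1 allows the larger exponent.
      ^-cancel (d ℕ.+ d′ ℕ.* suc d) 0≤b (begin
        q ^ℚ (suc d′ ℕ.* suc d)       ≡⟨ ^-* q (suc d′) (suc d) ⟨
        (q ^ℚ suc d′) ^ℚ suc d        ≤⟨ ^-mono (suc d) (0≤^ (suc d′) 0≤q) q^d′≤s^i′ ⟩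
        (s ^ℚ i′) ^ℚ suc d            ≡⟨ ^-* s i′ (suc d) ⟩
        s ^ℚ (i′ ℕ.* suc d)           ≤⟨ ^-mono (i′ ℕ.* suc d) 0≤s (fromℚ-cancel 0≤S λ {q} → x≤S ∘ s≤x {q}) ⟩
        S ^ℚ (i′ ℕ.* suc d)
          ≤⟨ ^-monoʳ 1≤S (/-≤⁻ i′ i (suc d′) (suc d) (fromℚ-cancel (0≤/ i (suc d)) λ {q} → y≤i/d ∘ i′/d′≤y {q})) ⟩
        S ^ℚ (i ℕ.* suc d′)           ≡⟨ ^-* S i (suc d′) ⟨
        (S ^ℚ i) ^ℚ suc d′            ≤⟨ ^-mono (suc d′) (0≤^ i 0≤S) S^i≤b^d ⟩
        (b ^ℚ suc d) ^ℚ suc d′        ≡⟨ ^-* b (suc d) (suc d′) ⟩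
        b ^ℚ (suc d ℕ.* suc d′)       ≡⟨ cong (b ^ℚ_) (ℕₚ.*-comm (suc d) (suc d′)) ⟩
        b ^ℚ (suc d′ ℕ.* suc d)       ∎)

  fromℚ-≤ᴿ : ∀ {x a} → lower x a → fromℚ a ≤ᴿ x
  fromℚ-≤ᴿ {x} a∈ (inj₁ q<0)              = negative x q<0
  fromℚ-≤ᴿ {x} a∈ (inj₂ (_ , refl , q<a)) = downward x (ℚₚ.<⇒≤ q<a) a∈

  ≤ᴿ-bound : ∀ {x b} → (∀ {q} → lower x q → q ≤ b) → x ≤ᴿ fromℚ b
  ≤ᴿ-bound {x} ≤b q∈ with rounded x q∈
  ... | s , q<s , s∈ = inj₂ (_ , refl , ℚₚ.<-≤-trans q<s (≤b s∈))

  natural-bound : ∀ x → ∃[ m ] x ≤ᴿ fromℕ m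
  natural-bound x with bounded x
  ... | b@(mkℚ (+ i) d _) , ≤b = i , ≤ᴿ-bound {x} λ q∈ → ℚₚ.≤-trans (≤b q∈)
          (subst (_≤ ι i) (ℚₚ.↥p/↧p≡p b) (/-≤ i i (suc d) 1 (ℕₚ.*-monoʳ-≤ i (ℕ.s≤s ℕ.z≤n))))
  ... | mkℚ -[1+ _ ] _ _ , ≤b = 0 , ≤ᴿ-bound {x} λ q∈ → ℚₚ.≤-trans (≤b q∈) (ℚₚ.nonPositive⁻¹ _)

  -- The rational that witnesses m < x may be m itself; roundedness yields a larger one in the cut,
  -- whose numerator and denominator satisfy the strict inequality.
  fraction-between : ∀ {x} m → fromℕ m <ᴿ x →
                     ∃[ i ] ∃[ d ] m ℕ.* suc d ℕ.< i × fromℚ (+ i / suc d) ≤ᴿ x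
  fraction-between {x} m (q , q∈x , q∉m) with rounded x q∈x
  ... | s , q<s , s∈x = go s s∈x m<s
    where
    m≤q : ι m ≤ q
    m≤q = ℚₚ.≮⇒≥ λ q<m → q∉m (inj₂ (_ , refl , q<m))
    m<s : ι m < s
    m<s = ℚₚ.≤-<-trans m≤q q<s
    go : ∀ s → lower x s → ι m < s → _
    go s@(mkℚ (+ i) d _) s∈x m<s = i , d ,
      ℕₚ.≰⇒> (λ i≤ → ℚₚ.<-irrefl refl (ℚₚ.<-≤-trans m<s (subst (_≤ ι m) (ℚₚ.↥p/↧p≡p s)
        (/-≤ i m (suc d) 1 (ℕₚ.≤-trans (ℕₚ.≤-reflexive (ℕₚ.*-identityʳ i)) i≤))))) ,
      λ {q} → fromℚ-≤ᴿ {x} (subst (lower x) (sym (ℚₚ.↥p/↧p≡p s)) s∈x) {q}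
    go s@(mkℚ -[1+ _ ] _ _) s∈x m<s = ⊥-elim (ℚₚ.<-irrefl refl (ℚₚ.<-≤-trans m<s
      (ℚₚ.≤-trans (ℚₚ.nonPositive⁻¹ s) (0≤/ m 1))))

  1-1/r : ∀ r → 1ℚ - + 1 / suc r ≡ + r / suc r
  1-1/r r = begin
    1ℚ - y             ≡⟨ cong (_- y) sum ⟨
    (x + y) - y        ≡⟨ ℚₚ.+-assoc x y (ℚ.- y) ⟩
    x + (y - y)        ≡⟨ cong (λ z → x + z) (ℚₚ.+-inverseʳ y) ⟩
    x + 0ℚ             ≡⟨ ℚₚ.+-identityʳ x ⟩
    x                  ∎
    where
    open ≡-Reasoning
    x y : ℚ
    x = + r / suc r
    y = + 1 / suc r
    arith : ∀ r → (r ℤ.* (+ 1 ℤ.+ r) ℤ.+ + 1 ℤ.* (+ 1 ℤ.+ r)) ℤ.* + 1 ≡ + 1 ℤ.* ((+ 1 ℤ.+ r) ℤ.* (+ 1 ℤ.+ r))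
    arith = ℤsolve-∀
    sum : x + y ≡ 1ℚ
    sum = ℚₚ.toℚᵘ-injective (ℚᵘₚ.≃-trans (ℚₚ.toℚᵘ-homo-+ x y)
      (ℚᵘₚ.≃-trans (ℚᵘₚ.+-cong (ℚₚ.toℚᵘ-fromℚᵘ (+ r ℚᵘ./ suc r)) (ℚₚ.toℚᵘ-fromℚᵘ (+ 1 ℚᵘ./ suc r)))
        (ℚᵘ.*≡* (arith (+ r)))))

  ι-* : ∀ m n → ι m * ι n ≡ ι (m ℕ.* n)
  ι-* m n = /-* m n 1 1

  0<ᴿ/ : ∀ i d .{{_ : NonZero d}} → 0 ℕ.< i → fromℕ 0 <ᴿ fromℚ (+ i / d)
  0<ᴿ/ i d 0<i = 0ℚ , inj₂ (_ , refl , 0<i/d) , λ { (inj₁ 0<0) → ℚₚ.<-irrefl refl 0<0 ; (inj₂ (_ , refl , 0<0)) → ℚₚ.<-irrefl refl 0<0 }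
    where
    0<i/d : 0ℚ < + i / d
    0<i/d = ℚₚ.≰⇒> λ le → ℕₚ.<-irrefl refl (ℕₚ.<-≤-trans 0<i
      (ℕₚ.≤-trans (ℕₚ.≤-reflexive (sym (ℕₚ.*-identityʳ i))) (/-≤⁻ i 0 d 1 le)))

open Cuts

module Rates where

  open import Data.Nat.Base
  open import Data.Nat.Properties
  open import Data.Nat.Tactic.RingSolver using (solve-∀)
  open import Data.Integer.Base using (+_)
  open import Data.Rational.Base as ℚ using (ℚ; 1ℚ; _-_) renaming (_/_ to _÷_)
  import Data.Rational.Properties as ℚₚ
  open import Data.List.Base using (List)
  open import Data.Vec.Base using (Vec)
  import Data.Vec.Relation.Unary.All as All

  private variable
    l : ℕ

  -- From powers of two to n exp(c (log n)^e).

  module _ (r′ : ℕ) {L n m : ℕ} where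

    -- From log n ≤ 2 (L + 1) ≤ 4 L one gets (log n)^e ≤ 4 B (5 + j) ≤ 24 B j, so c = 1/(96 B) makes
    -- the argument of `exp` at most j/4 and its value at most 2^(j + 1). The offset 4 in 4 + j pays
    -- for this last successor and for the factor 8 = 2^3.
    growth-≤ : ∀ B j .{{_ : NonZero B}} → 1 ≤ j → 1 ≤ L → n < 2 ^ suc L →
               L ^ r′ ≤ B * suc (4 + j) ^ suc r′ → n * 2 ^ (4 + j) ≤ 8 * m →
               growth (fromℚ (_÷_ (+ 1) (96 * B) {{m*n≢0 96 B}})) (+ r′ ÷ suc r′) n ≤ᴿ fromℕ m
    growth-≤ B j 1≤j 1≤L n<2^ L^≤ n2^f≤8m {q} q∈ = fromℚ-mono total {q}
      (*ᴿ-≤ {fromℕ n} {exp (fromℚ c *ᴿ log (fromℕ n) ^ᴿ fromℚ e)} (0≤/ n 1) (0≤/ (2 ^ suc j) 1)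
        (λ q∈ → q∈) (λ {q} → exp-≤ {fromℚ c *ᴿ log (fromℕ n) ^ᴿ fromℚ e} j (λ {q} → scaled {q}) {q}) {q} q∈)
      where
      open ≤-Reasoning
      instance
        96B≢0 : NonZero (96 * B)
        96B≢0 = m*n≢0 96 B
        96B*1≢0 : NonZero (96 * B * 1)
        96B*1≢0 = m*n≢0 (96 * B) 1
      c e : ℚ
      c = + 1 ÷ (96 * B)
      e = + r′ ÷ suc r′
      S b : ℕ
      S = 2 * suc L
      b = 4 * B * suc (4 + j)
      S^≤b^ : S ^ r′ ≤ b ^ suc r′
      S^≤b^ = begin
        S ^ r′                                          ≤⟨ ^-monoˡ-≤ r′ (begin
          2 * suc L      ≤⟨ *-monoʳ-≤ 2 (+-monoˡ-≤ L 1≤L) ⟩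
          2 * (L + L)    ≡⟨ arith L ⟩
          4 * L          ∎) ⟩
        (4 * L) ^ r′                                    ≡⟨ ^-distribʳ-* r′ 4 L ⟩
        4 ^ r′ * L ^ r′                                 ≤⟨ *-mono-≤ (^-monoʳ-≤ 4 (n≤1+n r′)) L^≤ ⟩
        4 ^ suc r′ * (B * suc (4 + j) ^ suc r′)         ≤⟨ *-monoʳ-≤ (4 ^ suc r′) (*-monoˡ-≤ (suc (4 + j) ^ suc r′) (m≤m^n B (suc r′))) ⟩
        4 ^ suc r′ * (B ^ suc r′ * suc (4 + j) ^ suc r′) ≡⟨ *-assoc (4 ^ suc r′) _ _ ⟨
        4 ^ suc r′ * B ^ suc r′ * suc (4 + j) ^ suc r′  ≡⟨ cong (_* suc (4 + j) ^ suc r′) (^-distribʳ-* (suc r′) 4 B) ⟨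
        (4 * B) ^ suc r′ * suc (4 + j) ^ suc r′         ≡⟨ ^-distribʳ-* (suc r′) (4 * B) (suc (4 + j)) ⟨
        b ^ suc r′                                      ∎
        where
        arith : ∀ x → 2 * (x + x) ≡ 4 * x
        arith = solve-∀
      power : log (fromℕ n) ^ᴿ fromℚ e ≤ᴿ fromℚ (ι b)
      power {q} = ^ᴿ-≤ {log (fromℕ n)} {fromℚ e} {ι S} {ι b} r′ r′ (ι-mono {1} {S} (s≤s z≤n)) (0≤/ b 1)
        (λ {q} → log-≤ {suc L} n<2^ {q}) (λ q∈ → q∈)
        (subst₂ ℚ._≤_ (sym (ι-^ S r′)) (sym (ι-^ b (suc r′))) (ι-mono {S ^ r′} {b ^ suc r′} S^≤b^)) {q}
      c*b≤ : c ℚ.* ι b ℚ.≤ + j ÷ 4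
      c*b≤ = subst (ℚ._≤ + j ÷ 4) (sym (/-* 1 b (96 * B) 1)) (/-≤ (1 * b) j (96 * B * 1) 4 (begin
        1 * (4 * B * (5 + j)) * 4       ≡⟨ arith₁ B j ⟩
        16 * B * (5 * 1 + j)            ≤⟨ *-monoʳ-≤ (16 * B) (+-monoˡ-≤ j (*-monoʳ-≤ 5 1≤j)) ⟩
        16 * B * (5 * j + j)            ≡⟨ arith₂ B j ⟩
        j * (96 * B * 1)                ∎))
        where
        arith₁ : ∀ B j → 1 * (4 * B * (5 + j)) * 4 ≡ 16 * B * (5 * 1 + j)
        arith₁ = solve-∀
        arith₂ : ∀ B j → 16 * B * (5 * j + j) ≡ j * (96 * B * 1)
        arith₂ = solve-∀
      scaled : fromℚ c *ᴿ log (fromℕ n) ^ᴿ fromℚ e ≤ᴿ fromℚ (+ j ÷ 4)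
      scaled {q} q∈ = fromℚ-mono c*b≤ {q}
        (*ᴿ-≤ {fromℚ c} {log (fromℕ n) ^ᴿ fromℚ e} (0≤/ 1 (96 * B)) (0≤/ b 1) (λ q∈ → q∈) (λ {q} → power {q}) {q} q∈)
      total : ι n ℚ.* ι (2 ^ suc j) ℚ.≤ ι m
      total = subst (ℚ._≤ ι m) (sym (ι-* n (2 ^ suc j))) (ι-mono {n * 2 ^ suc j} {m} (*-cancelˡ-≤ 8 (begin
        8 * (n * 2 ^ suc j)      ≡⟨ arith n (2 ^ j) ⟩
        n * 2 ^ (4 + j)          ≤⟨ n2^f≤8m ⟩
        8 * m                    ∎)))
        where
        arith : ∀ n x → 8 * (n * (2 * x)) ≡ n * (2 * (2 * (2 * (2 * x))))
        arith = solve-∀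

    -- log n ≥ L/8 turns the bound on e into (log n)^(r′/(r′ + 1)) ≥ e / (8 μ). Times 16 κ μ this is
    -- 2 κ e, and `exp` of it is at least 2^(κ e).
    growth-≥ : ∀ μ κ e .{{_ : NonZero μ}} → 2 ≤ L → 2 ^ L ≤ n → e ^ suc r′ ≤ μ * L ^ r′ →
               m ≤ n * 2 ^ (κ * e) → fromℕ m ≤ᴿ growth (fromℕ (16 * κ * μ)) (+ r′ ÷ suc r′) n
    growth-≥ μ κ e 2≤L 2^L≤n e^≤ m≤ {q} q∈ =
      *ᴿ-≥ {fromℕ n} {exp (fromℕ (16 * κ * μ) *ᴿ log (fromℕ n) ^ᴿ fromℚ y)} {ι n} {ι (2 ^ (κ * e))}
        (0≤/ n 1) (0≤/ (2 ^ (κ * e)) 1) (λ q∈ → q∈)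
        (λ {q} → exp-≥ {fromℕ (16 * κ * μ) *ᴿ log (fromℕ n) ^ᴿ fromℚ y} (κ * e) (λ {q} → scaled {q}) {q}) {q}
        (subst (λ z → lower (fromℚ z) q) (sym (ι-* n (2 ^ (κ * e)))) (fromℕ-mono {m} {n * 2 ^ (κ * e)} m≤ {q} q∈))
      where
      open ≤-Reasoning
      instance
        8μ≢0 : NonZero (8 * μ)
        8μ≢0 = m*n≢0 8 μ
        1*8μ≢0 : NonZero (1 * (8 * μ))
        1*8μ≢0 = m*n≢0 1 (8 * μ)
        8μ^≢0 : NonZero ((8 * μ) ^ suc r′)
        8μ^≢0 = m^n≢0 (8 * μ) (suc r′)
        8^≢0 : NonZero (8 ^ r′)
        8^≢0 = m^n≢0 8 r′
      y : ℚ
      y = + r′ ÷ suc r′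
      s t : ℚ
      s = + L ÷ 8
      t = + e ÷ (8 * μ)
      t^≤s^ : t ^ℚ suc r′ ℚ.≤ s ^ℚ r′
      t^≤s^ = subst₂ ℚ._≤_ (sym (/-^ e (8 * μ) (suc r′))) (sym (/-^ L 8 r′))
        (/-≤ (e ^ suc r′) (L ^ r′) ((8 * μ) ^ suc r′) (8 ^ r′) (begin
          e ^ suc r′ * 8 ^ r′                  ≤⟨ *-mono-≤ e^≤ (^-monoʳ-≤ 8 (n≤1+n r′)) ⟩
          μ * L ^ r′ * 8 ^ suc r′              ≤⟨ *-monoˡ-≤ (8 ^ suc r′) (*-monoˡ-≤ (L ^ r′) (m≤m^n μ (suc r′))) ⟩
          μ ^ suc r′ * L ^ r′ * 8 ^ suc r′     ≡⟨ arith (μ ^ suc r′) (L ^ r′) (8 ^ suc r′) ⟩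
          L ^ r′ * (8 ^ suc r′ * μ ^ suc r′)   ≡⟨ cong (L ^ r′ *_) (^-distribʳ-* (suc r′) 8 μ) ⟨
          L ^ r′ * (8 * μ) ^ suc r′            ∎))
        where
        arith : ∀ x y z → x * y * z ≡ y * (z * x)
        arith = solve-∀
      power : fromℚ t ≤ᴿ log (fromℕ n) ^ᴿ fromℚ y
      power {q} = ^ᴿ-≥ {log (fromℕ n)} {fromℚ y} {t} {s} r′ r′ (0≤/ e (8 * μ)) (0≤/ L 8)
        (λ {q} → log-≥ {L} {n} 2≤L 2^L≤n {q}) (λ q∈ → q∈) t^≤s^ {q}
      product : ι (16 * κ * μ) ℚ.* t ≡ ι (2 * (κ * e))
      product = trans (/-* (16 * κ * μ) e 1 (8 * μ))
        (/-≡ (16 * κ * μ * e) (2 * (κ * e)) (1 * (8 * μ)) 1 (arith κ μ e))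
        where
        arith : ∀ κ μ e → 16 * κ * μ * e * 1 ≡ 2 * (κ * e) * (1 * (8 * μ))
        arith = solve-∀
      scaled : fromℚ (ι (2 * (κ * e))) ≤ᴿ fromℕ (16 * κ * μ) *ᴿ log (fromℕ n) ^ᴿ fromℚ y
      scaled {q} q∈ = *ᴿ-≥ {fromℕ (16 * κ * μ)} {log (fromℕ n) ^ᴿ fromℚ y} {ι (16 * κ * μ)} {t}
        (0≤/ (16 * κ * μ) 1) (0≤/ e (8 * μ)) (λ q∈ → q∈) (λ {q} → power {q}) {q}
        (subst (λ z → lower (fromℚ z) q) (sym product) q∈)

  -- Admissible sets and their minima.

  balanced⇒admissible : ∀ {K d κ μ n p L} → fromℚ (+ suc (suc d) ÷ suc d) ≤ᴿ K →
    (bal : Balanced l (suc d) κ μ n p L) → Admissible K n p (Balanced.A bal)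
  balanced⇒admissible {K = K} {d} le bal = record
    { range = range ; distinct = distinct ; independent = independent ; coprime = coprime
    ; comparable = λ {q} → ^ᴿ-≥ {fromℕ (minimum A)} {K} {ι (maximum A)} {ι (minimum A)} (suc (suc d)) d
        (0≤/ (maximum A) 1) (0≤/ (minimum A) 1) (λ q∈ → q∈) (λ {q} → le {q})
        (subst₂ ℚ._≤_ (sym (ι-^ (maximum A) (suc d))) (sym (ι-^ (minimum A) (suc (suc d)))) (ι-mono {maximum A ^ suc d} {minimum A ^ suc (suc d)} comparable)) {q}
    ; small = small }
    where open Balanced bal

  admissible-maximum : ∀ {K k n p} {A : Vec ℕ (suc l)} → K ≤ᴿ fromℕ k → Admissible K n p A →
                       maximum A ≤ minimum A ^ k
  admissible-maximum {K = K} {k} {A = A} K≤k adm = fromℕ-cancel {maximum A} {minimum A ^ k} λ {q} q∈ →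
    ^ᴿ-≤ {fromℕ (minimum A)} {K} {ι (minimum A)} {ι (minimum A ^ k)} k 0
      (ι-mono {1} {minimum A} (<⇒≤ (≤-minimum (All.map proj₁ range)))) (0≤/ (minimum A ^ k) 1)
      (λ q∈ → q∈) (λ {q} → K≤k {q})
      (ℚₚ.≤-reflexive (trans (ι-^ (minimum A) k) (sym (ℚₚ.*-identityʳ _)))) {q} (comparable {q} q∈)
    where open Admissible adm

  -- Infinite descent: if no value were minimal, every value could be undercut, and b bounds the
  -- number of times.
  minimum-exists : ∀ {X : Set} {P : X → Set} (f : X → ℕ) {x} → P x → ¬ ¬ (∃[ m ] IsMinimum P f m)
  minimum-exists {P = P} f {x} Px ¬min = below (f x) Px ≤-refl
    where
    below : ∀ b {x} → P x → f x ≤ b → ⊥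
    below zero    {x} Px fx≤0 = ¬min (f x , (x , Px , refl) , λ y _ → ≤-trans fx≤0 z≤n)
    below (suc b) {x} Px fx≤b = ¬min (f x , (x , Px , refl) , λ y Py →
      ≮⇒≥ λ fy<fx → below b Py (s≤s⁻¹ (≤-trans fy<fx fx≤b)))

  -- The exponent bounds are compared through L, of which e is at most of order
  -- L^(1/2) and f at least of order L^((r − 1)/r).
  separation : ∀ t α β κ M {L e f} → 0 < e →
    (β * (κ + M + 3) ^ (3 + t)) * (β * (κ + M + 3) ^ (3 + t)) * α ^ (3 + t) < L →
    e ^ 2 ≤ α * L ^ 1 → L ^ (2 + t) ≤ β * suc f ^ (3 + t) → κ * e + M + 3 ≤ f
  separation t α β κ M {L} {e} {f} 0<e large e²≤ L^≤ = ≮⇒≥ λ f< → <-irrefl refl (<-≤-trans large (begin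
    L                                    ≤⟨ m≤m^n L (1 + t) ⟩
    -- With r = 3 + t, squaring L^(r - 1) ≤ γ e^r makes e² ≤ α L applicable; after cancelling L^r
    -- there remains L^(r - 2), a positive power exactly because r ≥ 3.
    L ^ (1 + t)
      ≤⟨ *-cancelʳ-≤ (L ^ (1 + t)) _ (L ^ r) (begin
        L ^ (1 + t) * L ^ r                ≡⟨ ^-distribˡ-+-* L (1 + t) r ⟨
        L ^ (1 + t + (3 + t))              ≡⟨ cong (L ^_) (index t) ⟩
        L ^ (2 + t + (2 + t))              ≡⟨ ^-distribˡ-+-* L (2 + t) (2 + t) ⟩
        L ^ (2 + t) * L ^ (2 + t)          ≤⟨ *-mono-≤ (power f<) (power f<) ⟩
        γ * e ^ r * (γ * e ^ r)            ≡⟨ arith γ (e ^ r) ⟩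
        γ * γ * (e ^ r * e ^ r)            ≡⟨ cong (γ * γ *_) (^-distribʳ-* r e e) ⟨
        γ * γ * (e * e) ^ r                ≤⟨ *-monoʳ-≤ (γ * γ) (^-monoˡ-≤ r e*e≤) ⟩
        γ * γ * (α * L) ^ r                ≡⟨ cong (γ * γ *_) (^-distribʳ-* r α L) ⟩
        γ * γ * (α ^ r * L ^ r)            ≡⟨ *-assoc (γ * γ) (α ^ r) (L ^ r) ⟨
        γ * γ * α ^ r * L ^ r              ∎) ⟩
    γ * γ * α ^ r                        ∎))
    where
    open ≤-Reasoning
    r = 3 + t
    γ = β * (κ + M + 3) ^ r
    instance
      L≢0 : NonZero L
      L≢0 = >-nonZero (≤-<-trans z≤n large)
      L^r≢0 : NonZero (L ^ r)
      L^r≢0 = m^n≢0 L r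
    index : ∀ t → 1 + t + (3 + t) ≡ 2 + t + (2 + t)
    index = solve-∀
    arith : ∀ x y → x * y * (x * y) ≡ x * x * (y * y)
    arith = solve-∀
    e*e≤ : e * e ≤ α * L
    e*e≤ = begin
      e * e          ≡⟨ cong (e *_) (*-identityʳ e) ⟨
      e ^ 2          ≤⟨ e²≤ ⟩
      α * L ^ 1      ≡⟨ cong (α *_) (*-identityʳ L) ⟩
      α * L          ∎
    power : f < κ * e + M + 3 → L ^ (2 + t) ≤ γ * e ^ r
    power f< = begin
      L ^ (2 + t)                          ≤⟨ L^≤ ⟩
      β * suc f ^ r                        ≤⟨ *-monoʳ-≤ β (^-monoˡ-≤ r (begin
        suc f                    ≤⟨ f< ⟩
        κ * e + M + 3            ≡⟨ arith₁ (κ * e) M ⟩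
        κ * e + (M + 3) * 1      ≤⟨ +-monoʳ-≤ (κ * e) (*-monoʳ-≤ (M + 3) 0<e) ⟩
        κ * e + (M + 3) * e      ≡⟨ arith₂ κ M e ⟩
        (κ + M + 3) * e          ∎)) ⟩
      β * ((κ + M + 3) * e) ^ r            ≡⟨ cong (β *_) (^-distribʳ-* r (κ + M + 3) e) ⟩
      β * ((κ + M + 3) ^ r * e ^ r)        ≡⟨ *-assoc β _ (e ^ r) ⟨
      γ * e ^ r                            ∎
      where
      arith₁ : ∀ x M → x + M + 3 ≡ x + (M + 3) * 1
      arith₁ = solve-∀
      arith₂ : ∀ κ M e → κ * e + (M + 3) * e ≡ (κ + M + 3) * e
      arith₂ = solve-∀

  log-bounds⇒ : ∀ {c₁ c₂ d B n p L} → fromℚ (+ 1 ÷ suc d) ≤ᴿ c₁ → c₂ ≤ᴿ fromℕ B →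
    2 ≤ L → 2 ^ L ≤ n → n < 2 ^ suc L →
    c₁ *ᴿ log (fromℕ n) ≤ᴿ fromℕ p × fromℕ p ≤ᴿ c₂ *ᴿ log (fromℕ n) →
    L ≤ suc d * 8 * p × p ≤ suc (4 * B) * L
  log-bounds⇒ {c₁} {c₂} {d} {B} {n} {p} {L} ≤c₁ c₂≤ 2≤L 2^L≤n n<2^ (low , high) = L≤ , p≤
    where
    open ≤-Reasoning
    L≤ : L ≤ suc d * 8 * p
    L≤ = begin
      L                      ≡⟨ trans (sym (*-identityˡ L)) (sym (*-identityʳ (1 * L))) ⟩
      1 * L * 1              ≤⟨ /-≤⁻ (1 * L) p (suc d * 8) 1 (subst (ℚ._≤ ι p) (/-* 1 L (suc d) 8)
                                  (fromℚ-cancel (0≤/ p 1) λ {q} q∈ → low {q}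
                                    (*ᴿ-≥ {c₁} {log (fromℕ n)} (0≤/ 1 (suc d)) (0≤/ L 8) (λ {q} → ≤c₁ {q})
                                      (λ {q} → log-≥ {L} {n} 2≤L 2^L≤n {q}) {q} q∈))) ⟩
      p * (suc d * 8)        ≡⟨ *-comm p _ ⟩
      suc d * 8 * p          ∎
    p≤ : p ≤ suc (4 * B) * L
    p≤ = begin
      p                      ≤⟨ fromℕ-cancel {p} {B * (2 * suc L)} (λ {q} q∈ →
                                  subst (λ z → lower (fromℚ z) q) (ι-* B (2 * suc L))
                                    (*ᴿ-≤ {c₂} {log (fromℕ n)} (0≤/ B 1) (0≤/ (2 * suc L) 1) (λ {q} → c₂≤ {q})
                                      (λ {q} → log-≤ {suc L} n<2^ {q}) {q} (high {q} q∈))) ⟩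
      B * (2 * suc L)        ≤⟨ *-monoʳ-≤ B (*-monoʳ-≤ 2 (+-monoˡ-≤ L (<⇒≤ 2≤L))) ⟩
      B * (2 * (L + L))      ≡⟨ arith B L ⟩
      -- The successor makes the constant positive by its form, as `spread` requires.
      4 * B * L              ≤⟨ m≤n+m (4 * B * L) L ⟩
      suc (4 * B) * L        ∎
      where
      arith : ∀ B L → B * (2 * (L + L)) ≡ 4 * B * L
      arith = solve-∀

  large-log : ∀ L₀ n → 2 ^ L₀ ≤ n → ∃[ L ] L₀ ≤ L × 2 ^ L ≤ n × n < 2 ^ suc L
  large-log L₀ n 2^L₀≤n with binary-log n (≤-trans (m^n>0 2 L₀) 2^L₀≤n)
  ... | L , 2^L≤n , n< = L , s≤s⁻¹ (^-cancelʳ-< 2 ≤-refl (≤-<-trans 2^L₀≤n n<)) , 2^L≤n , n<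

  -- `growth-≤` needs f = 4 + j with j ≥ 1; a smaller f would bound L.
  exponent≥5 : ∀ t β f {L} → 1 ≤ L → β * 6 ^ (2 + t) < L → L ^ suc t ≤ β * suc f ^ (2 + t) → 5 ≤ f
  exponent≥5 t β f {L} 1≤L 6^<L L^≤ = ≮⇒≥ λ f<5 → <-irrefl refl (begin-strict
    β * 6 ^ (2 + t)       <⟨ 6^<L ⟩
    L                     ≤⟨ m≤m^n L (suc t) {{>-nonZero 1≤L}} ⟩
    L ^ suc t             ≤⟨ L^≤ ⟩
    β * suc f ^ (2 + t)   ≤⟨ *-monoʳ-≤ β (^-monoˡ-≤ (2 + t) (≤-trans f<5 (n≤1+n 5))) ⟩
    β * 6 ^ (2 + t)       ∎)
    where open ≤-Reasoning

  -- Both bounds for a fixed number of generators.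

  exponent : ℕ → ℚ
  exponent r″ = + suc r″ ÷ suc (suc r″)

  RateBetween : (c₁ c₂ : ℝ≥0) → ℕ → ℝ≥0 → ℚ → Set₁
  RateBetween c₁ c₂ r K e = ∃[ c ] ∃[ c′ ] fromℕ 0 <ᴿ c × fromℕ 0 <ᴿ c′ ×
    (∀ (p : ℕ → ℕ) → LogBounds c₁ c₂ p → Eventually λ n →
       MinimumBetween (Admissible {r} K n (p n)) (λ A → W n (grid A n)) (growth c e n) (growth c′ e n) ×
       MinimumBetween (Admissible {r} K n (p n)) (λ A → C n (grid A n)) (growth c e n) (growth c′ e n))

  -- Of the sizes of K, c₁ and c₂ only these bounds are used, and the constants below are computed
  -- from d, k, d₁, B and the number of generators; so they are fixed before p.
  module Setting (K c₁ c₂ : ℝ≥0) (d k d₁ B : ℕ)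
    (≤K : fromℚ (+ suc (suc d) ÷ suc d) ≤ᴿ K) (K≤ : K ≤ᴿ fromℕ k)
    (≤c₁ : fromℚ (+ 1 ÷ suc d₁) ≤ᴿ c₁) (c₂≤ : c₂ ≤ᴿ fromℕ B) where

    private
      D₁ = suc d₁ * 8
      D₂ = suc (4 * B)

    module Rank (r″ : ℕ) where

      -- κ, μ and β are successors so that they are nonzero. The last summand of the threshold is
      -- for `exponent≥5`.
      rank κ μ β threshold : ℕ
      rank = suc (suc r″)
      κ = suc (balancedCost r″ D₁ (suc d))
      μ = suc (balancedBound r″ D₁ (suc d))
      β = suc (spreadBound (suc r″) D₂ k)
      threshold = balancedThreshold r″ D₁ (suc d) + 2 + suc (β * 6 ^ rank)

      c c′ : ℝ≥0
      c  = fromℚ (+ 1 ÷ (96 * β))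
      c′ = fromℕ (16 * κ * μ)

      module _ {n p L : ℕ} (2^L≤n : 2 ^ L ≤ n) (n<2^1+L : n < 2 ^ suc L) (large : threshold ≤ L)
        (bounds : c₁ *ᴿ log (fromℕ n) ≤ᴿ fromℕ p × fromℕ p ≤ᴿ c₂ *ᴿ log (fromℕ n)) where

        2≤L : 2 ≤ L
        2≤L = ≤-trans (≤-trans (m≤n+m 2 (balancedThreshold r″ D₁ (suc d))) (m≤m+n _ _)) large

        L-bounds : L ≤ D₁ * p × p ≤ D₂ * L
        L-bounds = log-bounds⇒ {c₁} {c₂} {d₁} {B} (λ {q} → ≤c₁ {q}) (λ {q} → c₂≤ {q})
          2≤L 2^L≤n n<2^1+L bounds

        cheap : ∃[ A ] ∃[ e ] Admissible {rank} K n p A × 0 < e × e ^ rank ≤ μ * L ^ suc r″ ×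
                C n (grid A n) ≤ n * 2 ^ (κ * e)
        cheap = A , e , balanced⇒admissible {K = K} {d} (λ {q} → ≤K {q}) bal , e>0 ,
          ≤-trans e-bound (*-monoˡ-≤ (L ^ suc r″) (n≤1+n (balancedBound r″ D₁ (suc d)))) ,
          ≤-trans cost (*-monoʳ-≤ n (^-monoʳ-≤ 2 (*-monoˡ-≤ e (n≤1+n (balancedCost r″ D₁ (suc d))))))
          where
          bal = balanced r″ D₁ (suc d) 2^L≤n n<2^1+L
            (≤-trans (≤-trans (m≤m+n _ 2) (m≤m+n _ _)) large) (proj₁ L-bounds)
          open Balanced bal

        costly : ∀ A → Admissible {rank} K n p A →
                 ∃[ f ] 5 ≤ f × L ^ suc r″ ≤ β * suc f ^ rank × n * 2 ^ f ≤ 8 * W n (grid A n)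
        costly A adm =
          let f , L^≤ , n2^f≤ = spread (suc r″) D₂ k z<s (<⇒≤ 2≤L) 2^L≤n range independent
                (admissible-maximum {K = K} {k} (λ {q} → K≤ {q}) adm) small (proj₂ L-bounds)
              L^≤′ = ≤-trans L^≤ (*-monoˡ-≤ (suc f ^ rank) (n≤1+n (spreadBound (suc r″) D₂ k)))
          in f , exponent≥5 r″ β f (<⇒≤ 2≤L) 6^<L L^≤′ , L^≤′ , n2^f≤
          where
          open Admissible adm
          6^<L : β * 6 ^ rank < L
          6^<L = ≤-trans (m≤n+m (suc (β * 6 ^ rank)) (balancedThreshold r″ D₁ (suc d) + 2)) large

        -- W and C are handled at once: the lower bound holds for W, the upper bound for C, and
        -- every cost between them inherits both.
        module _ (cost : ℕ → List ℕ → ℕ) (W≤ : ∀ n H → W n H ≤ cost n H) (≤C : ∀ n H → cost n H ≤ C n H) where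

          minimum≤ : ∀ {m} → IsMinimum (Admissible {rank} K n p) (λ A → cost n (grid A n)) m →
                     ∃[ e ] 0 < e × e ^ rank ≤ μ * L ^ suc r″ × m ≤ n * 2 ^ (κ * e)
          minimum≤ (_ , least) =
            let A , e , adm , 0<e , e^≤ , C≤ = cheap
            in e , 0<e , e^≤ , ≤-trans (least A adm) (≤-trans (≤C n (grid A n)) C≤)

          minimum≥ : ∀ {m} → IsMinimum (Admissible {rank} K n p) (λ A → cost n (grid A n)) m →
                     ∃[ f ] 5 ≤ f × L ^ suc r″ ≤ β * suc f ^ rank × n * 2 ^ f ≤ 8 * m
          minimum≥ ((A , adm , refl) , _) =
            let f , 5≤f , L^≤ , n2^f≤ = costly A adm
            in f , 5≤f , L^≤ , ≤-trans n2^f≤ (*-monoʳ-≤ 8 (W≤ n (grid A n)))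

          minimum-between : MinimumBetween (Admissible {rank} K n p) (λ A → cost n (grid A n))
            (growth c (exponent r″) n)
            (growth c′ (exponent r″) n)
          minimum-between = record
            { exists = minimum-exists (λ A → cost n (grid A n)) (proj₁ (proj₂ (proj₂ cheap)))
            ; bounds = λ m min → (λ {q} → lower-bound m min {q}) , (λ {q} → upper-bound m min {q})
            }
            where
            lower-bound : ∀ m → IsMinimum (Admissible {rank} K n p) (λ A → cost n (grid A n)) m →
                          growth c (exponent r″) n ≤ᴿ fromℕ m
            lower-bound m min {q} =
              let f , 5≤f , L^≤ , n2^f≤ = minimum≥ min
                  f≡ = sym (m+[n∸m]≡n (<⇒≤ 5≤f))
              in growth-≤ (suc r″) {m = m} β (f ∸ 4) (∸-monoˡ-≤ 4 5≤f) (<⇒≤ 2≤L) n<2^1+L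
                   (subst (λ f → L ^ suc r″ ≤ β * suc f ^ rank) f≡ L^≤)
                   (subst (λ f → n * 2 ^ f ≤ 8 * m) f≡ n2^f≤) {q}
            upper-bound : ∀ m → IsMinimum (Admissible {rank} K n p) (λ A → cost n (grid A n)) m →
                          fromℕ m ≤ᴿ growth c′ (exponent r″) n
            upper-bound m min {q} =
              let e , _ , e^≤ , m≤ = minimum≤ min
              in growth-≥ (suc r″) {m = m} μ κ e 2≤L 2^L≤n e^≤ m≤ {q}

      minimum-cost-rate : RateBetween c₁ c₂ rank K (exponent r″)
      minimum-cost-rate = c , c′ , 0<ᴿ/ 1 (96 * β) z<s , 0<ᴿ/ (16 * κ * μ) 1 z<s ,
        λ p (N , bounds) → N + 2 ^ threshold , λ n N≤n →
          let L , large , 2^L≤n , n< = large-log threshold n (≤-trans (m≤n+m (2 ^ threshold) N) N≤n)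
              bs = bounds n (≤-trans (m≤m+n N (2 ^ threshold)) N≤n)
          in minimum-between 2^L≤n n< large bs W (λ _ _ → ≤-refl) W≤C ,
             minimum-between 2^L≤n n< large bs C W≤C (λ _ _ → ≤-refl)

    -- The factor M is absorbed by 2^M and the factor 8 of the lower bound by 2^3, so it suffices
    -- that κ e + M + 3 ≤ f, which is `separation`.
    two-generators-beat : ∀ t p → LogBounds c₁ c₂ p →
      ∀ (cost : ℕ → List ℕ → ℕ) → (∀ n H → W n H ≤ cost n H) → (∀ n H → cost n H ≤ C n H) →
      TwoGeneratorsBeat (3 + t) K p cost
    two-generators-beat t p (N , bounds) cost W≤ ≤C M = N + 2 ^ L₀ , λ n N≤n m₂ mᵣ min₂ minᵣ →
      let L , large , 2^L≤n , n< = large-log L₀ n (≤-trans (m≤n+m _ N) N≤n)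
          bs = bounds n (≤-trans (m≤m+n N _) N≤n)
          e , 0<e , e²≤ , m₂≤ = R₂.minimum≤ 2^L≤n n<
            (≤-trans (≤-trans (m≤m+n _ _) (m≤m+n _ _)) large) bs cost W≤ ≤C min₂
          f , _ , L^≤ , ≤mᵣ = Rᵣ.minimum≥ 2^L≤n n<
            (≤-trans (≤-trans (m≤n+m _ R₂.threshold) (m≤m+n _ _)) large) bs cost W≤ ≤C minᵣ
          κe≤f = separation t R₂.μ Rᵣ.β R₂.κ M 0<e
            (≤-trans (m≤n+m _ (R₂.threshold + Rᵣ.threshold)) large) e²≤ L^≤
      in *-cancelˡ-≤ 8 (begin
        8 * (M * m₂)                          ≤⟨ *-monoʳ-≤ 8 (*-mono-≤ (<⇒≤ (n<2^n M)) m₂≤) ⟩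
        8 * (2 ^ M * (n * 2 ^ (R₂.κ * e)))    ≡⟨ arith (2 ^ M) n (2 ^ (R₂.κ * e)) ⟩
        n * (2 ^ (R₂.κ * e) * 2 ^ M * 2 ^ 3)  ≡⟨ cong (λ x → n * (x * 2 ^ 3)) (^-distribˡ-+-* 2 (R₂.κ * e) M) ⟨
        n * (2 ^ (R₂.κ * e + M) * 2 ^ 3)      ≡⟨ cong (n *_) (^-distribˡ-+-* 2 (R₂.κ * e + M) 3) ⟨
        n * 2 ^ (R₂.κ * e + M + 3)            ≤⟨ *-monoʳ-≤ n (^-monoʳ-≤ 2 κe≤f) ⟩
        n * 2 ^ f                             ≤⟨ ≤mᵣ ⟩
        8 * mᵣ                                ∎)
      where
      open ≤-Reasoning
      module R₂ = Rank 0
      module Rᵣ = Rank (suc t)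
      L₁ = Rᵣ.β * (R₂.κ + M + 3) ^ (3 + t) * (Rᵣ.β * (R₂.κ + M + 3) ^ (3 + t)) * R₂.μ ^ (3 + t)
      -- Beyond L₀ both numbers of generators are past their thresholds and L exceeds the bound of
      -- `separation`.
      L₀ = R₂.threshold + Rᵣ.threshold + suc L₁
      arith : ∀ x n y → 8 * (x * (n * y)) ≡ n * (y * x * 8)
      arith = solve-∀

  -- From real parameters to the three statements.

  fractions : ∀ {K c₁} → fromℕ 1 <ᴿ K → fromℕ 0 <ᴿ c₁ →
    (∃[ d ] fromℚ (+ suc (suc d) ÷ suc d) ≤ᴿ K) × (∃[ d₁ ] fromℚ (+ 1 ÷ suc d₁) ≤ᴿ c₁)
  fractions {K} {c₁} 1<K 0<c₁ =
    let i , d , 1+d<i , i/d≤K = fraction-between {K} 1 1<K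
        j , e , 0<j , j/e≤c₁ = fraction-between {c₁} 0 0<c₁
    in (d , λ {q} q∈ → i/d≤K {q} (fromℚ-mono (/-≤ (suc (suc d)) i (suc d) (suc d)
              (*-monoˡ-≤ (suc d) (subst (_< i) (*-identityˡ (suc d)) 1+d<i))) {q} q∈)) ,
       (e , λ {q} q∈ → j/e≤c₁ {q} (fromℚ-mono (/-≤ 1 j (suc e) (suc e) (*-monoˡ-≤ (suc e) 0<j)) {q} q∈))

  -- With e a variable, Agda need not compare two different rational
  -- expressions inside the cuts, which it would do by unfolding them.
  rate : ∀ r″ {e} → e ≡ exponent r″ → ∀ K → fromℕ 1 <ᴿ K → MinimumCostRate (suc (suc r″)) K e
  rate r″ refl K 1<K c₁ c₂ 0<c₁ _ =
    let (d , ≤K) , (d₁ , ≤c₁) = fractions {K} {c₁} 1<K 0<c₁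
        k , K≤ = natural-bound K
        B , c₂≤ = natural-bound c₂
    in Setting.Rank.minimum-cost-rate K c₁ c₂ d k d₁ B
         (λ {q} → ≤K {q}) (λ {q} → K≤ {q}) (λ {q} → ≤c₁ {q}) (λ {q} → c₂≤ {q}) r″

  two-generators-cheaper : ∀ K → fromℕ 1 <ᴿ K → ∀ c₁ c₂ → fromℕ 0 <ᴿ c₁ → ∀ t p → LogBounds c₁ c₂ p →
    ∀ (cost : ℕ → List ℕ → ℕ) → (∀ n H → W n H ≤ cost n H) → (∀ n H → cost n H ≤ C n H) →
    TwoGeneratorsBeat (3 + t) K p cost
  two-generators-cheaper K 1<K c₁ c₂ 0<c₁ =
    let (d , ≤K) , (d₁ , ≤c₁) = fractions {K} {c₁} 1<K 0<c₁
        k , K≤ = natural-bound K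
        B , c₂≤ = natural-bound c₂
    in Setting.two-generators-beat K c₁ c₂ d k d₁ B
         (λ {q} → ≤K {q}) (λ {q} → K≤ {q}) (λ {q} → ≤c₁ {q}) (λ {q} → c₂≤ {q})

  general-rate : ∀ r .{{_ : NonZero r}} → 2 ≤ r → ∀ K → fromℕ 1 <ᴿ K → MinimumCostRate r K (1ℚ - + 1 ÷ r)
  general-rate (suc (suc r″)) _ = rate r″ (1-1/r (suc r″))
  general-rate (suc zero) (s≤s ())

  rate-2-3-4 : ∀ K → fromℕ 1 <ᴿ K →
    MinimumCostRate 2 K (+ 1 ÷ 2) × MinimumCostRate 3 K (+ 2 ÷ 3) × MinimumCostRate 4 K (+ 3 ÷ 4)
  rate-2-3-4 K 1<K =
    rate 0 {+ 1 ÷ 2} refl K 1<K , rate 1 {+ 2 ÷ 3} refl K 1<K , rate 2 {+ 3 ÷ 4} refl K 1<K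

  two-generators-optimal : ∀ r → 3 ≤ r → ∀ K → fromℕ 1 <ᴿ K →
    ∀ c₁ c₂ → fromℕ 0 <ᴿ c₁ → fromℕ 0 <ᴿ c₂ → ∀ p → LogBounds c₁ c₂ p →
    TwoGeneratorsBeat r K p W × TwoGeneratorsBeat r K p C
  two-generators-optimal (suc (suc (suc t))) _ K 1<K c₁ c₂ 0<c₁ _ p bounds =
    two-generators-cheaper K 1<K c₁ c₂ 0<c₁ t p bounds W (λ _ _ → ≤-refl) W≤C ,
    two-generators-cheaper K 1<K c₁ c₂ 0<c₁ t p bounds C W≤C (λ _ _ → ≤-refl)
  two-generators-optimal (suc zero)       (s≤s ())
  two-generators-optimal (suc (suc zero)) (s≤s (s≤s ()))

open Rates

open import Data.Nat.Base using (ℕ; NonZero; _≤_)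
open import Data.Integer.Base using (+_)
open import Data.Rational.Base using (1ℚ; _/_; _-_)

corollary3p2 : ((r : ℕ) .{{_ : NonZero r}} → 2 ≤ r → (K : ℝ≥0) → fromℕ 1 <ᴿ K →
    MinimumCostRate r K (1ℚ - + 1 / r))
    × ((K : ℝ≥0) → fromℕ 1 <ᴿ K →
    MinimumCostRate 2 K (+ 1 / 2) ×
    MinimumCostRate 3 K (+ 2 / 3) ×
    MinimumCostRate 4 K (+ 3 / 4))
    × ((r : ℕ) → 3 ≤ r → (K : ℝ≥0) → fromℕ 1 <ᴿ K →
    (c₁ c₂ : ℝ≥0) → fromℕ 0 <ᴿ c₁ → fromℕ 0 <ᴿ c₂ →
    (p : ℕ → ℕ) → LogBounds c₁ c₂ p →
    TwoGeneratorsBeat r K p W × TwoGeneratorsBeat r K p C)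
corollary3p2 = general-rate , rate-2-3-4 , two-generators-optimal
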